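{- For a positive integer $k$, let $N_k$ be the maximum size of a $k$-nice set. There exists $k_0$ such that for every integer $k\ge k_0$, \[ N_k = \begin{cases} k+4 &\text{ if } k \bmod 6 = 2,\\ k+3 &\text{ if } k \bmod 6\in\{1,3,5\},\\ k+2 &\text{ otherwise.} \end{cases} \]
   Context: For a positive integer $k$, a set $Q\subseteq\mathbb{Z}^2$ is $k$-nice if (i) every element $(m,n)\in Q$ is non-zero with $\gcd(m,n)=1$; (ii) $Q$ does not contain both $(m,n)$ and $(-m,-n)$ for any $(m,n)\in\mathbb{Z}^2$; and (iii) $|mn'-m'n|\le k$ for all $(m,n),(m',n')\in Q$. -}

module Defs where

open import Data.Integer using (ℤ; 0ℤ; 1ℤ; -_; _-_; _*_; ∣_∣)
open import Data.Integer.GCD using (gcd)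
open import Data.List using (List; length)
open import Data.List.Membership.Propositional using (_∈_)
open import Data.List.Relation.Unary.All using (All)
open import Data.List.Relation.Unary.Unique.Propositional using (Unique)
open import Data.Nat using (ℕ; _+_; _≤_; _%_)
open import Data.Product using (_×_; _,_; ∃-syntax)
open import Function.Bundles using (_⇔_)
open import Level using (0ℓ)
open import Relation.Binary.PropositionalEquality using (_≡_; _≢_)
open import Relation.Nullary using (¬_)
open import Relation.Unary using (Pred)

ℤ² : Set
ℤ² = ℤ × ℤ

record IsNice (k : ℕ) (Q : Pred ℤ² 0ℓ) : Set where
  field
    nonZero     : ∀ {m n} → Q (m , n) → (m , n) ≢ (0ℤ , 0ℤ)
    coprime     : ∀ {m n} → Q (m , n) → gcd m n ≡ 1ℤ
    noAntipodes : ∀ m n → ¬ (Q (m , n) × Q (- m , - n))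
    detBound    : ∀ {m n m′ n′} → Q (m , n) → Q (m′ , n′) →
                  ∣ m * n′ - m′ * n ∣ ≤ k

HasSize : Pred ℤ² 0ℓ → ℕ → Set
HasSize Q s = ∃[ xs ] Unique xs × (∀ p → p ∈ xs ⇔ Q p) × length xs ≡ s

-- Phrased through duplicate-free lists of elements, so that it also makes sense
-- for (and excludes) infinite Q, and needs no decidability of membership.
SizeAtMost : Pred ℤ² 0ℓ → ℕ → Set
SizeAtMost Q s = ∀ (xs : List ℤ²) → Unique xs → All Q xs → length xs ≤ s

-- N is the maximum size N_k of a k-nice set.
record IsMaxNiceSize (k N : ℕ) : Set₁ where
  field
    attained   : ∃[ Q ] IsNice k Q × HasSize Q N
    upperBound : ∀ Q → IsNice k Q → SizeAtMost Q N

closedForm : ℕ → ℕ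
closedForm k with k % 6
... | 2 = k + 4
... | 1 = k + 3
... | 3 = k + 3
... | 5 = k + 3
... | _ = k + 2

{-# OPTIONS --safe #-}
module Submission where

open import Data.Empty using (⊥)
open import Data.Fin using (Fin; toℕ; fromℕ<)
open import Data.Fin.Properties using (pigeonhole; toℕ<n; toℕ-fromℕ<)
open import Data.Integer using (ℤ; 0ℤ; 1ℤ; -_; +_; -[1+_]; ∣_∣; +≤+; -≤+; drop‿+≤+; _⊖_) renaming (_+_ to _+ᶻ_; _-_ to _-ᶻ_; _*_ to _*ᶻ_; _≤_ to _≤ᶻ_; suc to sucᶻ)
open import Data.Integer.DivMod using (_/ℕ_; _%ℕ_; a≡a%ℕn+[a/ℕn]*n; n%ℕd<d; n<s[n/ℕd]*d)
import Data.Integer.Divisibility.Signed as Signed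
open import Data.Integer.GCD using () renaming (gcd to gcdᶻ)
import Data.Integer.Properties as ℤ
import Data.Integer.Tactic.RingSolver as ℤ-Solver
open import Data.List using (List; []; _∷_; length; map; _++_; applyUpTo)
open import Data.List.Membership.Propositional using (_∈_; find)
open import Data.List.Membership.Propositional.Properties using (∈-map⁻; ∈-applyUpTo⁻)
open import Data.List.Properties using (length-map; length-++; length-applyUpTo)
open import Data.List.Relation.Binary.Disjoint.Propositional using (Disjoint)
open import Data.List.Relation.Unary.All as All using (All; []; _∷_)
import Data.List.Relation.Unary.All.Properties as All
open import Data.List.Relation.Unary.AllPairs using ([]; _∷_)
open import Data.List.Relation.Unary.Any using (here; there)
open import Data.List.Relation.Unary.Unique.Propositional using (Unique)
open import Data.List.Relation.Unary.Unique.Propositional.Properties using (++⁺; applyUpTo⁺₁)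
open import Data.Nat
open import Data.Nat.Coprimality as Coprimality using (Coprime; coprime?; coprime-Bézout; coprime-/gcd; 1-coprimeTo; coprime⇒gcd≡1; gcd≡1⇒coprime)
open import Data.Nat.DivMod
open import Data.Nat.Divisibility
open import Data.Nat.GCD using (gcd; module Bézout; gcd[m,n]∣m; gcd[m,n]∣n; gcd[m,n]≢0)
open import Data.Nat.Properties
open import Data.Nat.Tactic.RingSolver using (solve-∀)
open import Data.Product using (_×_; _,_; proj₁; proj₂; ∃₂; ∃-syntax)
open import Data.Sum as Sum using (_⊎_; inj₁; inj₂)
open import Data.Unit using (tt)
open import Function using (_∘_; id; mk⇔)
open import Relation.Binary.PropositionalEquality
open import Relation.Nullary
open import Relation.Nullary.Decidable using (_×-dec_; from-yes; toWitness)
open import Defs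

-- Up to sign a nice set lies in the half plane of heights j ≥ 0. If w j is the width of
-- its level j, the determinant condition gives i · w j + j · w i ≤ 2k, so the scaled
-- widths r j = w j / j satisfy r i + r j ≤ 2k / (ij), while level j holds about φ(j) r j
-- points. Summing over the coprime pairs i, j ≤ n < i + j, for which Σ 1/(ij) = 1 by the
-- Farey recursion, bounds the main term by k for every top height n. For n ≥ 4 three
-- consecutive levels n-2, n-1, n improve this strictly, which settles all bounded n ≥ 4.
-- For large n the set is fat: averaging over blocks of levels reduces the constraint to
-- b · H c + c · H b ≤ K, pairing blocks along a circle bounds Σ H b by about (π/4) K, and
-- sieving by 2, 3, 5, 7 brings the number of points below k. This needs n ≤ εk, which a
-- change of basis found by Dirichlet approximation provides. The closed form comes from
-- n ≤ 3, where the residues of the extreme points of each level decide the rounding.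

-- Sums and the Farey identity

-- For top height at most 3 the main term really reaches k, so additive constants decide and every
-- rounding has to be followed exactly. The determinants used there give inequalities with
-- denominators 2, 3 and 6, which is why k enters through its residue modulo 6. From height 4 on,
-- neighbouring Farey pairs can be traded, because (n-1) + (n-2) > n. The saving is proved only as k
-- over the square of a factorial, while rounding costs about n², so this argument needs n bounded
-- independently of k. For great heights the limiting profile is w j = (2k/n) √(1 - (j/n)²), of
-- total width (π/2) k. With the density 6/π² of primitive points this makes (3/π) k, about 0.955 k,
-- and the finite certificate has to fit into this gap of less than five per cent. The primes 2, 3,
-- 5 leave density 0.64, and 0.64 · π/2 still exceeds 1; adding 7 brings the limit down to about
-- 0.985, which leaves room for finitely many blocks.

∑ : ℕ → (ℕ → ℕ) → ℕ
∑ zero    f = 0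
∑ (suc n) f = ∑ n f + f n

∑-cong : ∀ n {f g} → (∀ i → i < n → f i ≡ g i) → ∑ n f ≡ ∑ n g
∑-cong zero    h = refl
∑-cong (suc n) h = cong₂ _+_ (∑-cong n λ i i<n → h i (m<n⇒m<1+n i<n)) (h n ≤-refl)

∑-mono : ∀ n {f g} → (∀ i → i < n → f i ≤ g i) → ∑ n f ≤ ∑ n g
∑-mono zero    h = z≤n
∑-mono (suc n) h = +-mono-≤ (∑-mono n λ i i<n → h i (m<n⇒m<1+n i<n)) (h n ≤-refl)

∑-+ : ∀ n f g → ∑ n (λ i → f i + g i) ≡ ∑ n f + ∑ n g
∑-+ zero    f g = refl
∑-+ (suc n) f g = trans (cong (_+ (f n + g n)) (∑-+ n f g)) (interchange (∑ n f) (∑ n g) (f n) (g n))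
  where
  interchange : ∀ a b c d → a + b + (c + d) ≡ a + c + (b + d)
  interchange = solve-∀

∑-* : ∀ n a f → ∑ n (λ i → a * f i) ≡ a * ∑ n f
∑-* zero    a f = sym (*-zeroʳ a)
∑-* (suc n) a f = trans (cong (_+ a * f n) (∑-* n a f)) (sym (*-distribˡ-+ a (∑ n f) (f n)))

∑-const : ∀ n a → ∑ n (λ _ → a) ≡ n * a
∑-const zero    a = refl
∑-const (suc n) a = trans (cong (_+ a) (∑-const n a)) (+-comm (n * a) a)

∑-split : ∀ m n f → ∑ (m + n) f ≡ ∑ m f + ∑ n (λ i → f (m + i))
∑-split m zero    f = trans (cong (λ j → ∑ j f) (+-identityʳ m)) (sym (+-identityʳ (∑ m f)))
∑-split m (suc n) f = begin
  ∑ (m + suc n) f                                   ≡⟨ cong (λ j → ∑ j f) (+-suc m n) ⟩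
  ∑ (m + n) f + f (m + n)                           ≡⟨ cong (_+ f (m + n)) (∑-split m n f) ⟩
  ∑ m f + ∑ n (λ i → f (m + i)) + f (m + n)         ≡⟨ +-assoc (∑ m f) _ _ ⟩
  ∑ m f + (∑ n (λ i → f (m + i)) + f (m + n))       ∎
  where open ≡-Reasoning

∑-head : ∀ n f → ∑ (suc n) f ≡ f 0 + ∑ n (λ i → f (suc i))
∑-head n f = ∑-split 1 n f

∑-rev : ∀ n f → ∑ n (λ i → f (n ∸ suc i)) ≡ ∑ n f
∑-rev zero    f = refl
∑-rev (suc n) f = trans (∑-head n (λ i → f (n ∸ i))) (trans (cong (λ z → f n + z) (∑-rev n f)) (+-comm (f n) _))

∑-≤ : ∀ {m n} f → m ≤ n → ∑ m f ≤ ∑ n f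
∑-≤ {m} {n} f m≤n = begin
  ∑ m f                                    ≤⟨ m≤m+n _ _ ⟩
  ∑ m f + ∑ (n ∸ m) (λ i → f (m + i))      ≡⟨ sym (∑-split m (n ∸ m) f) ⟩
  ∑ (m + (n ∸ m)) f                        ≡⟨ cong (λ j → ∑ j f) (m+[n∸m]≡n m≤n) ⟩
  ∑ n f                                    ∎
  where open ≤-Reasoning

m∸n≡1+[m∸1+n] : ∀ {m n} → n < m → m ∸ n ≡ suc (m ∸ suc n)
m∸n≡1+[m∸1+n] {m} {n} n<m = +-∸-assoc 1 {m} {suc n} n<m

indicator : ∀ {p} {P : Set p} → Dec P → ℕ
indicator (yes _) = 1
indicator (no _)  = 0

indicator-⇔ : ∀ {p q} {P : Set p} {Q : Set q} (P? : Dec P) (Q? : Dec Q) →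
              (P → Q) → (Q → P) → indicator P? ≡ indicator Q?
indicator-⇔ (yes p) (yes q) f g = refl
indicator-⇔ (yes p) (no ¬q) f g = contradiction (f p) ¬q
indicator-⇔ (no ¬p) (yes q) f g = contradiction (g q) ¬p
indicator-⇔ (no ¬p) (no ¬q) f g = refl

indicator-yes : ∀ {p} {P : Set p} (P? : Dec P) → P → indicator P? ≡ 1
indicator-yes (yes _) p = refl
indicator-yes (no ¬p) p = contradiction p ¬p

indicator-no : ∀ {p} {P : Set p} (P? : Dec P) → ¬ P → indicator P? ≡ 0
indicator-no (yes p) ¬p = contradiction p ¬p
indicator-no (no _)  ¬p = refl

indicator≤1 : ∀ {p} {P : Set p} (P? : Dec P) → indicator P? ≤ 1
indicator≤1 (yes _) = s≤s z≤n
indicator≤1 (no _)  = z≤n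

κ : ℕ → ℕ → ℕ
κ i j = indicator (coprime? i j)

κ-sym : ∀ i j → κ i j ≡ κ j i
κ-sym i j = indicator-⇔ _ _ Coprimality.sym Coprimality.sym

κ-add : ∀ i j → κ i (i + j) ≡ κ i j
κ-add i j = indicator-⇔ _ _
  (λ c {d} (d∣i , d∣j) → c (d∣i , ∣m∣n⇒∣m+n d∣i d∣j))
  (λ c {d} (d∣i , d∣i+j) → c (d∣i , ∣m+n∣m⇒∣n d∣i+j d∣i))

κ-diag : ∀ m → κ (2 + m) (2 + m) ≡ 0
κ-diag m = indicator-no (coprime? (2 + m) (2 + m)) λ c → contradiction (c {2 + m} (∣-refl , ∣-refl)) λ ()

κ0≡0 : ∀ m → κ 0 (2 + m) ≡ 0
κ0≡0 m = indicator-no (coprime? 0 (2 + m)) λ c → contradiction (c {2 + m} ((_ ∣0) , ∣-refl)) λ ()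

κ-suc : ∀ m → κ m (suc m) ≡ 1
κ-suc m = indicator-yes (coprime? m (suc m))
  λ {d} (d∣m , d∣1+m) → ∣1⇒≡1 (∣m+n∣m⇒∣n (subst (d ∣_) (+-comm 1 m) d∣1+m) d∣m)

φ : ℕ → ℕ
φ j = ∑ j (λ t → κ t j)

φ-tail : ∀ m → φ (2 + m) ≡ ∑ (suc m) (λ a → κ (suc a) (2 + m))
φ-tail m = trans (∑-head (suc m) (λ t → κ t (2 + m))) (cong (_+ ∑ (suc m) (λ a → κ (suc a) (2 + m))) (κ0≡0 m))

φ≤ : ∀ j → φ j ≤ j
φ≤ j = begin
  φ j                  ≤⟨ ∑-mono j (λ t _ → indicator≤1 (coprime? t j)) ⟩
  ∑ j (λ _ → 1)        ≡⟨ ∑-const j 1 ⟩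
  j * 1                ≡⟨ *-identityʳ j ⟩
  j                    ∎
  where open ≤-Reasoning

-- fareySum G m runs over 1 ≤ i, j ≤ m with i + j > m; the coprime pairs among these are
-- the pairs of denominators of neighbours in the Farey sequence of order m.
fareyRow : (ℕ → ℕ → ℕ) → ℕ → ℕ → ℕ
fareyRow G m a = ∑ (suc a) (λ t → G (suc a) (m ∸ t))

fareySum : (ℕ → ℕ → ℕ) → ℕ → ℕ
fareySum G m = ∑ m (fareyRow G m)

module _ (G : ℕ → ℕ → ℕ) (G-sym : ∀ i j → G i j ≡ G j i) where

  -- For fixed i the partners j form the window m - i < j ≤ m. Raising m by one slides it: m + 1
  -- enters and m + 1 - i leaves.
  fareyRow-step : ∀ m a → fareyRow G (suc m) a + G (suc a) (m ∸ a) ≡ fareyRow G m a + G (suc a) (suc m)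
  fareyRow-step m a = begin
    fareyRow G (suc m) a + G (suc a) (m ∸ a)
      ≡⟨ cong (_+ G (suc a) (m ∸ a)) (∑-head a (λ t → G (suc a) (suc m ∸ t))) ⟩
    G (suc a) (suc m) + ∑ a (λ t → G (suc a) (m ∸ t)) + G (suc a) (m ∸ a)
      ≡⟨ +-assoc (G (suc a) (suc m)) _ _ ⟩
    G (suc a) (suc m) + fareyRow G m a
      ≡⟨ +-comm (G (suc a) (suc m)) _ ⟩
    fareyRow G m a + G (suc a) (suc m) ∎
    where open ≡-Reasoning

  fareyRow-last : ∀ m → G (suc m) (suc m) ≡ 0 → fareyRow G (suc m) m ≡ ∑ m (λ a → G (suc a) (suc m))
  fareyRow-last m G≡0 = begin
    fareyRow G (suc m) m
      ≡⟨ ∑-head m (λ t → G (suc m) (suc m ∸ t)) ⟩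
    G (suc m) (suc m) + ∑ m (λ t → G (suc m) (m ∸ t))
      ≡⟨ cong (_+ ∑ m (λ t → G (suc m) (m ∸ t))) G≡0 ⟩
    ∑ m (λ t → G (suc m) (m ∸ t))
      ≡⟨ ∑-cong m (λ t t<m → cong (G (suc m)) (m∸n≡1+[m∸1+n] t<m)) ⟩
    ∑ m (λ t → G (suc m) (suc (m ∸ suc t)))
      ≡⟨ ∑-rev m (λ a → G (suc m) (suc a)) ⟩
    ∑ m (λ a → G (suc m) (suc a))
      ≡⟨ ∑-cong m (λ a _ → G-sym (suc m) (suc a)) ⟩
    ∑ m (λ a → G (suc a) (suc m)) ∎
    where open ≡-Reasoning

  -- Passing from order m to m + 1 inserts a mediant between neighbours whose denominators add up to
  -- m + 1. These pairs, the antidiagonal i + j = m + 1, disappear, and each is replaced by two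
  -- pairs that contain m + 1.
  fareySum-step : ∀ m → G (suc m) (suc m) ≡ 0 →
           fareySum G (suc m) + ∑ m (λ a → G (suc a) (m ∸ a)) ≡ fareySum G m + 2 * ∑ m (λ a → G (suc a) (suc m))
  fareySum-step m G≡0 = begin
    ∑ m (fareyRow G (suc m)) + fareyRow G (suc m) m + R
      ≡⟨ cong (λ x → ∑ m (fareyRow G (suc m)) + x + R) (fareyRow-last m G≡0) ⟩
    ∑ m (fareyRow G (suc m)) + A + R
      ≡⟨ swap₁ (∑ m (fareyRow G (suc m))) A R ⟩
    ∑ m (fareyRow G (suc m)) + R + A
      ≡⟨ cong (_+ A) (sym (∑-+ m _ _)) ⟩
    ∑ m (λ a → fareyRow G (suc m) a + G (suc a) (m ∸ a)) + A
      ≡⟨ cong (_+ A) (∑-cong m λ a _ → fareyRow-step m a) ⟩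
    ∑ m (λ a → fareyRow G m a + G (suc a) (suc m)) + A
      ≡⟨ cong (_+ A) (∑-+ m _ _) ⟩
    fareySum G m + A + A
      ≡⟨ swap₂ (fareySum G m) A ⟩
    fareySum G m + 2 * A ∎
    where
    open ≡-Reasoning
    A R : ℕ
    A = ∑ m (λ a → G (suc a) (suc m))
    R = ∑ m (λ a → G (suc a) (m ∸ a))
    swap₁ : ∀ x y z → x + y + z ≡ x + z + y
    swap₁ = solve-∀
    swap₂ : ∀ x y → x + y + y ≡ x + 2 * y
    swap₂ = solve-∀

sumPair prodPair : (ℕ → ℕ) → ℕ → ℕ → ℕ
sumPair  r i j = κ i j * (r i + r j)
prodPair e i j = κ i j * (e i * e j)

sumPair-sym : ∀ r i j → sumPair r i j ≡ sumPair r j i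
sumPair-sym r i j = cong₂ _*_ (κ-sym i j) (+-comm (r i) (r j))

prodPair-sym : ∀ e i j → prodPair e i j ≡ prodPair e j i
prodPair-sym e i j = cong₂ _*_ (κ-sym i j) (*-comm (e i) (e j))

κ-anti : ∀ m a → a < m → κ (suc a) (m ∸ a) ≡ κ (suc a) (suc m)
κ-anti m a a<m = trans (sym (κ-add (suc a) (m ∸ a)))
  (cong (λ j → κ (suc a) (suc j)) (m+[n∸m]≡n (<⇒≤ a<m)))

-- On the line i + j = m + 1, coprimality of i and j is coprimality of i and m + 1. Reversing the
-- line identifies the contributions of the two coordinates.
antidiagonal : ∀ r m → ∑ m (λ a → sumPair r (suc a) (m ∸ a))
                       ≡ 2 * ∑ m (λ a → κ (suc a) (suc m) * r (suc a))
antidiagonal r m = begin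
  ∑ m (λ a → sumPair r (suc a) (m ∸ a))
    ≡⟨ ∑-cong m (λ a a<m → pointwise a a<m) ⟩
  ∑ m (λ a → f a + f (m ∸ suc a))
    ≡⟨ ∑-+ m f (λ a → f (m ∸ suc a)) ⟩
  ∑ m f + ∑ m (λ a → f (m ∸ suc a))
    ≡⟨ cong (λ z → ∑ m f + z) (∑-rev m f) ⟩
  ∑ m f + ∑ m f
    ≡⟨ cong (λ z → ∑ m f + z) (sym (+-identityʳ (∑ m f))) ⟩
  2 * ∑ m f ∎
  where
  open ≡-Reasoning
  f : ℕ → ℕ
  f a = κ (suc a) (suc m) * r (suc a)
  pointwise : ∀ a → a < m → sumPair r (suc a) (m ∸ a) ≡ f a + f (m ∸ suc a)
  pointwise a a<m = begin
    κ (suc a) (m ∸ a) * (r (suc a) + r (m ∸ a))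
      ≡⟨ *-distribˡ-+ (κ (suc a) (m ∸ a)) _ _ ⟩
    κ (suc a) (m ∸ a) * r (suc a) + κ (suc a) (m ∸ a) * r (m ∸ a)
      ≡⟨ cong₂ _+_ (cong (_* r (suc a)) (κ-anti m a a<m)) (cong₂ _*_ second (cong r idx)) ⟩
    f a + f (m ∸ suc a) ∎
    where
    idx : m ∸ a ≡ suc (m ∸ suc a)
    idx = m∸n≡1+[m∸1+n] a<m
    second : κ (suc a) (m ∸ a) ≡ κ (suc (m ∸ suc a)) (suc m)
    second = begin
      κ (suc a) (m ∸ a)                       ≡⟨ κ-sym (suc a) (m ∸ a) ⟩
      κ (m ∸ a) (suc a)                       ≡⟨ sym (κ-add (m ∸ a) (suc a)) ⟩
      κ (m ∸ a) (m ∸ a + suc a)               ≡⟨ cong₂ κ idx (trans (+-suc (m ∸ a) a) (cong suc (m∸n+n≡m (<⇒≤ a<m)))) ⟩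
      κ (suc (m ∸ suc a)) (suc m)             ∎

-- The i consecutive partners of i form a complete residue system modulo i, and φ i of them are
-- coprime to i, so r i is counted 2 φ(i) times. The induction on m sees this as follows: the lost
-- antidiagonal cancels against the new border except for the term of the new height. Order 1 stands
-- apart because 1 is coprime to itself.
fareySum-sum : ∀ r m → fareySum (sumPair r) m ≡ 2 * ∑ m (λ a → φ (suc a) * r (suc a))
fareySum-sum r zero          = refl
fareySum-sum r (suc zero)    = one (r 1)
  where
  one : ∀ x → x + x + 0 ≡ x + 0 + (x + 0 + 0)
  one = solve-∀
fareySum-sum r (suc (suc m)) = +-cancelʳ-≡ (2 * X) _ _ (begin
  fareySum (sumPair r) (2 + m) + 2 * X
    ≡⟨ cong (λ z → fareySum (sumPair r) (2 + m) + z) (sym (antidiagonal r (suc m))) ⟩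
  fareySum (sumPair r) (2 + m) + ∑ (suc m) (λ a → sumPair r (suc a) (suc m ∸ a))
    ≡⟨ fareySum-step (sumPair r) (sumPair-sym r) (suc m) (cong (_* (r (2 + m) + r (2 + m))) (κ-diag m)) ⟩
  fareySum (sumPair r) (suc m) + 2 * ∑ (suc m) (λ a → sumPair r (suc a) (2 + m))
    ≡⟨ cong₂ (λ x y → x + 2 * y) (fareySum-sum r (suc m)) new ⟩
  2 * T + 2 * (X + φ (2 + m) * r (2 + m))
    ≡⟨ regroup T X (φ (2 + m) * r (2 + m)) ⟩
  2 * (T + φ (2 + m) * r (2 + m)) + 2 * X ∎)
  where
  open ≡-Reasoning
  X T : ℕ
  X = ∑ (suc m) (λ a → κ (suc a) (2 + m) * r (suc a))
  T = ∑ (suc m) (λ a → φ (suc a) * r (suc a))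
  regroup : ∀ t x p → 2 * t + 2 * (x + p) ≡ 2 * (t + p) + 2 * x
  regroup = solve-∀
  new : ∑ (suc m) (λ a → sumPair r (suc a) (2 + m)) ≡ X + φ (2 + m) * r (2 + m)
  new = begin
    ∑ (suc m) (λ a → sumPair r (suc a) (2 + m))
      ≡⟨ ∑-cong (suc m) (λ a _ → trans (*-distribˡ-+ (κ (suc a) (2 + m)) _ _)
           (cong (λ z → κ (suc a) (2 + m) * r (suc a) + z) (*-comm (κ (suc a) (2 + m)) _))) ⟩
    ∑ (suc m) (λ a → κ (suc a) (2 + m) * r (suc a) + r (2 + m) * κ (suc a) (2 + m))
      ≡⟨ ∑-+ (suc m) _ _ ⟩
    X + ∑ (suc m) (λ a → r (2 + m) * κ (suc a) (2 + m))
      ≡⟨ cong (λ z → X + z) (∑-* (suc m) (r (2 + m)) _) ⟩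
    X + r (2 + m) * ∑ (suc m) (λ a → κ (suc a) (2 + m))
      ≡⟨ cong (λ z → X + r (2 + m) * z) (sym (φ-tail m)) ⟩
    X + r (2 + m) * φ (2 + m)
      ≡⟨ cong (λ z → X + z) (*-comm (r (2 + m)) _) ⟩
    X + φ (2 + m) * r (2 + m) ∎

module _ {D n : ℕ} .{{_ : NonZero D}} (e : ℕ → ℕ)
         (ie≡D : ∀ i → 0 < i → i ≤ n → i * e i ≡ D) where

  -- 1/(ij) = 1/(i+j) · (1/i + 1/j)
  mediant : ∀ i j → 0 < i → 0 < j → i + j ≤ n → e i * e j ≡ e (i + j) * (e i + e j)
  mediant i j 0<i 0<j i+j≤n = *-cancelˡ-≡ _ _ D (begin
    D * (e i * e j)
      ≡⟨ cong (_* (e i * e j)) (sym (ie≡D (i + j) (≤-trans 0<i (m≤m+n i j)) i+j≤n)) ⟩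
    (i + j) * e (i + j) * (e i * e j)
      ≡⟨ expand i j (e (i + j)) (e i) (e j) ⟩
    e (i + j) * ((j * e j) * e i + (i * e i) * e j)
      ≡⟨ cong₂ (λ x y → e (i + j) * (x * e i + y * e j))
           (ie≡D j 0<j (≤-trans (m≤n+m j i) i+j≤n)) (ie≡D i 0<i (≤-trans (m≤m+n i j) i+j≤n)) ⟩
    e (i + j) * (D * e i + D * e j)
      ≡⟨ collect (e (i + j)) D (e i) (e j) ⟩
    D * (e (i + j) * (e i + e j)) ∎)
    where
    open ≡-Reasoning
    expand : ∀ i j c x y → (i + j) * c * (x * y) ≡ c * ((j * y) * x + (i * x) * y)
    expand = solve-∀
    collect : ∀ c D x y → c * (D * x + D * y) ≡ D * (c * (x + y))
    collect = solve-∀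

  -- Neighbouring Farey fractions with denominators i and j differ by 1/(ij), and these gaps fill
  -- the unit interval. Inductively, `mediant` makes the lost antidiagonal equal to the new border.
  fareySum-prod : ∀ m → suc m ≤ n → fareySum (prodPair e) (suc m) ≡ D * D
  fareySum-prod zero 1≤n = trans (one (e 1)) (cong₂ _*_ e1≡D e1≡D)
    where
    one : ∀ x → x * x + 0 ≡ x * x
    one = solve-∀
    e1≡D : e 1 ≡ D
    e1≡D = trans (sym (*-identityˡ (e 1))) (ie≡D 1 ≤-refl 1≤n)
  fareySum-prod (suc m) m+2≤n = +-cancelʳ-≡ R _ _ (begin
    fareySum (prodPair e) (2 + m) + R
      ≡⟨ fareySum-step (prodPair e) (prodPair-sym e) (suc m) (cong (_* (e (2 + m) * e (2 + m))) (κ-diag m)) ⟩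
    fareySum (prodPair e) (suc m) + 2 * A
      ≡⟨ cong₂ _+_ (fareySum-prod m (<⇒≤ m+2≤n)) (sym R≡2A) ⟩
    D * D + R ∎)
    where
    open ≡-Reasoning
    A R : ℕ
    A = ∑ (suc m) (λ a → prodPair e (suc a) (2 + m))
    R = ∑ (suc m) (λ a → prodPair e (suc a) (suc m ∸ a))
    c : ℕ
    c = e (2 + m)
    pull : ∀ x y z → x * (y * z) ≡ y * (x * z)
    pull = solve-∀
    pull′ : ∀ x y z → x * (y * z) ≡ z * (x * y)
    pull′ = solve-∀
    pull″ : ∀ x y → x * (2 * y) ≡ 2 * (x * y)
    pull″ = solve-∀
    pointwise : ∀ a → a < suc m → prodPair e (suc a) (suc m ∸ a) ≡ c * sumPair e (suc a) (suc m ∸ a)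
    pointwise a a<m = begin
      κ (suc a) (suc m ∸ a) * (e (suc a) * e (suc m ∸ a))
        ≡⟨ cong (κ (suc a) (suc m ∸ a) *_) (trans
             (mediant (suc a) (suc m ∸ a) z<s (m<n⇒0<n∸m a<m) (≤-trans (≤-reflexive idx) m+2≤n))
             (cong (λ j → e j * (e (suc a) + e (suc m ∸ a))) idx)) ⟩
      κ (suc a) (suc m ∸ a) * (c * (e (suc a) + e (suc m ∸ a)))
        ≡⟨ pull (κ (suc a) (suc m ∸ a)) c _ ⟩
      c * sumPair e (suc a) (suc m ∸ a) ∎
      where
      idx : suc a + (suc m ∸ a) ≡ 2 + m
      idx = cong suc (m+[n∸m]≡n (<⇒≤ a<m))
    R≡2A : R ≡ 2 * A
    R≡2A = begin
      R
        ≡⟨ ∑-cong (suc m) pointwise ⟩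
      ∑ (suc m) (λ a → c * sumPair e (suc a) (suc m ∸ a))
        ≡⟨ ∑-* (suc m) c _ ⟩
      c * ∑ (suc m) (λ a → sumPair e (suc a) (suc m ∸ a))
        ≡⟨ cong (c *_) (antidiagonal e (suc m)) ⟩
      c * (2 * ∑ (suc m) (λ a → κ (suc a) (2 + m) * e (suc a)))
        ≡⟨ pull″ c _ ⟩
      2 * (c * ∑ (suc m) (λ a → κ (suc a) (2 + m) * e (suc a)))
        ≡⟨ cong (2 *_) (sym (∑-* (suc m) c _)) ⟩
      2 * ∑ (suc m) (λ a → c * (κ (suc a) (2 + m) * e (suc a)))
        ≡⟨ cong (2 *_) (∑-cong (suc m) λ a _ → sym (pull′ (κ (suc a) (2 + m)) (e (suc a)) c)) ⟩
      2 * A ∎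

fareySum-* : ∀ c G m → fareySum (λ i j → c * G i j) m ≡ c * fareySum G m
fareySum-* c G m = trans (∑-cong m (λ a _ → ∑-* (suc a) c (λ t → G (suc a) (m ∸ t)))) (∑-* m c (fareyRow G m))

-- The strict Farey bound for heights at least four

module _ {D k q : ℕ} .{{_ : NonZero D}} (e w : ℕ → ℕ)
         (ie≡D : ∀ i → 0 < i → i ≤ 4 + q → i * e i ≡ D)
         (pair : ∀ i j → 0 < i → 0 < j → i ≤ 4 + q → j ≤ 4 + q → i * w j + j * w i ≤ 2 * k) where

  private
    n : ℕ
    n = 4 + q
    r : ℕ → ℕ
    r i = e i * w i
    X Y : ℕ → ℕ → ℕ
    X i j = D * sumPair r i j
    Y i j = 2 * k * prodPair e i j

  scaled-pair : ∀ i j → 0 < i → 0 < j → i ≤ n → j ≤ n → D * (r i + r j) ≤ 2 * k * (e i * e j)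
  scaled-pair i j 0<i 0<j i≤n j≤n = begin
    D * (r i + r j)
      ≡⟨ *-distribˡ-+ D (r i) (r j) ⟩
    D * r i + D * r j
      ≡⟨ cong₂ (λ x y → x * r i + y * r j) (sym (ie≡D j 0<j j≤n)) (sym (ie≡D i 0<i i≤n)) ⟩
    j * e j * (e i * w i) + i * e i * (e j * w j)
      ≡⟨ regroup i j (e i) (e j) (w i) (w j) ⟩
    (i * w j + j * w i) * (e i * e j)
      ≤⟨ *-monoˡ-≤ (e i * e j) (pair i j 0<i 0<j i≤n j≤n) ⟩
    2 * k * (e i * e j) ∎
    where
    open ≤-Reasoning
    regroup : ∀ i j x y u v → j * y * (x * u) + i * x * (y * v) ≡ (i * v + j * u) * (x * y)
    regroup = solve-∀

  X≤Y : ∀ i j → 0 < i → 0 < j → i ≤ n → j ≤ n → X i j ≤ Y i j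
  X≤Y i j 0<i 0<j i≤n j≤n = begin
    D * (κ i j * (r i + r j))      ≡⟨ swap D (κ i j) _ ⟩
    κ i j * (D * (r i + r j))      ≤⟨ *-monoʳ-≤ (κ i j) (scaled-pair i j 0<i 0<j i≤n j≤n) ⟩
    κ i j * (2 * k * (e i * e j))  ≡⟨ swap (κ i j) (2 * k) _ ⟩
    2 * k * (κ i j * (e i * e j))  ∎
    where
    open ≤-Reasoning
    swap : ∀ x y z → x * (y * z) ≡ y * (x * z)
    swap = solve-∀

  fareyRow≤ : ∀ a → a < n → fareyRow X n a ≤ fareyRow Y n a
  fareyRow≤ a a<n = ∑-mono (suc a) λ t t<1+a →
    X≤Y (suc a) (n ∸ t) z<s (m<n⇒0<n∸m (≤-trans t<1+a a<n)) a<n (m∸n≤m n t)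

  e-decreasing : ∀ i → 0 < i → suc i ≤ n → e (suc i) < e i
  e-decreasing i 0<i i<n = *-cancelˡ-< i _ _ (begin-strict
    i * e (suc i)              <⟨ m<n+m _ (n≢0⇒n>0 e≢0) ⟩
    e (suc i) + i * e (suc i)  ≡⟨ ie≡D (suc i) z<s i<n ⟩
    D                          ≡⟨ sym (ie≡D i 0<i (<⇒≤ i<n)) ⟩
    i * e i ∎)
    where
    open ≤-Reasoning
    e≢0 : e (suc i) ≢ 0
    e≢0 e≡0 = ≢-nonZero⁻¹ D (trans (sym (ie≡D (suc i) z<s i<n))
      (trans (cong (suc i *_) e≡0) (*-zeroʳ (suc i))))

  -- (1/(n-2) - 1/(n-1)) (1/(n-1) - 1/n) > 0
  gap : e (3 + q) * e (3 + q) + e (4 + q) * e (2 + q) + 1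
        ≤ e (3 + q) * e (4 + q) + e (3 + q) * e (2 + q)
  gap with z , p ← m≤n⇒∃[o]m+o≡n (e-decreasing (3 + q) z<s ≤-refl)
         | z′ , p′ ← m≤n⇒∃[o]m+o≡n (e-decreasing (2 + q) z<s (n≤1+n (3 + q))) =
    subst₂ (λ x y → x * x + c * y + 1 ≤ x * c + x * y) p
      (trans (cong (λ x → suc x + z′) p) p′)
      (≤-trans (m≤m+n _ (z + z′ + z * z′)) (≤-reflexive (identity c z z′)))
    where
    c : ℕ
    c = e (4 + q)
    identity : ∀ c z z′ → let x = suc c + z; y = suc x + z′ in
      x * x + c * y + 1 + (z + z′ + z * z′) ≡ x * c + x * y
    identity = solve-∀

  -- Replacing the pairs (n-1,n) and (n-1,n-2) by (n-1,n-1) and (n,n-2) yields a smaller bound.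
  fareyRow-gain : fareyRow X n (2 + q) + 2 * k ≤ fareyRow Y n (2 + q)
  fareyRow-gain = begin
    fareyRow X n (2 + q) + 2 * k
      -- The partners of n-1 start with n, n-1 and n-2. That n-2 is still among them uses n ≥ 4; the
      -- middle term is not coprime and is carried along with the rest.
      ≡⟨ cong (_+ 2 * k) (∑-split 3 q (λ t → X (3 + q) (n ∸ t))) ⟩
    X p n + X p p + X p o + X-rest + 2 * k
      ≡⟨ regroup₁ (X p n) (X p p) (X p o) X-rest (2 * k) ⟩
    (X p n + X p o + 2 * k) + (X p p + X-rest)
      ≤⟨ +-mono-≤ three (+-mono-≤ (X≤Y p p z<s z<s (n≤1+n p) (n≤1+n p)) rest≤) ⟩
    (Y p n + Y p o) + (Y p p + Y-rest)
      ≡⟨ regroup₂ (Y p n) (Y p o) (Y p p) Y-rest ⟩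
    Y p n + Y p p + Y p o + Y-rest
      ≡⟨ sym (∑-split 3 q (λ t → Y (3 + q) (n ∸ t))) ⟩
    fareyRow Y n (2 + q) ∎
    where
    open ≤-Reasoning
    o p : ℕ
    o = 2 + q
    p = 3 + q
    X-rest Y-rest : ℕ
    X-rest = ∑ q (λ t → X p (n ∸ (3 + t)))
    Y-rest = ∑ q (λ t → Y p (n ∸ (3 + t)))
    regroup₁ : ∀ a b c d f → a + b + c + d + f ≡ (a + c + f) + (b + d)
    regroup₁ = solve-∀
    regroup₂ : ∀ a b c d → (a + b) + (c + d) ≡ a + c + b + d
    regroup₂ = solve-∀
    rest≤ : X-rest ≤ Y-rest
    rest≤ = ∑-mono q λ t t<q → X≤Y p (n ∸ (3 + t)) z<s
      (m<n⇒0<n∸m (s≤s (s≤s (s≤s (m<n⇒m<1+n t<q))))) (n≤1+n p) (m∸n≤m n (3 + t))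
    κpn : κ p n ≡ 1
    κpn = κ-suc p
    κpo : κ p o ≡ 1
    κpo = trans (κ-sym p o) (κ-suc o)
    left : ∀ D x y z → D * (1 * (x + y)) + D * (1 * (x + z)) ≡ D * (x + x) + D * (y + z)
    left = solve-∀
    right : ∀ k x y z → 2 * k * (x * x) + 2 * k * (y * z) + 2 * k ≡ 2 * k * (x * x + y * z + 1)
    right = solve-∀
    right′ : ∀ k x y z → 2 * k * (x * y + x * z) ≡ 2 * k * (1 * (x * y)) + 2 * k * (1 * (x * z))
    right′ = solve-∀
    three : X p n + X p o + 2 * k ≤ Y p n + Y p o
    three = begin
      D * (κ p n * (r p + r n)) + D * (κ p o * (r p + r o)) + 2 * k
        ≡⟨ cong₂ (λ x y → D * (x * (r p + r n)) + D * (y * (r p + r o)) + 2 * k) κpn κpo ⟩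
      D * (1 * (r p + r n)) + D * (1 * (r p + r o)) + 2 * k
        ≡⟨ cong (_+ 2 * k) (left D (r p) (r n) (r o)) ⟩
      D * (r p + r p) + D * (r n + r o) + 2 * k
        ≤⟨ +-monoˡ-≤ (2 * k) (+-mono-≤
             (scaled-pair p p z<s z<s (n≤1+n p) (n≤1+n p))
             (scaled-pair n o z<s z<s ≤-refl (≤-trans (n≤1+n o) (n≤1+n p)))) ⟩
      2 * k * (e p * e p) + 2 * k * (e n * e o) + 2 * k
        ≡⟨ right k (e p) (e n) (e o) ⟩
      2 * k * (e p * e p + e n * e o + 1)
        ≤⟨ *-monoʳ-≤ (2 * k) gap ⟩
      2 * k * (e p * e n + e p * e o)
        ≡⟨ right′ k (e p) (e n) (e o) ⟩
      2 * k * (1 * (e p * e n)) + 2 * k * (1 * (e p * e o))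
        ≡⟨ cong₂ (λ x y → 2 * k * (x * (e p * e n)) + 2 * k * (y * (e p * e o))) (sym κpn) (sym κpo) ⟩
      Y p n + Y p o ∎

  -- The summand `2 * k` on the left is the gain from the row of n-1. It is tiny against the right
  -- side, yet proportional to k, and it later pays for the rounding in all levels.
  farey-bound : D * (2 * ∑ n (λ a → φ (suc a) * r (suc a))) + 2 * k ≤ 2 * k * (D * D)
  farey-bound = begin
    D * (2 * ∑ n (λ a → φ (suc a) * r (suc a))) + 2 * k
      ≡⟨ cong (λ x → D * x + 2 * k) (sym (fareySum-sum r n)) ⟩
    D * fareySum (sumPair r) n + 2 * k
      ≡⟨ cong (_+ 2 * k) (sym (fareySum-* D (sumPair r) n)) ⟩
    ∑ (2 + q) (fareyRow X n) + fareyRow X n (2 + q) + fareyRow X n (3 + q) + 2 * k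
      ≡⟨ regroup (∑ (2 + q) (fareyRow X n)) (fareyRow X n (2 + q)) (fareyRow X n (3 + q)) (2 * k) ⟩
    ∑ (2 + q) (fareyRow X n) + (fareyRow X n (2 + q) + 2 * k) + fareyRow X n (3 + q)
      ≤⟨ +-mono-≤ (+-mono-≤ (∑-mono (2 + q) λ a a<2+q → fareyRow≤ a (≤-trans a<2+q (m≤n+m (2 + q) 2))) fareyRow-gain)
           (fareyRow≤ (3 + q) ≤-refl) ⟩
    ∑ (2 + q) (fareyRow Y n) + fareyRow Y n (2 + q) + fareyRow Y n (3 + q)
      ≡⟨ fareySum-* (2 * k) (prodPair e) n ⟩
    2 * k * fareySum (prodPair e) n
      ≡⟨ cong (2 * k *_) (fareySum-prod e ie≡D (3 + q) ≤-refl) ⟩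
    2 * k * (D * D) ∎
    where
    open ≤-Reasoning
    regroup : ∀ a b c d → a + b + c + d ≡ a + (b + d) + c
    regroup = solve-∀

-- Blocks of levels

∑-blocks : ∀ M L f → ∑ (M * L) f ≡ ∑ M (λ b → ∑ L (λ s → f (b * L + s)))
∑-blocks zero    L f = refl
∑-blocks (suc M) L f = begin
  ∑ (L + M * L) f                                  ≡⟨ cong (λ j → ∑ j f) (+-comm L (M * L)) ⟩
  ∑ (M * L + L) f                                  ≡⟨ ∑-split (M * L) L f ⟩
  ∑ (M * L) f + ∑ L (λ s → f (M * L + s))          ≡⟨ cong (_+ ∑ L (λ s → f (M * L + s))) (∑-blocks M L f) ⟩
  ∑ (suc M) (λ b → ∑ L (λ s → f (b * L + s)))      ∎
  where open ≡-Reasoning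

module _ {P : ℕ} (g : ℕ → ℕ) (periodic : ∀ j → g (P + j) ≡ g j) where

  periodic-* : ∀ b j → g (b * P + j) ≡ g j
  periodic-* zero    j = refl
  periodic-* (suc b) j = trans (cong g (+-assoc P (b * P) j)) (trans (periodic (b * P + j)) (periodic-* b j))

  ∑-periods : ∀ m → ∑ (m * P) g ≡ m * ∑ P g
  ∑-periods m = begin
    ∑ (m * P) g                              ≡⟨ ∑-blocks m P g ⟩
    ∑ m (λ b → ∑ P (λ s → g (b * P + s)))    ≡⟨ ∑-cong m (λ b _ → ∑-cong P λ s _ → periodic-* b s) ⟩
    ∑ m (λ b → ∑ P g)                        ≡⟨ ∑-const m (∑ P g) ⟩
    m * ∑ P g                                ∎
    where open ≡-Reasoning

∑-weighted : ∀ L (g v : ℕ → ℕ) α β →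
             ∑ L (λ s → g s * (α + β * v s)) ≡ α * ∑ L g + β * ∑ L (λ s → g s * v s)
∑-weighted L g v α β = begin
  ∑ L (λ s → g s * (α + β * v s))                       ≡⟨ ∑-cong L (λ s _ → expand (g s) α β (v s)) ⟩
  ∑ L (λ s → α * g s + β * (g s * v s))                 ≡⟨ ∑-+ L _ _ ⟩
  ∑ L (λ s → α * g s) + ∑ L (λ s → β * (g s * v s))     ≡⟨ cong₂ _+_ (∑-* L α g) (∑-* L β _) ⟩
  α * ∑ L g + β * ∑ L (λ s → g s * v s)                 ∎
  where
  open ≡-Reasoning
  expand : ∀ g α β v → g * (α + β * v) ≡ α * g + β * (g * v)
  expand = solve-∀

∑-weighted-≤ : ∀ L (g v : ℕ → ℕ) α β C → (∀ s → s < L → α + β * v s ≤ C) →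
               α * ∑ L g + β * ∑ L (λ s → g s * v s) ≤ C * ∑ L g
∑-weighted-≤ L g v α β C h = begin
  α * ∑ L g + β * ∑ L (λ s → g s * v s)    ≡⟨ sym (∑-weighted L g v α β) ⟩
  ∑ L (λ s → g s * (α + β * v s))          ≤⟨ ∑-mono L (λ s s<L → *-monoʳ-≤ (g s) (h s s<L)) ⟩
  ∑ L (λ s → g s * C)                      ≡⟨ ∑-cong L (λ s _ → *-comm (g s) C) ⟩
  ∑ L (λ s → C * g s)                      ≡⟨ ∑-* L C g ⟩
  C * ∑ L g                                ∎
  where open ≤-Reasoning

-- Nonnegative multipliers y for the constraints b H c + c H b ≤ K.
Multipliers : Set
Multipliers = List (ℕ × ℕ × ℕ)

δ : ℕ → ℕ → ℕ
δ b a = indicator (b ≟ a)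

total : Multipliers → ℕ
total []                 = 0
total ((b , c , y) ∷ ys) = y + total ys

coefficient : Multipliers → ℕ → ℕ
coefficient []                 a = 0
coefficient ((b , c , y) ∷ ys) a = y * (b * δ c a + c * δ b a) + coefficient ys a

∑-δ : ∀ M b (H : ℕ → ℕ) → b < M → ∑ M (λ a → δ b a * H a) ≡ H b
∑-δ (suc M) b H b<1+M with m≤n⇒m<n∨m≡n (s≤s⁻¹ b<1+M)
... | inj₁ b<M  = trans (cong₂ _+_ (∑-δ M b H b<M) (cong (_* H M) (indicator-no (b ≟ M) (<⇒≢ b<M))))
                        (+-identityʳ (H b))
... | inj₂ refl = trans (cong₂ _+_ (trans (∑-cong M λ a a<M → cong (_* H a) (indicator-no (b ≟ a) (≢-sym (<⇒≢ a<M))))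
                                          (trans (∑-const M 0) (*-zeroʳ M)))
                                   (cong (_* H b) (indicator-yes (b ≟ b) refl)))
                        (*-identityˡ (H b))

InRange : ℕ → ℕ × ℕ × ℕ → Set
InRange M (b , c , y) = b < M × c < M

module _ (M K : ℕ) (n : ℕ) (H : ℕ → ℕ)
         (constraint : ∀ b c → b < M → c < M → n * (b * H c + c * H b) ≤ K) where

  combine : ∀ ys → All (InRange M) ys → n * ∑ M (λ a → coefficient ys a * H a) ≤ total ys * K
  combine [] [] = ≤-reflexive (trans (cong (n *_) (trans (∑-const M 0) (*-zeroʳ M))) (*-zeroʳ n))
  combine ((b , c , y) ∷ ys) ((b<M , c<M) ∷ rs) = begin
    n * ∑ M (λ a → (y * (b * δ c a + c * δ b a) + coefficient ys a) * H a)
      ≡⟨ cong (n *_) (trans (∑-cong M λ a _ → expand y b c (δ c a) (δ b a) (coefficient ys a) (H a))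
           (trans (∑-+ M _ _) (cong (_+ rest) (trans (∑-* M y _) (cong (y *_) (trans (∑-+ M _ _)
             (cong₂ _+_ (trans (∑-* M b _) (cong (b *_) (∑-δ M c H c<M)))
                        (trans (∑-* M c _) (cong (c *_) (∑-δ M b H b<M)))))))))) ⟩
    n * (y * (b * H c + c * H b) + rest)
      ≡⟨ regroup n y (b * H c + c * H b) rest ⟩
    y * (n * (b * H c + c * H b)) + n * rest
      ≤⟨ +-mono-≤ (*-monoʳ-≤ y (constraint b c b<M c<M)) (combine ys rs) ⟩
    y * K + total ys * K
      ≡⟨ sym (*-distribʳ-+ K y (total ys)) ⟩
    (y + total ys) * K ∎
    where
    open ≤-Reasoning
    rest : ℕ
    rest = ∑ M (λ a → coefficient ys a * H a)
    expand : ∀ y b c d d′ e h → (y * (b * d + c * d′) + e) * h ≡ y * (b * (d * h) + c * (d′ * h)) + e * h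
    expand = solve-∀
    regroup : ∀ n y x r → n * (y * x + r) ≡ y * (n * x) + n * r
    regroup = solve-∀

  -- Weak duality of linear programming: a nonnegative combination of the constraints in which every
  -- H a has coefficient at least Y certifies a bound for the sum of all H a.
  dual-bound : ∀ Y ys → All (InRange M) ys → (∀ {a} → a < M → Y ≤ coefficient ys a) →
               n * (Y * ∑ M H) ≤ total ys * K
  dual-bound Y ys rs Y≤ = begin
    n * (Y * ∑ M H)                              ≡⟨ cong (n *_) (sym (∑-* M Y H)) ⟩
    n * ∑ M (λ a → Y * H a)                      ≤⟨ *-monoʳ-≤ n (∑-mono M λ a a<M → *-monoˡ-≤ (H a) (Y≤ a<M)) ⟩
    n * ∑ M (λ a → coefficient ys a * H a)       ≤⟨ combine ys rs ⟩
    total ys * K                                 ∎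
    where open ≤-Reasoning

module _ {P : ℕ} (g : ℕ → ℕ) (periodic : ∀ j → g (P + j) ≡ g j)
         (w : ℕ → ℕ) (k n M m : ℕ)
         .{{_ : NonZero (m * P)}} .{{_ : NonZero (m * ∑ P g)}}
         (pair : ∀ s t → s < M * (m * P) → t < M * (m * P) →
                 n * (s * w t + t * w s) ≤ 2 * k * (M * (m * P))) where

  private
    L G : ℕ
    L = m * P
    G = m * ∑ P g
    T : ℕ
    T = M * L

  blockWeight : ℕ → ℕ
  blockWeight b = ∑ L (λ s → g (b * L + s) * w (b * L + s))

  ∑-block : ∀ b → ∑ L (λ s → g (b * L + s)) ≡ G
  ∑-block b = trans
    (∑-cong L λ s _ → trans (cong (λ x → g (x + s)) (sym (*-assoc b m P))) (periodic-* g periodic (b * m) s))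
    (∑-periods g periodic m)

  in-block : ∀ b s → b < M → s < L → b * L + s < T
  in-block b s b<M s<L = begin-strict
    b * L + s      <⟨ +-monoʳ-< (b * L) s<L ⟩
    b * L + L      ≡⟨ +-comm (b * L) L ⟩
    suc b * L      ≤⟨ *-monoˡ-≤ L b<M ⟩
    T              ∎
    where open ≤-Reasoning

  -- Every height is lowered to the start of its block, which only weakens `pair`. The result is
  -- averaged with weights g, over s in block b and then over t in block c. Since the block length
  -- is a multiple of the period, all blocks have the same total weight G, which can be cancelled.
  block-constraint : ∀ b c → b < M → c < M → n * (b * blockWeight c + c * blockWeight b) ≤ 2 * k * (M * G)
  block-constraint b c b<M c<M = *-cancelˡ-≤ L (*-cancelˡ-≤ G (begin
    G * (L * (n * (b * blockWeight c + c * blockWeight b)))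
      ≡⟨ regroup G L n b c (blockWeight b) (blockWeight c) ⟩
    n * (c * L) * blockWeight b * G + n * (b * L) * G * blockWeight c
      ≡⟨ cong (λ x → n * (c * L) * blockWeight b * x + n * (b * L) * G * blockWeight c) (sym (∑-block c)) ⟩
    n * (c * L) * blockWeight b * ∑ L (λ t → g (c * L + t)) + n * (b * L) * G * blockWeight c
      ≤⟨ ∑-weighted-≤ L (λ t → g (c * L + t)) (λ t → w (c * L + t))
           (n * (c * L) * blockWeight b) (n * (b * L) * G) (2 * k * T * G) inner ⟩
    2 * k * T * G * ∑ L (λ t → g (c * L + t))
      ≡⟨ cong (2 * k * T * G *_) (∑-block c) ⟩
    2 * k * (M * L) * G * G
      ≡⟨ regroup′ G L (2 * k) M ⟩
    G * (L * (2 * k * (M * G))) ∎))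
    where
    open ≤-Reasoning
    regroup : ∀ G L n b c x y → G * (L * (n * (b * y + c * x))) ≡ n * (c * L) * x * G + n * (b * L) * G * y
    regroup = solve-∀
    regroup′ : ∀ G L k M → k * (M * L) * G * G ≡ G * (L * (k * (M * G)))
    regroup′ = solve-∀
    inner : ∀ t → t < L → n * (c * L) * blockWeight b + n * (b * L) * G * w (c * L + t) ≤ 2 * k * T * G
    inner t t<L = begin
      n * (c * L) * blockWeight b + n * (b * L) * G * w (c * L + t)
        ≡⟨ rearrange (n * (c * L) * blockWeight b) (n * (b * L)) G (w (c * L + t)) ⟩
      n * (b * L) * w (c * L + t) * G + n * (c * L) * blockWeight b
        ≡⟨ cong (λ x → n * (b * L) * w (c * L + t) * x + n * (c * L) * blockWeight b) (sym (∑-block b)) ⟩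
      n * (b * L) * w (c * L + t) * ∑ L (λ s → g (b * L + s)) + n * (c * L) * blockWeight b
        ≤⟨ ∑-weighted-≤ L (λ s → g (b * L + s)) (λ s → w (b * L + s))
             (n * (b * L) * w (c * L + t)) (n * (c * L)) (2 * k * T) single ⟩
      2 * k * T * ∑ L (λ s → g (b * L + s))
        ≡⟨ cong (2 * k * T *_) (∑-block b) ⟩
      2 * k * T * G ∎
      where
      rearrange : ∀ a b c d → a + b * c * d ≡ b * d * c + a
      rearrange = solve-∀
      factor : ∀ n x u y v → n * x * u + n * y * v ≡ n * (x * u + y * v)
      factor = solve-∀
      single : ∀ s → s < L → n * (b * L) * w (c * L + t) + n * (c * L) * w (b * L + s) ≤ 2 * k * T
      single s s<L = begin
        n * (b * L) * w (c * L + t) + n * (c * L) * w (b * L + s)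
          ≡⟨ factor n (b * L) (w (c * L + t)) (c * L) (w (b * L + s)) ⟩
        n * (b * L * w (c * L + t) + c * L * w (b * L + s))
          ≤⟨ *-monoʳ-≤ n (+-mono-≤ (*-monoˡ-≤ (w (c * L + t)) (m≤m+n (b * L) s))
                                   (*-monoˡ-≤ (w (b * L + s)) (m≤m+n (c * L) t))) ⟩
        n * ((b * L + s) * w (c * L + t) + (c * L + t) * w (b * L + s))
          ≤⟨ pair (b * L + s) (c * L + t) (in-block b s b<M s<L) (in-block c t c<M t<L) ⟩
        2 * k * T ∎

  weighted-bound : ∀ Y ys → All (InRange M) ys → (∀ {a} → a < M → Y ≤ coefficient ys a) →
                   n * (Y * ∑ T (λ j → g j * w j)) ≤ total ys * (2 * k * (M * G))
  weighted-bound Y ys rs Y≤ = begin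
    n * (Y * ∑ T (λ j → g j * w j))   ≡⟨ cong (λ x → n * (Y * x)) (∑-blocks M L (λ j → g j * w j)) ⟩
    n * (Y * ∑ M blockWeight)         ≤⟨ dual-bound M _ n blockWeight block-constraint Y ys rs Y≤ ⟩
    total ys * (2 * k * (M * G))      ∎
    where open ≤-Reasoning

  module _ (Y A B E : ℕ) (ys : Multipliers)
           .{{_ : NonZero n}} .{{_ : NonZero (E * (Y * (P * (P * A))))}}
           (rs : All (InRange M) ys) (Y≤ : ∀ {a} → a < M → Y ≤ coefficient ys a)
           (c : ℕ → ℕ) (count : ∀ j → j < T → P * c j ≤ g j * (w j + P))
           (T≤ : A * T ≤ B * n) (En≤k : E * n ≤ k)
           (numeric : B * (∑ P g * (2 * E * total ys + Y * P)) ≤ E * (Y * (P * (P * A)))) where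

    private
      Γ Z : ℕ
      Γ = ∑ P g
      Z = total ys
      C W : ℕ
      C = ∑ T c
      W = ∑ T (λ j → g j * w j)

    P*C≤ : P * C ≤ W + P * (M * G)
    P*C≤ = begin
      P * C                                     ≡⟨ sym (∑-* T P c) ⟩
      ∑ T (λ j → P * c j)                       ≤⟨ ∑-mono T count ⟩
      ∑ T (λ j → g j * (w j + P))               ≡⟨ ∑-cong T (λ j _ → expand (g j) (w j) P) ⟩
      ∑ T (λ j → g j * w j + P * g j)           ≡⟨ ∑-+ T _ _ ⟩
      W + ∑ T (λ j → P * g j)                   ≡⟨ cong (λ z → W + z) (∑-* T P g) ⟩
      W + P * ∑ T g                             ≡⟨ cong (λ x → W + P * x) (trans (∑-blocks M L g)
                                                     (trans (∑-cong M λ b _ → ∑-block b) (∑-const M G))) ⟩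
      W + P * (M * G)                           ∎
      where
      open ≤-Reasoning
      expand : ∀ g w P → g * (w + P) ≡ g * w + P * g
      expand = solve-∀

    -- Divided by E Y P² A, `numeric` reads (B/A)(Γ/P²)(2Z/Y + P/E) ≤ 1. The factor B/A pays for
    -- extending the heights from n to T, the term 2Z/Y is the width bound from duality, and P/E is
    -- the rounding error of up to one period per level, small because n ≤ k/E.
    density-bound : C ≤ k
    density-bound = *-cancelˡ-≤ (E * (Y * (P * (P * A)))) (*-cancelˡ-≤ n (begin
      n * (E * (Y * (P * (P * A))) * C)
        ≡⟨ e₁ n E Y P A C ⟩
      E * (A * (P * (n * (Y * (P * C)))))
        ≤⟨ *-monoʳ-≤ E (*-monoʳ-≤ A (*-monoʳ-≤ P (*-monoʳ-≤ n (*-monoʳ-≤ Y P*C≤)))) ⟩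
      E * (A * (P * (n * (Y * (W + P * (M * G))))))
        ≡⟨ cong (λ x → E * (A * (P * x))) (e₂ n Y W (P * (M * G))) ⟩
      E * (A * (P * (n * (Y * W) + n * Y * (P * (M * G)))))
        ≤⟨ *-monoʳ-≤ E (*-monoʳ-≤ A (*-monoʳ-≤ P (+-monoˡ-≤ (n * Y * (P * (M * G))) (weighted-bound Y ys rs Y≤)))) ⟩
      E * (A * (P * (Z * (2 * k * (M * (m * Γ))) + n * Y * (P * (M * (m * Γ))))))
        ≡⟨ e₃ E A P Z k M m Γ n Y ⟩
      A * (M * (m * P)) * (E * Γ * (2 * k * Z + n * (Y * P)))
        ≤⟨ *-monoˡ-≤ (E * Γ * (2 * k * Z + n * (Y * P))) T≤ ⟩
      B * n * (E * Γ * (2 * k * Z + n * (Y * P)))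
        ≡⟨ e₄ B n E Γ k Z (Y * P) ⟩
      n * (B * Γ * (2 * E * Z * k + E * n * (Y * P)))
        ≤⟨ *-monoʳ-≤ n (*-monoʳ-≤ (B * Γ) (+-monoʳ-≤ (2 * E * Z * k) (*-monoˡ-≤ (Y * P) En≤k))) ⟩
      n * (B * Γ * (2 * E * Z * k + k * (Y * P)))
        ≡⟨ cong (n *_) (e₅ B Γ (2 * E * Z) k (Y * P)) ⟩
      n * (B * (Γ * (2 * E * Z + Y * P)) * k)
        ≤⟨ *-monoʳ-≤ n (*-monoˡ-≤ k numeric) ⟩
      n * (E * (Y * (P * (P * A))) * k) ∎))
      where
      open ≤-Reasoning
      e₁ : ∀ n E Y P A C → n * (E * (Y * (P * (P * A))) * C) ≡ E * (A * (P * (n * (Y * (P * C)))))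
      e₁ = solve-∀
      e₂ : ∀ n Y W X → n * (Y * (W + X)) ≡ n * (Y * W) + n * Y * X
      e₂ = solve-∀
      e₃ : ∀ E A P Z k M m Γ n Y →
           E * (A * (P * (Z * (2 * k * (M * (m * Γ))) + n * Y * (P * (M * (m * Γ))))))
           ≡ A * (M * (m * P)) * (E * Γ * (2 * k * Z + n * (Y * P)))
      e₃ = solve-∀
      e₄ : ∀ B n E Γ k Z X → B * n * (E * Γ * (2 * k * Z + n * X)) ≡ n * (B * Γ * (2 * E * Z * k + E * n * X))
      e₄ = solve-∀
      e₅ : ∀ B Γ U k X → B * Γ * (U * k + k * X) ≡ B * (Γ * (U + X)) * k
      e₅ = solve-∀

-- Counting in residue classes

∑-term : ∀ n f i → i < n → f i ≤ ∑ n f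
∑-term (suc n) f i i<1+n with i ≟ n
... | yes refl = m≤n+m (f i) (∑ n f)
... | no  i≢n  = ≤-trans (∑-term n f i (≤∧≢⇒< (s≤s⁻¹ i<1+n) i≢n)) (m≤m+n (∑ n f) (f n))

occurrences : ℤ → List ℤ → ℕ
occurrences v []       = 0
occurrences v (x ∷ xs) = indicator (v ℤ.≟ x) + occurrences v xs

occurrences-∉ : ∀ v xs → All (v ≢_) xs → occurrences v xs ≡ 0
occurrences-∉ v []       []         = refl
occurrences-∉ v (x ∷ xs) (v≢x ∷ ps) = cong₂ _+_ (indicator-no (v ℤ.≟ x) v≢x) (occurrences-∉ v xs ps)

occurrences-Unique : ∀ v {xs} → Unique xs → (c : ℕ) → (v ∈ xs → c ≡ 1) → occurrences v xs ≤ c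
occurrences-Unique v []                     c h = z≤n
occurrences-Unique v {x ∷ xs} (x∉xs ∷ u) c h with v ℤ.≟ x
... | yes refl = ≤-reflexive (trans (cong suc (occurrences-∉ v xs x∉xs)) (sym (h (here refl))))
... | no  _    = occurrences-Unique v u c (h ∘ there)

length≤∑occurrences : ∀ N l xs → (∀ {x} → x ∈ xs → ∃[ t ] t < N × x ≡ l +ᶻ + t) →
                      length xs ≤ ∑ N (λ t → occurrences (l +ᶻ + t) xs)
length≤∑occurrences N l []       h = z≤n
length≤∑occurrences N l (x ∷ xs) h with t , t<N , x≡ ← h (here refl) = begin
  1 + length xs
    ≤⟨ +-mono-≤ (≤-trans (≤-reflexive (sym (indicator-yes _ (sym x≡)))) (∑-term N (λ t → indicator (l +ᶻ + t ℤ.≟ x)) t t<N))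
                (length≤∑occurrences N l xs (h ∘ there)) ⟩
  ∑ N (λ t → indicator (l +ᶻ + t ℤ.≟ x)) + ∑ N (λ t → occurrences (l +ᶻ + t) xs)
    ≡⟨ sym (∑-+ N _ _) ⟩
  ∑ N (λ t → occurrences (l +ᶻ + t) (x ∷ xs)) ∎
  where open ≤-Reasoning

module _ (p : ℕ) .{{_ : NonZero p}} (χ : ℤ → ℕ) (periodic : ∀ x → χ (x +ᶻ + p) ≡ χ x) where

  private
    window : ℤ → ℕ
    window l = ∑ p (λ t → χ (l +ᶻ + t))

  window-suc : ∀ l → window (sucᶻ l) ≡ window l
  window-suc l = +-cancelˡ-≡ (χ l) _ _ (begin
    χ l + ∑ p (λ t → χ (sucᶻ l +ᶻ + t))
      ≡⟨ cong₂ _+_ (cong χ (sym (ℤ.+-identityʳ l))) (∑-cong p λ t _ → cong χ (shift t)) ⟩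
    χ (l +ᶻ + 0) + ∑ p (λ t → χ (l +ᶻ + suc t))
      ≡⟨ sym (∑-head p (λ t → χ (l +ᶻ + t))) ⟩
    window l + χ (l +ᶻ + p)
      ≡⟨ cong (λ z → window l + z) (periodic l) ⟩
    window l + χ l
      ≡⟨ +-comm (window l) (χ l) ⟩
    χ l + window l ∎)
    where
    open ≡-Reasoning
    shift : ∀ t → sucᶻ l +ᶻ + t ≡ l +ᶻ + suc t
    shift t = trans (cong (_+ᶻ + t) (ℤ.+-comm (+ 1) l)) (ℤ.+-assoc l (+ 1) (+ t))

  window-const : ∀ l → window l ≡ window (+ 0)
  window-const (+ zero)       = refl
  window-const (+ suc n)      = trans (window-suc (+ n)) (window-const (+ n))
  window-const -[1+ zero ]    = sym (window-suc -[1+ zero ])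
  window-const -[1+ suc n ]   = trans (sym (window-suc -[1+ suc n ])) (window-const -[1+ n ])

  ∑-window : ∀ l q → ∑ (q * p) (λ t → χ (l +ᶻ + t)) ≡ q * ∑ p (χ ∘ +_)
  ∑-window l q = begin
    ∑ (q * p) (λ t → χ (l +ᶻ + t))
      ≡⟨ ∑-blocks q p _ ⟩
    ∑ q (λ b → ∑ p (λ s → χ (l +ᶻ + (b * p + s))))
      ≡⟨ ∑-cong q (λ b _ → trans (∑-cong p λ s _ → cong χ (sym (ℤ.+-assoc l (+ (b * p)) (+ s))))
           (trans (window-const (l +ᶻ + (b * p))) (∑-cong p λ s _ → cong χ (ℤ.+-identityˡ (+ s))))) ⟩
    ∑ q (λ b → ∑ p (χ ∘ +_))
      ≡⟨ ∑-const q _ ⟩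
    q * ∑ p (χ ∘ +_) ∎
    where open ≡-Reasoning

  module _ (l : ℤ) (w : ℕ) (xs : List ℤ) (u : Unique xs)
           (within : ∀ {x} → x ∈ xs → ∃[ t ] t ≤ w × x ≡ l +ᶻ + t)
           (χ≡1 : ∀ {x} → x ∈ xs → χ x ≡ 1) where

    length≤∑ : length xs ≤ ∑ (suc w) (λ t → χ (l +ᶻ + t))
    length≤∑ = begin
      length xs
        ≤⟨ length≤∑occurrences (suc w) l xs (λ x∈ → let t , t≤w , x≡ = within x∈ in t , s≤s t≤w , x≡) ⟩
      ∑ (suc w) (λ t → occurrences (l +ᶻ + t) xs)
        ≤⟨ ∑-mono (suc w) (λ t _ → occurrences-Unique (l +ᶻ + t) u (χ (l +ᶻ + t)) χ≡1) ⟩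
      ∑ (suc w) (λ t → χ (l +ᶻ + t)) ∎
      where open ≤-Reasoning

    count-bound : length xs ≤ suc (w / p) * ∑ p (χ ∘ +_)
    count-bound = begin
      length xs                                          ≤⟨ length≤∑ ⟩
      ∑ (suc w) (λ t → χ (l +ᶻ + t))                     ≤⟨ ∑-≤ _ w< ⟩
      ∑ (suc (w / p) * p) (λ t → χ (l +ᶻ + t))           ≡⟨ ∑-window l (suc (w / p)) ⟩
      suc (w / p) * ∑ p (χ ∘ +_)                         ∎
      where
      open ≤-Reasoning
      w< : w < suc (w / p) * p
      w< = begin-strict
        w                    ≡⟨ m≡m%n+[m/n]*n w p ⟩
        w % p + w / p * p    <⟨ +-monoˡ-< (w / p * p) (m%n<n w p) ⟩
        p + w / p * p        ∎

    scaled-count-bound : p * length xs ≤ ∑ p (χ ∘ +_) * (w + p)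
    scaled-count-bound = begin
      p * length xs                             ≤⟨ *-monoʳ-≤ p count-bound ⟩
      p * (suc (w / p) * ∑ p (χ ∘ +_))          ≡⟨ regroup p (w / p) (∑ p (χ ∘ +_)) ⟩
      ∑ p (χ ∘ +_) * (w / p * p + p)            ≤⟨ *-monoʳ-≤ (∑ p (χ ∘ +_)) (+-monoˡ-≤ p (m/n*n≤m w p)) ⟩
      ∑ p (χ ∘ +_) * (w + p)                    ∎
      where
      open ≤-Reasoning
      regroup : ∀ p q s → p * (suc q * s) ≡ s * (q * p + p)
      regroup = solve-∀

    -- An interval of width m p has m p + 1 integers: m full periods and one leftover endpoint.
    -- `count-bound` would charge a whole further period for that endpoint, which is too much when
    -- the exact constant matters.
    exact-count-bound : (∀ x → χ x ≤ 1) → ∀ m → w ≡ m * p → length xs ≤ m * ∑ p (χ ∘ +_) + 1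
    exact-count-bound χ≤1 m refl = ≤-trans length≤∑ (+-mono-≤ (≤-reflexive (∑-window l m)) (χ≤1 (l +ᶻ + (m * p))))

∣-shift : ∀ d P x → d ∣ P → d ∣ ∣ x ∣ → d ∣ ∣ x +ᶻ + P ∣
∣-shift d P x d∣P d∣x = Signed.∣⇒∣ᵤ (Signed.∣m∣n⇒∣m+n (Signed.∣ᵤ⇒∣ {+ d} {x} d∣x) (Signed.∣ᵤ⇒∣ {+ d} {+ P} d∣P))

∣-unshift : ∀ d P x → d ∣ P → d ∣ ∣ x +ᶻ + P ∣ → d ∣ ∣ x ∣
∣-unshift d P x d∣P d∣x+P = Signed.∣⇒∣ᵤ (Signed.∣m+n∣n⇒∣m {+ d} {x} (Signed.∣ᵤ⇒∣ {+ d} {x +ᶻ + P} d∣x+P) (Signed.∣ᵤ⇒∣ {+ d} {+ P} d∣P))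

κᶻ : ℕ → ℤ → ℕ
κᶻ j x = κ ∣ x ∣ j

κᶻ-periodic : ∀ j x → κᶻ j (x +ᶻ + j) ≡ κᶻ j x
κᶻ-periodic j x = indicator-⇔ _ _
  (λ c {d} (d∣x , d∣j) → c (∣-shift d j x d∣j d∣x , d∣j))
  (λ c {d} (d∣x , d∣j) → c (∣-unshift d j x d∣j d∣x , d∣j))

ν : ℕ → ℕ → ℤ → ℕ
ν p j x = 1 ∸ indicator (p ∣? j) * indicator (p ∣? ∣ x ∣)

ν-periodicˡ : ∀ p P j x → p ∣ P → ν p (P + j) x ≡ ν p j x
ν-periodicˡ p P j x p∣P = cong (λ i → 1 ∸ i * indicator (p ∣? ∣ x ∣))
  (indicator-⇔ (p ∣? (P + j)) (p ∣? j) (λ p∣P+j → ∣m+n∣m⇒∣n p∣P+j p∣P) (∣m∣n⇒∣m+n p∣P))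

ν-periodicʳ : ∀ p P j x → p ∣ P → ν p j (x +ᶻ + P) ≡ ν p j x
ν-periodicʳ p P j x p∣P = cong (λ i → 1 ∸ indicator (p ∣? j) * i)
  (indicator-⇔ (p ∣? ∣ x +ᶻ + P ∣) (p ∣? ∣ x ∣) (∣-unshift p P x p∣P) (∣-shift p P x p∣P))

ν-coprime : ∀ p j x → p ≢ 1 → Coprime ∣ x ∣ j → ν p j x ≡ 1
ν-coprime p j x p≢1 c with p ∣? j | p ∣? ∣ x ∣
... | yes p∣j | yes p∣x = contradiction (c (p∣x , p∣j)) p≢1
... | yes _   | no _    = refl
... | no _    | _       = refl

-- The exact indicator `κᶻ j` has period j, which changes with the level. This majorant sees only
-- four primes, but it has period 210 in both arguments, as averaging over blocks of levels
-- requires.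
sieve : ℕ → ℤ → ℕ
sieve j x = ν 2 j x * ν 3 j x * ν 5 j x * ν 7 j x

private
  2∣210 : 2 ∣ 210
  2∣210 = divides 105 refl
  3∣210 : 3 ∣ 210
  3∣210 = divides 70 refl
  5∣210 : 5 ∣ 210
  5∣210 = divides 42 refl
  7∣210 : 7 ∣ 210
  7∣210 = divides 30 refl

sieve-periodicˡ : ∀ j x → sieve (210 + j) x ≡ sieve j x
sieve-periodicˡ j x = cong₂ _*_ (cong₂ _*_ (cong₂ _*_ (ν-periodicˡ 2 210 j x 2∣210) (ν-periodicˡ 3 210 j x 3∣210))
  (ν-periodicˡ 5 210 j x 5∣210)) (ν-periodicˡ 7 210 j x 7∣210)

sieve-periodicʳ : ∀ j x → sieve j (x +ᶻ + 210) ≡ sieve j x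
sieve-periodicʳ j x = cong₂ _*_ (cong₂ _*_ (cong₂ _*_ (ν-periodicʳ 2 210 j x 2∣210) (ν-periodicʳ 3 210 j x 3∣210))
  (ν-periodicʳ 5 210 j x 5∣210)) (ν-periodicʳ 7 210 j x 7∣210)

sieve-coprime : ∀ j x → Coprime ∣ x ∣ j → sieve j x ≡ 1
sieve-coprime j x c = cong₂ _*_ (cong₂ _*_ (cong₂ _*_ (ν-coprime 2 j x (λ ()) c) (ν-coprime 3 j x (λ ()) c))
  (ν-coprime 5 j x (λ ()) c)) (ν-coprime 7 j x (λ ()) c)

density : ℕ → ℕ
density j = ∑ 210 (λ t → sieve j (+ t))

density-periodic : ∀ j → density (210 + j) ≡ density j
density-periodic j = ∑-cong 210 λ t _ → sieve-periodicˡ j (+ t)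

-- 27648 = (2² - 1) (3² - 1) (5² - 1) (7² - 1)
∑-density : ∑ 210 density ≡ 27648
∑-density = refl

-- Levels of a nice set

-- The ends `l` and `l + w` are required to be members, since the determinant condition is going to
-- be applied to them.
data Extent (xs : List ℤ) : Set where
  none : xs ≡ [] → Extent xs
  span : ∀ l w → l ∈ xs → l +ᶻ + w ∈ xs → (∀ {x} → x ∈ xs → ∃[ t ] t ≤ w × x ≡ l +ᶻ + t) → Extent xs

width : ∀ {xs} → Extent xs → ℕ
width (none _)         = 0
width (span _ w _ _ _) = w

≤⇒+ : ∀ {i j} → i ≤ᶻ j → ∃[ t ] j ≡ i +ᶻ + t
≤⇒+ {i} {j} i≤j = ∣ j -ᶻ i ∣ , sym (trans (cong (λ z → i +ᶻ z) (ℤ.0≤i⇒+∣i∣≡i (ℤ.i≤j⇒0≤j-i i≤j))) (cancel i j))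
  where
  cancel : ∀ i j → i +ᶻ (j -ᶻ i) ≡ j
  cancel = ℤ-Solver.solve-∀

extent : ∀ xs → Extent xs
extent []       = none refl
extent (x ∷ xs) with extent xs
... | none refl = span x 0 (here refl) (here (ℤ.+-identityʳ x)) λ { (here refl) → 0 , z≤n , sym (ℤ.+-identityʳ x) }
... | span l w l∈ r∈ within with ℤ.≤-total x l
...   | inj₁ x≤l with d , l≡ ← ≤⇒+ x≤l =
  span x (d + w) (here refl) (there (subst (_∈ xs) (shift w) r∈))
    λ { (here refl) → 0 , z≤n , sym (ℤ.+-identityʳ x)
      ; (there y∈) → let t , t≤w , y≡ = within y∈ in d + t , +-monoʳ-≤ d t≤w , trans y≡ (shift t) }
  where
  shift : ∀ t → l +ᶻ + t ≡ x +ᶻ + (d + t)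
  shift t = trans (cong (_+ᶻ + t) l≡) (ℤ.+-assoc x (+ d) (+ t))
...   | inj₂ l≤x with d , x≡ ← ≤⇒+ l≤x with ≤-total d w
...     | inj₁ d≤w = span l w (there l∈) (there r∈)
  λ { (here refl) → d , d≤w , x≡ ; (there y∈) → within y∈ }
...     | inj₂ w≤d = span l d (there l∈) (here (sym x≡))
  λ { (here refl) → d , ≤-refl , x≡ ; (there y∈) → let t , t≤w , y≡ = within y∈ in t , ≤-trans t≤w w≤d , y≡ }

-- The points (x , j) of a set with heights 1 ≤ j ≤ n, listed by height.
record Levels (k n : ℕ) : Set where
  field
    level    : ℕ → List ℤ
    unique   : ∀ j → Unique (level j)
    coprime  : ∀ {j x} → x ∈ level j → Coprime ∣ x ∣ j
    detBound : ∀ {i j x y} → x ∈ level i → y ∈ level j → ∣ x *ᶻ + j -ᶻ y *ᶻ + i ∣ ≤ k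
    bottom   : level 0 ≡ []
    top      : level n ≢ []
    above    : ∀ {j} → n < j → level j ≡ []

module LevelBounds {k n : ℕ} (ls : Levels k n) where
  open Levels ls public

  c w : ℕ → ℕ
  c j = length (level j)
  w j = width (extent (level j))

  c-empty : ∀ j → level j ≡ [] → c j ≡ 0
  c-empty j eq = cong length eq

  w-empty : ∀ j → level j ≡ [] → w j ≡ 0
  w-empty j eq = trans (cong (λ xs → width (extent xs)) eq) refl

  -- Add two determinants: right end of level i against left end of level j, and the reverse. The
  -- positions cancel and only the widths survive.
  span-pair : ∀ i j {l w l′ w′} → l ∈ level i → l +ᶻ + w ∈ level i → l′ ∈ level j → l′ +ᶻ + w′ ∈ level j →
              i * w′ + j * w ≤ 2 * k
  span-pair i j {l} {w} {l′} {w′} l∈ r∈ l′∈ r′∈ = begin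
    i * w′ + j * w
      ≡⟨⟩
    ∣ + (i * w′) +ᶻ + (j * w) ∣
      ≡⟨ cong ∣_∣ (trans (cong₂ _+ᶻ_ (ℤ.pos-* i w′) (ℤ.pos-* j w)) (split (+ i) (+ j) l (+ w) l′ (+ w′))) ⟩
    ∣ ((l +ᶻ + w) *ᶻ + j -ᶻ l′ *ᶻ + i) +ᶻ ((l′ +ᶻ + w′) *ᶻ + i -ᶻ l *ᶻ + j) ∣
      ≤⟨ ℤ.∣i+j∣≤∣i∣+∣j∣ ((l +ᶻ + w) *ᶻ + j -ᶻ l′ *ᶻ + i) ((l′ +ᶻ + w′) *ᶻ + i -ᶻ l *ᶻ + j) ⟩
    ∣ (l +ᶻ + w) *ᶻ + j -ᶻ l′ *ᶻ + i ∣ + ∣ (l′ +ᶻ + w′) *ᶻ + i -ᶻ l *ᶻ + j ∣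
      ≤⟨ +-mono-≤ (detBound r∈ l′∈) (≤-trans (detBound r′∈ l∈) (m≤m+n k 0)) ⟩
    2 * k ∎
    where
    open ≤-Reasoning
    split : ∀ i j l w l′ w′ → i *ᶻ w′ +ᶻ j *ᶻ w ≡ ((l +ᶻ w) *ᶻ j -ᶻ l′ *ᶻ i) +ᶻ ((l′ +ᶻ w′) *ᶻ i -ᶻ l *ᶻ j)
    split = ℤ-Solver.solve-∀

  top-pair : ∀ i → n * w i ≤ 2 * k
  top-pair i with extent (level i) | extent (level n)
  ... | none _ | _       = ≤-trans (≤-reflexive (*-zeroʳ n)) z≤n
  ... | _      | none eq = contradiction eq top
  ... | span l w l∈ r∈ _ | span l′ w′ l′∈ r′∈ _ = ≤-trans (m≤n+m (n * w) (i * w′)) (span-pair i n l∈ r∈ l′∈ r′∈)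

  -- An empty level has width 0 by convention and offers no points to compare. The top level is
  -- nonempty, so `top-pair` bounds n times the other width, and the heights are at most n.
  pair : ∀ i j → i ≤ n → j ≤ n → i * w j + j * w i ≤ 2 * k
  pair i j i≤n j≤n with extent (level i) in eqᵢ | extent (level j) in eqⱼ
  ... | span l w l∈ r∈ _ | span l′ w′ l′∈ r′∈ _ = span-pair i j l∈ r∈ l′∈ r′∈
  ... | none _ | E = begin
    i * width E + j * 0   ≡⟨ cong (λ z → i * width E + z) (*-zeroʳ j) ⟩
    i * width E + 0       ≡⟨ +-identityʳ _ ⟩
    i * width E           ≤⟨ *-monoˡ-≤ (width E) i≤n ⟩
    n * width E           ≡⟨ cong (λ E → n * width E) (sym eqⱼ) ⟩
    n * w j               ≤⟨ top-pair j ⟩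
    2 * k                 ∎
    where open ≤-Reasoning
  ... | E@(span _ _ _ _ _) | none _ = begin
    i * 0 + j * width E   ≡⟨ cong (λ z → z + j * width E) (*-zeroʳ i) ⟩
    j * width E           ≤⟨ *-monoˡ-≤ (width E) j≤n ⟩
    n * width E           ≡⟨ cong (λ E → n * width E) (sym eqᵢ) ⟩
    n * w i               ≤⟨ top-pair i ⟩
    2 * k                 ∎
    where open ≤-Reasoning

  -- Here χ may be any periodic majorant of coprimality to j. The instances below are the exact
  -- indicator of period j, the sieve of period 210, and the constant 1.
  level-count : ∀ j p .{{_ : NonZero p}} (χ : ℤ → ℕ) → (∀ x → χ (x +ᶻ + p) ≡ χ x) →
                (∀ x → Coprime ∣ x ∣ j → χ x ≡ 1) → c j ≤ suc (w j / p) * ∑ p (χ ∘ +_)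
  level-count j p χ per χ≡1 with extent (level j)
  ... | none eq = ≤-trans (≤-reflexive (c-empty j eq)) z≤n
  ... | span l w _ _ within = count-bound p χ per l w (level j) (unique j) within (λ x∈ → χ≡1 _ (coprime x∈))

  level-count-scaled : ∀ j p .{{_ : NonZero p}} (χ : ℤ → ℕ) → (∀ x → χ (x +ᶻ + p) ≡ χ x) →
                       (∀ x → Coprime ∣ x ∣ j → χ x ≡ 1) → p * c j ≤ ∑ p (χ ∘ +_) * (w j + p)
  level-count-scaled j p χ per χ≡1 with extent (level j)
  ... | none eq = ≤-trans (≤-reflexive (trans (cong (p *_) (c-empty j eq)) (*-zeroʳ p))) z≤n
  ... | span l w _ _ within = scaled-count-bound p χ per l w (level j) (unique j) within (λ x∈ → χ≡1 _ (coprime x∈))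

  c≤ : ∀ j .{{_ : NonZero j}} → c j ≤ suc (w j / j) * φ j
  c≤ j = level-count j j (κᶻ j) (κᶻ-periodic j) (λ x → indicator-yes (coprime? ∣ x ∣ j))

  c≤-φ : ∀ j .{{_ : NonZero j}} → j * c j ≤ φ j * (w j + j)
  c≤-φ j = level-count-scaled j j (κᶻ j) (κᶻ-periodic j) (λ x → indicator-yes (coprime? ∣ x ∣ j))

  c≤-density : ∀ j → 210 * c j ≤ density j * (w j + 210)
  c≤-density j = level-count-scaled j 210 (sieve j) (sieve-periodicʳ j) (sieve-coprime j)

  c≤1+w : ∀ j → c j ≤ suc (w j)
  c≤1+w j = ≤-trans (level-count j 1 (λ _ → 1) (λ _ → refl) (λ _ _ → refl))
    (≤-reflexive (trans (*-identityʳ _) (cong suc (n/1≡n (w j)))))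

  c₃≤ : ∀ m → w 3 ≡ m * 3 → c 3 ≤ m * 2 + 1
  c₃≤ m eq with extent (level 3)
  ... | none empty = ≤-trans (≤-reflexive (c-empty 3 empty)) z≤n
  ... | span l w _ _ within = exact-count-bound 3 (κᶻ 3) (κᶻ-periodic 3) l w (level 3) (unique 3) within
    (λ x∈ → indicator-yes (coprime? _ 3) (coprime x∈)) (λ x → indicator≤1 (coprime? ∣ x ∣ 3)) m eq

-- Point counts for bounded height at least four

module _ (N : ℕ) where

  private
    D : ℕ
    D = N !
    instance
      D≢0 : NonZero D
      D≢0 = N !≢0

  -- scaled by the common denominator D
  reciprocal : ℕ → ℕ
  reciprocal zero    = 0
  reciprocal (suc i) = D / suc i

  i*reciprocal : ∀ i → 0 < i → i ≤ N → i * reciprocal i ≡ D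
  i*reciprocal (suc i) _ i<N = trans (*-comm (suc i) (D / suc i))
    (m/n*n≡m (∣-trans (m∣m*n (i !)) (m≤n⇒m!∣n! i<N)))

  module _ {k q : ℕ} (ls : Levels k (4 + q)) (n≤N : 4 + q ≤ N) (k-large : D * D * (N * N) ≤ k) where
    open LevelBounds ls

    private
      n : ℕ
      n = 4 + q
      C R Φ : ℕ
      C = ∑ n (λ a → c (suc a))
      R = ∑ n (λ a → φ (suc a) * (reciprocal (suc a) * w (suc a)))
      Φ = ∑ n (λ a → φ (suc a))

    DC≤ : D * C ≤ R + D * Φ
    DC≤ = begin
      D * C                                             ≡⟨ sym (∑-* n D _) ⟩
      ∑ n (λ a → D * c (suc a))                         ≤⟨ ∑-mono n pointwise ⟩
      ∑ n (λ a → φ (suc a) * (reciprocal (suc a) * w (suc a)) + D * φ (suc a))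
                                                        ≡⟨ ∑-+ n _ _ ⟩
      R + ∑ n (λ a → D * φ (suc a))                     ≡⟨ cong (λ z → R + z) (∑-* n D _) ⟩
      R + D * Φ                                         ∎
      where
      open ≤-Reasoning
      pointwise : ∀ a → a < n → D * c (suc a) ≤ φ (suc a) * (reciprocal (suc a) * w (suc a)) + D * φ (suc a)
      pointwise a a<n = begin
        D * c j                       ≡⟨ cong (_* c j) (sym je≡D) ⟩
        j * e * c j                   ≡⟨ swap₁ j e (c j) ⟩
        e * (j * c j)                 ≤⟨ *-monoʳ-≤ e (c≤-φ j) ⟩
        e * (φ j * (w j + j))         ≡⟨ swap₂ e (φ j) (w j) j ⟩
        φ j * (e * w j) + j * e * φ j ≡⟨ cong (λ z → φ j * (e * w j) + z * φ j) je≡D ⟩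
        φ j * (e * w j) + D * φ j     ∎
        where
        j e : ℕ
        j = suc a
        e = reciprocal j
        je≡D : j * e ≡ D
        je≡D = i*reciprocal j z<s (≤-trans a<n n≤N)
        swap₁ : ∀ j e c → j * e * c ≡ e * (j * c)
        swap₁ = solve-∀
        swap₂ : ∀ e f w j → e * (f * (w + j)) ≡ f * (e * w) + j * e * f
        swap₂ = solve-∀

    Φ≤ : Φ ≤ N * N
    Φ≤ = begin
      Φ                 ≤⟨ ∑-mono n (λ a a<n → ≤-trans (φ≤ (suc a)) (≤-trans a<n n≤N)) ⟩
      ∑ n (λ _ → N)     ≡⟨ ∑-const n N ⟩
      n * N             ≤⟨ *-monoˡ-≤ N n≤N ⟩
      N * N             ∎
      where open ≤-Reasoning

    -- Rounding adds at most φ(j) points to level j, altogether at most N². Multiplied by D² this is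
    -- at most k, exactly the slack that `farey-bound` leaves after halving.
    few-points-bounded-height : C ≤ k
    few-points-bounded-height = *-cancelˡ-≤ (D * D) (+-cancelʳ-≤ k _ _ (begin
      D * D * C + k
        ≡⟨ cong (λ z → z + k) (*-assoc D D C) ⟩
      D * (D * C) + k
        ≤⟨ +-monoˡ-≤ k (*-monoʳ-≤ D DC≤) ⟩
      D * (R + D * Φ) + k
        ≡⟨ regroup D R Φ k ⟩
      (D * R + k) + D * D * Φ
        ≤⟨ +-mono-≤ farey (≤-trans (*-monoʳ-≤ (D * D) Φ≤) k-large) ⟩
      D * D * k + k ∎))
      where
      open ≤-Reasoning
      instance
        D*D≢0 : NonZero (D * D)
        D*D≢0 = m*n≢0 D D
      regroup : ∀ D R Φ k → D * (R + D * Φ) + k ≡ (D * R + k) + D * D * Φ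
      regroup = solve-∀
      double : ∀ D R k → 2 * (D * R + k) ≡ D * (2 * R) + 2 * k
      double = solve-∀
      halve : ∀ D k → 2 * k * (D * D) ≡ 2 * (D * D * k)
      halve = solve-∀
      farey : D * R + k ≤ D * D * k
      farey = *-cancelˡ-≤ 2 (begin
        2 * (D * R + k)       ≡⟨ double D R k ⟩
        D * (2 * R) + 2 * k   ≤⟨ farey-bound {D} {k} {q} reciprocal w
                                   (λ i 0<i i≤n → i*reciprocal i 0<i (≤-trans i≤n n≤N))
                                   (λ i j _ _ i≤n j≤n → pair i j i≤n j≤n) ⟩
        2 * k * (D * D)       ≡⟨ halve D k ⟩
        2 * (D * D * k)       ∎)

-- Multipliers (b , c , y) for 80 blocks, found greedily: they follow the circle b² + c² = 80²
-- and imply that the sum of the H b is at most 0.79237 K, compared with (π/4) K in the limit.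
circle : Multipliers
circle =
  (0 , 79 , 1266) ∷ (1 , 79 , 1266) ∷ (2 , 79 , 1266) ∷ (3 , 79 , 1266) ∷ (4 , 79 , 1266) ∷
  (5 , 79 , 1266) ∷ (6 , 79 , 1266) ∷ (7 , 79 , 1266) ∷ (8 , 79 , 1266) ∷ (9 , 79 , 1266) ∷
  (10 , 79 , 1266) ∷ (11 , 79 , 1266) ∷ (12 , 79 , 1266) ∷ (13 , 79 , 97) ∷ (13 , 78 , 1184) ∷
  (14 , 78 , 1283) ∷ (15 , 78 , 1283) ∷ (16 , 78 , 1283) ∷ (17 , 78 , 1283) ∷ (18 , 78 , 282) ∷
  (18 , 77 , 1014) ∷ (19 , 77 , 1299) ∷ (20 , 77 , 1299) ∷ (21 , 77 , 1299) ∷ (22 , 77 , 174) ∷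
  (22 , 76 , 1140) ∷ (23 , 76 , 1316) ∷ (24 , 76 , 1316) ∷ (25 , 76 , 523) ∷ (25 , 75 , 804) ∷
  (26 , 75 , 1334) ∷ (27 , 75 , 1334) ∷ (28 , 75 , 329) ∷ (28 , 74 , 1018) ∷ (29 , 74 , 1352) ∷
  (30 , 74 , 1077) ∷ (30 , 73 , 279) ∷ (31 , 73 , 1370) ∷ (32 , 73 , 1370) ∷ (33 , 73 , 162) ∷
  (33 , 72 , 1225) ∷ (34 , 72 , 1389) ∷ (35 , 72 , 353) ∷ (35 , 71 , 1051) ∷ (36 , 71 , 1409) ∷
  (37 , 71 , 338) ∷ (37 , 70 , 1086) ∷ (38 , 70 , 1429) ∷ (39 , 70 , 142) ∷ (39 , 69 , 1306) ∷
  (40 , 69 , 1227) ∷ (40 , 68 , 226) ∷ (41 , 68 , 1471) ∷ (42 , 68 , 730) ∷ (42 , 67 , 752) ∷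
  (43 , 67 , 1493) ∷ (44 , 67 , 96) ∷ (44 , 66 , 1418) ∷ (45 , 66 , 836) ∷ (45 , 65 , 690) ∷
  (46 , 65 , 1499) ∷ (46 , 64 , 41) ∷ (47 , 64 , 1563) ∷ (48 , 64 , 514) ∷ (48 , 63 , 1066) ∷
  (49 , 63 , 997) ∷ (49 , 62 , 600) ∷ (50 , 62 , 1412) ∷ (50 , 61 , 205) ∷ (51 , 61 , 1640) ∷
  (52 , 61 , 118) ∷ (52 , 60 , 1547) ∷ (53 , 60 , 369) ∷ (53 , 59 , 1320) ∷ (54 , 59 , 557) ∷
  (54 , 58 , 1158) ∷ (55 , 58 , 682) ∷ (55 , 57 , 1061) ∷ (56 , 57 , 744) ∷ (56 , 56 , 515) ∷ []

circle-inRange : All (InRange 80) circle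
circle-inRange = toWitness {a? = All.all? (λ (b , c , y) → (b <? 80) ×-dec (c <? 80)) circle} tt

circle-coefficient : ∀ {a} → a < 80 → 100000 ≤ coefficient circle a
circle-coefficient = toWitness {a? = allUpTo? (λ a → 100000 ≤? coefficient circle a) 80} tt

total-circle : total circle ≡ 79237
total-circle = refl

-- Point counts for great height

module _ {k n : ℕ} (ls : Levels k n) where
  open LevelBounds ls

  -- The blocks must cover a multiple of the block length, so heights between n and T occur. Their
  -- levels are empty, and `top-pair` takes over for the other one. Having n on the left and T on
  -- the right makes one inequality serve all cases.
  pair-beyond : ∀ T → n < T → ∀ s t → s < T → t < T → n * (s * w t + t * w s) ≤ 2 * k * T
  pair-beyond T n<T s t s<T t<T with s ≤? n | t ≤? n
  ... | yes s≤n | yes t≤n = begin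
    n * (s * w t + t * w s)  ≤⟨ *-mono-≤ (<⇒≤ n<T) (pair s t s≤n t≤n) ⟩
    T * (2 * k)              ≡⟨ *-comm T (2 * k) ⟩
    2 * k * T                ∎
    where open ≤-Reasoning
  ... | yes _   | no t≰n = begin
    n * (s * w t + t * w s)  ≡⟨ cong (λ z → n * (s * z + t * w s)) (w-empty t (above (≰⇒> t≰n))) ⟩
    n * (s * 0 + t * w s)    ≡⟨ regroup n s t (w s) ⟩
    n * w s * t              ≤⟨ *-mono-≤ (top-pair s) (<⇒≤ t<T) ⟩
    2 * k * T                ∎
    where
    open ≤-Reasoning
    regroup : ∀ n s t x → n * (s * 0 + t * x) ≡ n * x * t
    regroup = solve-∀
  ... | no s≰n  | _      = begin
    n * (s * w t + t * w s)  ≡⟨ cong (λ z → n * (s * w t + t * z)) (w-empty s (above (≰⇒> s≰n))) ⟩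
    n * (s * w t + t * 0)    ≡⟨ regroup n s t (w t) ⟩
    n * w t * s              ≤⟨ *-mono-≤ (top-pair t) (<⇒≤ s<T) ⟩
    2 * k * T                ∎
    where
    open ≤-Reasoning
    regroup : ∀ n s t x → n * (s * x + t * 0) ≡ n * x * s
    regroup = solve-∀

  module _ {P : ℕ} .{{_ : NonZero P}} (g : ℕ → ℕ) (periodic : ∀ j → g (P + j) ≡ g j)
           (count : ∀ j → P * c j ≤ g j * (w j + P))
           (M Y A E Γ Z : ℕ) .{{_ : NonZero Γ}} .{{_ : NonZero (M * P)}} .{{_ : NonZero n}}
           .{{_ : NonZero (E * (Y * (P * (P * A))))}} (ys : Multipliers)
           (rs : All (InRange M) ys) (Y≤ : ∀ {a} → a < M → Y ≤ coefficient ys a)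
           (∑g≡Γ : ∑ P g ≡ Γ) (total≡Z : total ys ≡ Z)
           (numeric : suc A * (Γ * (2 * E * Z + Y * P)) ≤ E * (Y * (P * (P * A))))
           (n-large : A * (M * P) ≤ n) (En≤k : E * n ≤ k) where

    few-points-dense : ∑ n (λ a → c (suc a)) ≤ k
    few-points-dense = begin
      ∑ n (λ a → c (suc a))          ≤⟨ m≤n+m _ (c 0) ⟩
      c 0 + ∑ n (λ a → c (suc a))    ≡⟨ sym (∑-head n c) ⟩
      ∑ (suc n) c                    ≤⟨ ∑-≤ c n<T ⟩
      ∑ T c                          ≤⟨ density-bound g periodic w k n M m (pair-beyond T n<T) Y A (suc A) E ys rs Y≤ c
                                          (λ j _ → count j) T≤ En≤k numeric′ ⟩
      k                              ∎
      where
      open ≤-Reasoning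
      Q m T : ℕ
      Q = M * P
      -- This makes T the least multiple of M P beyond n. The overshoot is at most M P, hence at
      -- most n / A by `n-large`.
      m = suc (n / Q)
      T = M * (m * P)
      instance
        mP≢0 : NonZero (m * P)
        mP≢0 = m*n≢0 m P
        mΓ≢0 : NonZero (m * ∑ P g)
        mΓ≢0 = m*n≢0 m (∑ P g) {{_}} {{subst NonZero (sym ∑g≡Γ) (≢-nonZero (≢-nonZero⁻¹ Γ))}}
      numeric′ : suc A * (∑ P g * (2 * E * total ys + Y * P)) ≤ E * (Y * (P * (P * A)))
      numeric′ = subst₂ (λ Γ Z → suc A * (Γ * (2 * E * Z + Y * P)) ≤ E * (Y * (P * (P * A))))
        (sym ∑g≡Γ) (sym total≡Z) numeric
      regroup : ∀ M P x → M * (suc x * P) ≡ M * P + x * (M * P)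
      regroup = solve-∀
      n<T : n < T
      n<T = begin-strict
        n                      ≡⟨ m≡m%n+[m/n]*n n Q ⟩
        n % Q + n / Q * Q      <⟨ +-monoˡ-< (n / Q * Q) (m%n<n n Q) ⟩
        Q + n / Q * Q          ≡⟨ sym (regroup M P (n / Q)) ⟩
        T                      ∎
      T≤ : A * T ≤ suc A * n
      T≤ = begin
        A * T                      ≡⟨ cong (A *_) (regroup M P (n / Q)) ⟩
        A * (Q + n / Q * Q)        ≡⟨ *-distribˡ-+ A Q _ ⟩
        A * Q + A * (n / Q * Q)    ≤⟨ +-mono-≤ n-large (*-monoʳ-≤ A (m/n*n≤m n Q)) ⟩
        suc A * n                  ∎

abstract

  -- Abstract, since unfolding multiplication by these numerals is expensive.
  heightThreshold aspectRatio : ℕ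
  heightThreshold = 500 * (80 * 210)
  aspectRatio     = 100000

  aspectRatio≢0 : NonZero aspectRatio
  aspectRatio≢0 = _

  few-points-great-height : ∀ {k n} (ls : Levels k n) .{{_ : NonZero n}} → heightThreshold ≤ n → aspectRatio * n ≤ k →
                            ∑ n (λ a → LevelBounds.c ls (suc a)) ≤ k
  few-points-great-height ls n-large En≤k =
    few-points-dense ls {P = 210} density density-periodic (LevelBounds.c≤-density ls) 80 100000 500 100000 27648 79237
      circle circle-inRange circle-coefficient ∑-density total-circle numeric n-large En≤k
    where
    -- In quotients: (501/500)(27648/210²)(2 · 0.79237 + 210/100000) ≤ 1. The main part 27648/210² ·
    -- 2 · 0.79237 is about 0.9935, so some 0.6 per cent remain for the block overshoot and the
    -- rounding. The constants 500 and 100000 are chosen to fit into that.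
    numeric : 501 * (27648 * (2 * 100000 * 79237 + 100000 * 210)) ≤ 100000 * (100000 * (210 * (210 * 500)))
    numeric = ≤ᵇ⇒≤ _ _ tt

-- Heights at most three

bonus : ℕ → ℕ
bonus 2 = 4
bonus 1 = 3
bonus 3 = 3
bonus 5 = 3
bonus _ = 2

closedForm-bonus : ∀ k → closedForm k ≡ k + bonus (k % 6)
closedForm-bonus k with k % 6
... | 0 = refl
... | 1 = refl
... | 2 = refl
... | 3 = refl
... | 4 = refl
... | 5 = refl
... | suc (suc (suc (suc (suc (suc _))))) = refl

2≤bonus : ∀ r → 2 ≤ bonus r
2≤bonus 0 = ≤-refl
2≤bonus 1 = s≤s (s≤s z≤n)
2≤bonus 2 = s≤s (s≤s z≤n)
2≤bonus 3 = s≤s (s≤s z≤n)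
2≤bonus 4 = ≤-refl
2≤bonus 5 = s≤s (s≤s z≤n)
2≤bonus (suc (suc (suc (suc (suc (suc _)))))) = ≤-refl

k+2≤closedForm : ∀ k → k + 2 ≤ closedForm k
k+2≤closedForm k = ≤-trans (+-monoʳ-≤ k (2≤bonus (k % 6))) (≤-reflexive (sym (closedForm-bonus k)))

≤+∣∣ : ∀ {i k} → ∣ i ∣ ≤ k → i ≤ᶻ + k
≤+∣∣ {+ n}      n≤k = +≤+ n≤k
≤+∣∣ { -[1+ n ]} _  = -≤+

-- The integer division `/ℕ` rounds down for negative z as well, so the estimate is sharp for both
-- signs.
floor-bound : ∀ d .{{_ : NonZero d}} x y z → x *ᶻ + d ≤ᶻ y *ᶻ + d +ᶻ z → x ≤ᶻ y +ᶻ z /ℕ d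
floor-bound d@(suc _) x y z xd≤ = subst (x ≤ᶻ_) (ℤ.pred-suc (y +ᶻ z /ℕ d)) (ℤ.i<j⇒i≤pred[j] {x} {sucᶻ (y +ᶻ z /ℕ d)}
  (ℤ.*-cancelʳ-<-nonNeg {x} {sucᶻ (y +ᶻ z /ℕ d)} (+ d) (begin-strict
    x *ᶻ + d                             ≤⟨ xd≤ ⟩
    y *ᶻ + d +ᶻ z                        <⟨ ℤ.+-monoʳ-< (y *ᶻ + d) (n<s[n/ℕd]*d z d) ⟩
    y *ᶻ + d +ᶻ sucᶻ (z /ℕ d) *ᶻ + d     ≡⟨ regroup y (+ d) (z /ℕ d) ⟩
    sucᶻ (y +ᶻ z /ℕ d) *ᶻ + d            ∎)))
  where
  open ℤ.≤-Reasoning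
  regroup : ∀ y d q → y *ᶻ d +ᶻ (+ 1 +ᶻ q) *ᶻ d ≡ (+ 1 +ᶻ (y +ᶻ q)) *ᶻ d
  regroup = ℤ-Solver.solve-∀

%ℕ≡0⇒∣ : ∀ x d .{{_ : NonZero d}} → x %ℕ d ≡ 0 → d ∣ ∣ x ∣
%ℕ≡0⇒∣ x d eq = Signed.∣⇒∣ᵤ (Signed.divides (x /ℕ d) (trans (a≡a%ℕn+[a/ℕn]*n x d)
  (trans (cong (λ m → + m +ᶻ (x /ℕ d) *ᶻ + d) eq) (ℤ.+-identityˡ _))))

odd : ∀ {x} → Coprime ∣ x ∣ 2 → ∃[ a ] x ≡ a *ᶻ + 2 +ᶻ + 1
odd {x} c with x %ℕ 2 in eq | a≡a%ℕn+[a/ℕn]*n x 2 | n%ℕd<d x 2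
... | 0 | _  | _ = contradiction (c (%ℕ≡0⇒∣ x 2 eq , ∣-refl)) λ ()
... | 1 | x≡ | _ = x /ℕ 2 , trans x≡ (ℤ.+-comm (+ 1) ((x /ℕ 2) *ᶻ + 2))
... | suc (suc _) | _ | s≤s (s≤s ())

nonMultipleOf3 : ∀ {x} → Coprime ∣ x ∣ 3 → ∃₂ λ a ρ → x ≡ a *ᶻ + 3 +ᶻ + ρ × (ρ ≡ 1 ⊎ ρ ≡ 2)
nonMultipleOf3 {x} c with x %ℕ 3 in eq | a≡a%ℕn+[a/ℕn]*n x 3 | n%ℕd<d x 3
... | 0 | _  | _ = contradiction (c (%ℕ≡0⇒∣ x 3 eq , ∣-refl)) λ ()
... | 1 | x≡ | _ = x /ℕ 3 , 1 , trans x≡ (ℤ.+-comm (+ 1) ((x /ℕ 3) *ᶻ + 3)) , inj₁ refl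
... | 2 | x≡ | _ = x /ℕ 3 , 2 , trans x≡ (ℤ.+-comm (+ 2) ((x /ℕ 3) *ᶻ + 3)) , inj₂ refl
... | suc (suc (suc _)) | _ | s≤s (s≤s (s≤s ()))

module _ {k n : ℕ} (ls : Levels k n) where
  open LevelBounds ls

  ends : ∀ j → level j ≡ [] ⊎ ∃₂ λ l r → l ∈ level j × r ∈ level j × r ≡ l +ᶻ + w j
  ends j with extent (level j)
  ... | none eq          = inj₁ eq
  ... | span l w l∈ r∈ _ = inj₂ (l , l +ᶻ + w , l∈ , r∈ , refl)

  det≤ : ∀ {i j x y} → x ∈ level i → y ∈ level j → x *ᶻ + j -ᶻ y *ᶻ + i ≤ᶻ + k
  det≤ x∈ y∈ = ≤+∣∣ (detBound x∈ y∈)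

  j*w≤k : ∀ j → j ≤ n → j * w j ≤ k
  j*w≤k j j≤n = *-cancelˡ-≤ 2 (≤-trans (≤-reflexive (double (j * w j))) (pair j j j≤n j≤n))
    where
    double : ∀ x → 2 * x ≡ x + x
    double = solve-∀

-- The leading 1, here and for heights two and three, makes room for the one possible point of
-- height 0, which the levels leave out.
height-one : ∀ {k} (ls : Levels k 1) → 1 + LevelBounds.c ls 1 ≤ closedForm k
height-one {k} ls = begin
  1 + c 1           ≤⟨ s≤s (c≤1+w 1) ⟩
  2 + w 1           ≡⟨ cong (λ z → 2 + z) (sym (*-identityˡ (w 1))) ⟩
  2 + 1 * w 1       ≤⟨ +-monoʳ-≤ 2 (j*w≤k ls 1 ≤-refl) ⟩
  2 + k             ≡⟨ +-comm 2 k ⟩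
  k + 2             ≤⟨ k+2≤closedForm k ⟩
  closedForm k      ∎
  where
  open ≤-Reasoning
  open LevelBounds ls

k≡6q+r : ∀ k → + k ≡ + (k / 6) *ᶻ + 6 +ᶻ + (k % 6)
k≡6q+r k = trans (cong +_ (trans (m≡m%n+[m/n]*n k 6) (+-comm (k % 6) _)))
  (cong (_+ᶻ + (k % 6)) (ℤ.pos-* (k / 6) 6))

from-residues : ∀ {k N} b → + N ≤ᶻ + (k / 6) *ᶻ + 6 +ᶻ b → b ≤ᶻ + (k % 6 + bonus (k % 6)) → N ≤ closedForm k
from-residues {k} {N} b N≤ b≤ = drop‿+≤+ (begin
  + N                                                      ≤⟨ N≤ ⟩
  + (k / 6) *ᶻ + 6 +ᶻ b                                    ≤⟨ ℤ.+-monoʳ-≤ (+ (k / 6) *ᶻ + 6) b≤ ⟩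
  + (k / 6) *ᶻ + 6 +ᶻ (+ (k % 6) +ᶻ + bonus (k % 6))       ≡⟨ sym (ℤ.+-assoc (+ (k / 6) *ᶻ + 6) (+ (k % 6)) _) ⟩
  + (k / 6) *ᶻ + 6 +ᶻ + (k % 6) +ᶻ + bonus (k % 6)         ≡⟨ cong (_+ᶻ + bonus (k % 6)) (sym (k≡6q+r k)) ⟩
  + (k + bonus (k % 6))                                    ≡⟨ cong +_ (sym (closedForm-bonus k)) ⟩
  + closedForm k                                           ∎)
  where open ℤ.≤-Reasoning

move : ∀ {x y z k′} → x -ᶻ y ≤ᶻ k′ → z ≡ y +ᶻ k′ → x ≤ᶻ z
move {x} {y} {z} {k′} x-y≤k′ refl = subst (_≤ᶻ y +ᶻ k′) (cancel x y) (ℤ.+-monoʳ-≤ y x-y≤k′)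
  where
  cancel : ∀ x y → y +ᶻ (x -ᶻ y) ≡ x
  cancel = ℤ-Solver.solve-∀

-- Write k = 6q + s. Because d divides 6, the part 6q divides exactly by d and only s + y gets
-- rounded. Afterwards only the six values of s have to be examined.
slack-bound : ∀ {k} d .{{_ : NonZero d}} e → + e *ᶻ + d ≡ + 6 → ∀ x y {z} → z ≤ᶻ + k → z ≡ x *ᶻ + d -ᶻ y →
              x ≤ᶻ + (k / 6) *ᶻ + e +ᶻ (+ (k % 6) +ᶻ y) /ℕ d
slack-bound {k} d e ed≡6 x y z≤k refl = floor-bound d x (+ (k / 6) *ᶻ + e) (+ (k % 6) +ᶻ y) (move {y = y} z≤k (begin
  + (k / 6) *ᶻ + e *ᶻ + d +ᶻ (+ (k % 6) +ᶻ y)      ≡⟨ regroup (+ (k / 6)) (+ e) (+ d) (+ (k % 6)) y ⟩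
  y +ᶻ (+ (k / 6) *ᶻ (+ e *ᶻ + d) +ᶻ + (k % 6))    ≡⟨ cong (λ m → y +ᶻ (+ (k / 6) *ᶻ m +ᶻ + (k % 6))) ed≡6 ⟩
  y +ᶻ (+ (k / 6) *ᶻ + 6 +ᶻ + (k % 6))             ≡⟨ cong (λ m → y +ᶻ m) (sym (k≡6q+r k)) ⟩
  y +ᶻ + k                                         ∎))
  where
  open ≡-Reasoning
  regroup : ∀ q e d s y → q *ᶻ e *ᶻ d +ᶻ (s +ᶻ y) ≡ y +ᶻ (q *ᶻ (e *ᶻ d) +ᶻ s)
  regroup = ℤ-Solver.solve-∀

heightTwoBound : ℕ → ℤ
heightTwoBound r = + 3 +ᶻ (+ r +ᶻ + 1) /ℕ 2 +ᶻ (+ r -ᶻ + 1) /ℕ 2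

heightTwoBound≤ : ∀ {r} → r < 6 → heightTwoBound r ≤ᶻ + (r + bonus r)
heightTwoBound≤ = toWitness {a? = allUpTo? (λ r → heightTwoBound r ℤ.≤? + (r + bonus r)) 6} tt

module _ {k n : ℕ} (ls : Levels k n) where
  open LevelBounds ls

  odd-level-count : ∀ {a b l r} → l ≡ a *ᶻ + 2 +ᶻ + 1 → r ≡ b *ᶻ + 2 +ᶻ + 1 → r ≡ l +ᶻ + w 2 →
                    + c 2 ≤ᶻ + 1 +ᶻ (b -ᶻ a)
  odd-level-count {a} {b} refl refl r≡ = begin
    + c 2                          ≤⟨ +≤+ (c≤ 2) ⟩
    + (suc (w 2 / 2) * 1)          ≡⟨ cong +_ (*-identityʳ (suc (w 2 / 2))) ⟩
    + 1 +ᶻ + (w 2 / 2)             ≤⟨ ℤ.+-monoʳ-≤ (+ 1) (floor-bound 2 (+ (w 2 / 2)) (b -ᶻ a) (+ 0) (begin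
      + (w 2 / 2) *ᶻ + 2             ≡⟨ sym (ℤ.pos-* (w 2 / 2) 2) ⟩
      + (w 2 / 2 * 2)                ≤⟨ +≤+ (m/n*n≤m (w 2) 2) ⟩
      + w 2                          ≡⟨ solve-w a b (+ w 2) r≡ ⟩
      (b -ᶻ a) *ᶻ + 2 +ᶻ + 0         ∎)) ⟩
    + 1 +ᶻ (b -ᶻ a +ᶻ + 0)         ≡⟨ cong (λ z → + 1 +ᶻ z) (ℤ.+-identityʳ (b -ᶻ a)) ⟩
    + 1 +ᶻ (b -ᶻ a)                ∎
    where
    open ℤ.≤-Reasoning
    difference : ∀ a b → (b *ᶻ + 2 +ᶻ + 1) -ᶻ (a *ᶻ + 2 +ᶻ + 1) ≡ (b -ᶻ a) *ᶻ + 2 +ᶻ + 0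
    difference = ℤ-Solver.solve-∀
    cancel : ∀ x y → x ≡ y +ᶻ x -ᶻ y
    cancel = ℤ-Solver.solve-∀
    solve-w : ∀ a b v → b *ᶻ + 2 +ᶻ + 1 ≡ a *ᶻ + 2 +ᶻ + 1 +ᶻ v → v ≡ (b -ᶻ a) *ᶻ + 2 +ᶻ + 0
    solve-w a b v eq = trans (cancel v (a *ᶻ + 2 +ᶻ + 1))
      (trans (cong (_-ᶻ (a *ᶻ + 2 +ᶻ + 1)) (sym eq)) (difference a b))

  first-level-count : ∀ {l r} → r ≡ l +ᶻ + w 1 → + c 1 ≤ᶻ + 1 +ᶻ (r -ᶻ l)
  first-level-count {l} refl = begin
    + c 1                      ≤⟨ +≤+ (c≤1+w 1) ⟩
    + 1 +ᶻ + w 1               ≡⟨ cancel l (+ w 1) ⟩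
    + 1 +ᶻ (l +ᶻ + w 1 -ᶻ l)   ∎
    where
    open ℤ.≤-Reasoning
    cancel : ∀ l v → + 1 +ᶻ v ≡ + 1 +ᶻ (l +ᶻ v -ᶻ l)
    cancel = ℤ-Solver.solve-∀

  width₃ : ∀ {α β ρ σ} → β *ᶻ + 3 +ᶻ + σ ≡ α *ᶻ + 3 +ᶻ + ρ +ᶻ + w 3 → + w 3 ≡ (β -ᶻ α) *ᶻ + 3 +ᶻ (+ σ -ᶻ + ρ)
  width₃ {α} {β} {ρ} {σ} eq = trans (cancel (+ w 3) (α *ᶻ + 3 +ᶻ + ρ))
    (trans (cong (_-ᶻ (α *ᶻ + 3 +ᶻ + ρ)) (sym eq)) (difference α β (+ ρ) (+ σ)))
    where
    difference : ∀ a b p q → (b *ᶻ + 3 +ᶻ q) -ᶻ (a *ᶻ + 3 +ᶻ p) ≡ (b -ᶻ a) *ᶻ + 3 +ᶻ (q -ᶻ p)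
    difference = ℤ-Solver.solve-∀
    cancel : ∀ x y → x ≡ y +ᶻ x -ᶻ y
    cancel = ℤ-Solver.solve-∀

  third-level-count-mixed : ∀ {α β ρ σ l r} → l ≡ α *ᶻ + 3 +ᶻ + ρ → r ≡ β *ᶻ + 3 +ᶻ + σ → r ≡ l +ᶻ + w 3 →
                            + c 3 ≤ᶻ (+ 1 +ᶻ (β -ᶻ α +ᶻ (+ σ -ᶻ + ρ) /ℕ 3)) *ᶻ + 2
  third-level-count-mixed {α} {β} {ρ} {σ} refl refl r≡ = begin
    + c 3                                   ≤⟨ +≤+ (c≤ 3) ⟩
    + (suc (w 3 / 3) * 2)                   ≡⟨ ℤ.pos-* (suc (w 3 / 3)) 2 ⟩
    (+ 1 +ᶻ + (w 3 / 3)) *ᶻ + 2             ≤⟨ ℤ.*-monoʳ-≤-nonNeg (+ 2) (ℤ.+-monoʳ-≤ (+ 1)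
      (floor-bound 3 (+ (w 3 / 3)) (β -ᶻ α) (+ σ -ᶻ + ρ) (begin
        + (w 3 / 3) *ᶻ + 3                    ≡⟨ sym (ℤ.pos-* (w 3 / 3) 3) ⟩
        + (w 3 / 3 * 3)                       ≤⟨ +≤+ (m/n*n≤m (w 3) 3) ⟩
        + w 3                                 ≡⟨ width₃ {α} {β} {ρ} {σ} r≡ ⟩
        (β -ᶻ α) *ᶻ + 3 +ᶻ (+ σ -ᶻ + ρ)       ∎))) ⟩
    (+ 1 +ᶻ (β -ᶻ α +ᶻ (+ σ -ᶻ + ρ) /ℕ 3)) *ᶻ + 2  ∎
    where open ℤ.≤-Reasoning

  third-level-count-equal : ∀ {α β ρ l r} → l ≡ α *ᶻ + 3 +ᶻ + ρ → r ≡ β *ᶻ + 3 +ᶻ + ρ → r ≡ l +ᶻ + w 3 →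
                            + c 3 ≤ᶻ (β -ᶻ α) *ᶻ + 2 +ᶻ + 1
  third-level-count-equal {α} {β} {ρ} refl refl r≡ = begin
    + c 3                          ≤⟨ +≤+ (c₃≤ (w 3 / 3) (sym (m/n*n≡m 3∣w))) ⟩
    + (w 3 / 3 * 2 + 1)            ≡⟨ cong (_+ᶻ + 1) (ℤ.pos-* (w 3 / 3) 2) ⟩
    + (w 3 / 3) *ᶻ + 2 +ᶻ + 1      ≡⟨ cong (λ m → m *ᶻ + 2 +ᶻ + 1) (ℤ.*-cancelʳ-≡ (+ (w 3 / 3)) (β -ᶻ α) (+ 3)
      (trans (sym (ℤ.pos-* (w 3 / 3) 3)) (trans (cong +_ (m/n*n≡m 3∣w)) +w≡))) ⟩
    (β -ᶻ α) *ᶻ + 2 +ᶻ + 1         ∎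
    where
    open ℤ.≤-Reasoning
    cancel : ∀ x p → x +ᶻ (p -ᶻ p) ≡ x
    cancel = ℤ-Solver.solve-∀
    +w≡ : + w 3 ≡ (β -ᶻ α) *ᶻ + 3
    +w≡ = trans (width₃ {α} {β} {ρ} {ρ} r≡) (cancel ((β -ᶻ α) *ᶻ + 3) (+ ρ))
    3∣w : 3 ∣ w 3
    3∣w = Signed.∣⇒∣ᵤ (Signed.divides {+ 3} {+ w 3} (β -ᶻ α) +w≡)

  -- The right side is the exact number of non-multiples of 3 from l to r. Counting by started
  -- periods is sharp when ρ and σ differ but one too large when they agree, hence the separate
  -- treatment of equal residues.
  third-level-count : ∀ {α β ρ σ l r} → ρ ≡ 1 ⊎ ρ ≡ 2 → σ ≡ 1 ⊎ σ ≡ 2 →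
                      l ≡ α *ᶻ + 3 +ᶻ + ρ → r ≡ β *ᶻ + 3 +ᶻ + σ → r ≡ l +ᶻ + w 3 →
                      + c 3 ≤ᶻ (β -ᶻ α) *ᶻ + 2 +ᶻ (+ 1 +ᶻ + σ -ᶻ + ρ)
  third-level-count {α} {β} (inj₁ refl) (inj₁ refl) l≡ r≡ eq = third-level-count-equal {α} {β} l≡ r≡ eq
  third-level-count {α} {β} (inj₂ refl) (inj₂ refl) l≡ r≡ eq = third-level-count-equal {α} {β} l≡ r≡ eq
  third-level-count {α} {β} (inj₁ refl) (inj₂ refl) l≡ r≡ eq =
    ℤ.≤-trans (third-level-count-mixed {α} {β} l≡ r≡ eq) (ℤ.≤-reflexive (regroup (β -ᶻ α)))
    where
    regroup : ∀ x → (+ 1 +ᶻ (x +ᶻ + 0)) *ᶻ + 2 ≡ x *ᶻ + 2 +ᶻ + 2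
    regroup = ℤ-Solver.solve-∀
  third-level-count {α} {β} (inj₂ refl) (inj₁ refl) l≡ r≡ eq =
    ℤ.≤-trans (third-level-count-mixed {α} {β} l≡ r≡ eq) (ℤ.≤-reflexive (regroup (β -ᶻ α)))
    where
    regroup : ∀ x → (+ 1 +ᶻ (x +ᶻ -[1+ 0 ])) *ᶻ + 2 ≡ x *ᶻ + 2 +ᶻ + 0
    regroup = ℤ-Solver.solve-∀

-- The two widths are regrouped into the cross differences r₁ - a and b - l₁. Each comes from a
-- single determinant between levels 1 and 2, so it can be rounded down separately; adding the
-- determinants first would lose the exact constant.
height-two : ∀ {k} (ls : Levels k 2) → let open LevelBounds ls in 1 + (c 1 + c 2) ≤ closedForm k
height-two {k} ls with ends ls 1 | ends ls 2
... | _ | inj₁ empty = contradiction empty (Levels.top ls)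
... | inj₁ empty | inj₂ _ = begin
  1 + (c 1 + c 2)   ≡⟨ cong (λ z → 1 + (z + c 2)) (c-empty 1 empty) ⟩
  1 + c 2           ≤⟨ s≤s (c≤1+w 2) ⟩
  2 + w 2           ≤⟨ +-monoʳ-≤ 2 (≤-trans (m≤n*m (w 2) 2) (j*w≤k ls 2 ≤-refl)) ⟩
  2 + k             ≡⟨ +-comm 2 k ⟩
  k + 2             ≤⟨ k+2≤closedForm k ⟩
  closedForm k      ∎
  where
  open ≤-Reasoning
  open LevelBounds ls
... | inj₂ (l₁ , r₁ , l₁∈ , r₁∈ , r₁≡) | inj₂ (l₂ , r₂ , l₂∈ , r₂∈ , r₂≡)
  with a , l₂≡ ← odd (Levels.coprime ls l₂∈) | b , r₂≡′ ← odd (Levels.coprime ls r₂∈) =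
  from-residues {k} (heightTwoBound s) (begin
    + 1 +ᶻ (+ c 1 +ᶻ + c 2)
      ≤⟨ ℤ.+-monoʳ-≤ (+ 1) (ℤ.+-mono-≤ (first-level-count ls {l₁} {r₁} r₁≡) (odd-level-count ls {a} {b} {l₂} {r₂} l₂≡ r₂≡′ r₂≡)) ⟩
    + 1 +ᶻ ((+ 1 +ᶻ (r₁ -ᶻ l₁)) +ᶻ (+ 1 +ᶻ (b -ᶻ a)))
      ≡⟨ regroup r₁ l₁ a b ⟩
    + 3 +ᶻ ((r₁ -ᶻ a) +ᶻ (b -ᶻ l₁))
      ≤⟨ ℤ.+-monoʳ-≤ (+ 3) (ℤ.+-mono-≤ right left) ⟩
    + 3 +ᶻ ((+ q *ᶻ + 3 +ᶻ (+ s +ᶻ + 1) /ℕ 2) +ᶻ (+ q *ᶻ + 3 +ᶻ (+ s -ᶻ + 1) /ℕ 2))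
      ≡⟨ regroup′ (+ q) ((+ s +ᶻ + 1) /ℕ 2) ((+ s -ᶻ + 1) /ℕ 2) ⟩
    + q *ᶻ + 6 +ᶻ heightTwoBound s ∎) (heightTwoBound≤ (m%n<n k 6))
  where
  open ℤ.≤-Reasoning
  open LevelBounds ls
  q s : ℕ
  q = k / 6
  s = k % 6
  regroup : ∀ r l a b → + 1 +ᶻ ((+ 1 +ᶻ (r -ᶻ l)) +ᶻ (+ 1 +ᶻ (b -ᶻ a))) ≡ + 3 +ᶻ ((r -ᶻ a) +ᶻ (b -ᶻ l))
  regroup = ℤ-Solver.solve-∀
  regroup′ : ∀ q x y → + 3 +ᶻ ((q *ᶻ + 3 +ᶻ x) +ᶻ (q *ᶻ + 3 +ᶻ y)) ≡ q *ᶻ + 6 +ᶻ (+ 3 +ᶻ x +ᶻ y)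
  regroup′ = ℤ-Solver.solve-∀
  right : r₁ -ᶻ a ≤ᶻ + q *ᶻ + 3 +ᶻ (+ s +ᶻ + 1) /ℕ 2
  right = slack-bound {k} 2 3 refl (r₁ -ᶻ a) (+ 1) (det≤ ls {1} {2} {r₁} {l₂} r₁∈ l₂∈)
    (trans (cong (λ x → r₁ *ᶻ + 2 -ᶻ x *ᶻ + 1) l₂≡) (e₁ r₁ a))
    where
    e₁ : ∀ r a → r *ᶻ + 2 -ᶻ (a *ᶻ + 2 +ᶻ + 1) *ᶻ + 1 ≡ (r -ᶻ a) *ᶻ + 2 -ᶻ + 1
    e₁ = ℤ-Solver.solve-∀
  left : b -ᶻ l₁ ≤ᶻ + q *ᶻ + 3 +ᶻ (+ s -ᶻ + 1) /ℕ 2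
  left = slack-bound {k} 2 3 refl (b -ᶻ l₁) -[1+ 0 ] (det≤ ls {2} {1} {r₂} {l₁} r₂∈ l₁∈)
    (trans (cong (λ x → x *ᶻ + 1 -ᶻ l₁ *ᶻ + 2) r₂≡′) (e₁ l₁ b))
    where
    e₁ : ∀ l b → (b *ᶻ + 2 +ᶻ + 1) *ᶻ + 1 -ᶻ l *ᶻ + 2 ≡ (b -ᶻ l) *ᶻ + 2 -ᶻ -[1+ 0 ]
    e₁ = ℤ-Solver.solve-∀

-- The part of the count that remains once 6 (k / 6) is split off, where ρ and σ are the residues
-- modulo 3 of the ends of level 3. The four quotients come from the Farey pairs (1,3) and (2,3) in
-- both orders, whose weights 1/3, 1/3, 1/6, 1/6 add up to 1.
heightThreeBound : ℕ → ℕ → ℕ → ℤ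
heightThreeBound ρ σ r = + 3 +ᶻ (+ 1 +ᶻ + σ -ᶻ + ρ)
  +ᶻ (+ r +ᶻ + ρ) /ℕ 3 +ᶻ (+ r +ᶻ - + σ) /ℕ 3
  +ᶻ (+ r +ᶻ (+ ρ *ᶻ + 2 -ᶻ + 3)) /ℕ 6 +ᶻ (+ r +ᶻ (+ 3 -ᶻ + σ *ᶻ + 2)) /ℕ 6

heightThreeBound≤ : ∀ {ρ σ} → ρ ≡ 1 ⊎ ρ ≡ 2 → σ ≡ 1 ⊎ σ ≡ 2 → ∀ {r} → r < 6 → heightThreeBound ρ σ r ≤ᶻ + (r + bonus r)
heightThreeBound≤ (inj₁ refl) (inj₁ refl) = toWitness {a? = allUpTo? (λ r → heightThreeBound 1 1 r ℤ.≤? + (r + bonus r)) 6} tt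
heightThreeBound≤ (inj₁ refl) (inj₂ refl) = toWitness {a? = allUpTo? (λ r → heightThreeBound 1 2 r ℤ.≤? + (r + bonus r)) 6} tt
heightThreeBound≤ (inj₂ refl) (inj₁ refl) = toWitness {a? = allUpTo? (λ r → heightThreeBound 2 1 r ℤ.≤? + (r + bonus r)) 6} tt
heightThreeBound≤ (inj₂ refl) (inj₂ refl) = toWitness {a? = allUpTo? (λ r → heightThreeBound 2 2 r ℤ.≤? + (r + bonus r)) 6} tt

-- Modulo rounding, level 3 contributes twice β - α. One copy is paired with the ends of level 1,
-- the other with those of level 2, so every summand is again bounded by a single determinant. If
-- level 1 or level 2 is empty, crude counts suffice.
height-three : ∀ {k} (ls : Levels k 3) → 9 ≤ k → let open LevelBounds ls in 1 + (c 1 + c 2 + c 3) ≤ closedForm k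
height-three {k} ls 9≤k with ends ls 1 | ends ls 2 | ends ls 3
... | _ | _ | inj₁ empty = contradiction empty (Levels.top ls)
... | inj₁ empty | _ | _ = ≤-trans (*-cancelˡ-≤ 6 (begin
  6 * (1 + (c 1 + c 2 + c 3))                ≡⟨ cong (λ z → 6 * (1 + (z + c 2 + c 3))) (c-empty 1 empty) ⟩
  6 * (1 + (c 2 + c 3))                      ≤⟨ *-monoʳ-≤ 6 (s≤s (+-mono-≤ (c≤1+w 2) (c≤1+w 3))) ⟩
  6 * (1 + (suc (w 2) + suc (w 3)))          ≡⟨ regroup (w 2) (w 3) ⟩
  18 + (3 * (2 * w 2) + 2 * (3 * w 3))       ≤⟨ +-monoʳ-≤ 18 (+-mono-≤ (*-monoʳ-≤ 3 (j*w≤k ls 2 (s≤s (s≤s z≤n)))) (*-monoʳ-≤ 2 (j*w≤k ls 3 ≤-refl))) ⟩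
  18 + (3 * k + 2 * k)                       ≡⟨ regroup′ k ⟩
  6 + (5 * k + 12)                           ≤⟨ +-monoˡ-≤ (5 * k + 12) (≤-trans (m≤m+n 6 3) 9≤k) ⟩
  k + (5 * k + 12)                           ≡⟨ regroup″ k ⟩
  6 * (k + 2)                                ∎)) (k+2≤closedForm k)
  where
  open ≤-Reasoning
  open LevelBounds ls
  regroup : ∀ x y → 6 * (1 + (suc x + suc y)) ≡ 18 + (3 * (2 * x) + 2 * (3 * y))
  regroup = solve-∀
  regroup′ : ∀ k → 18 + (3 * k + 2 * k) ≡ 6 + (5 * k + 12)
  regroup′ = solve-∀
  regroup″ : ∀ k → k + (5 * k + 12) ≡ 6 * (k + 2)
  regroup″ = solve-∀
-- Without level 2 there remain at most 7k/9 + 4 points, which is at most k + 2 precisely from k = 9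
-- on. This is the source of the hypothesis `9 ≤ k`.
... | inj₂ _ | inj₁ empty | _ = ≤-trans (*-cancelˡ-≤ 9 (begin
  9 * (1 + (c 1 + c 2 + c 3))                ≡⟨ cong (λ z → 9 * (1 + (c 1 + z + c 3))) (c-empty 2 empty) ⟩
  9 * (1 + (c 1 + 0 + c 3))                  ≡⟨ regroup (c 1) (c 3) ⟩
  9 + 9 * c 1 + 3 * (3 * c 3)                ≤⟨ +-mono-≤ (+-monoʳ-≤ 9 (*-monoʳ-≤ 9 (c≤1+w 1))) (*-monoʳ-≤ 3 (c≤-φ 3)) ⟩
  9 + 9 * suc (w 1) + 3 * (2 * (w 3 + 3))    ≡⟨ regroup′ (w 1) (w 3) ⟩
  36 + (3 * (1 * w 3 + 3 * w 1) + 3 * w 3)   ≤⟨ +-monoʳ-≤ 36 (+-mono-≤ (*-monoʳ-≤ 3 (pair 1 3 (s≤s z≤n) ≤-refl)) (j*w≤k ls 3 ≤-refl)) ⟩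
  36 + (3 * (2 * k) + k)                     ≡⟨ regroup″ k ⟩
  2 * 9 + (7 * k + 18)                       ≤⟨ +-monoˡ-≤ (7 * k + 18) (*-monoʳ-≤ 2 9≤k) ⟩
  2 * k + (7 * k + 18)                       ≡⟨ regroup‴ k ⟩
  9 * (k + 2)                                ∎)) (k+2≤closedForm k)
  where
  open ≤-Reasoning
  open LevelBounds ls
  regroup : ∀ x y → 9 * (1 + (x + 0 + y)) ≡ 9 + 9 * x + 3 * (3 * y)
  regroup = solve-∀
  regroup′ : ∀ x y → 9 + 9 * suc x + 3 * (2 * (y + 3)) ≡ 36 + (3 * (1 * y + 3 * x) + 3 * y)
  regroup′ = solve-∀
  regroup″ : ∀ k → 36 + (3 * (2 * k) + k) ≡ 2 * 9 + (7 * k + 18)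
  regroup″ = solve-∀
  regroup‴ : ∀ k → 2 * k + (7 * k + 18) ≡ 9 * (k + 2)
  regroup‴ = solve-∀
... | inj₂ (l₁ , r₁ , l₁∈ , r₁∈ , r₁≡) | inj₂ (l₂ , r₂ , l₂∈ , r₂∈ , r₂≡) | inj₂ (l₃ , r₃ , l₃∈ , r₃∈ , r₃≡)
  with a , l₂≡ ← odd (Levels.coprime ls l₂∈) | b , r₂≡′ ← odd (Levels.coprime ls r₂∈)
     | α , ρ , l₃≡ , ρ∈ ← nonMultipleOf3 (Levels.coprime ls l₃∈)
     | β , σ , r₃≡′ , σ∈ ← nonMultipleOf3 (Levels.coprime ls r₃∈) =
  from-residues {k} (heightThreeBound ρ σ s) (begin
    + 1 +ᶻ (+ c 1 +ᶻ + c 2 +ᶻ + c 3)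
      ≤⟨ ℤ.+-monoʳ-≤ (+ 1) (ℤ.+-mono-≤ (ℤ.+-mono-≤ (first-level-count ls {l₁} {r₁} r₁≡)
           (odd-level-count ls {a} {b} {l₂} {r₂} l₂≡ r₂≡′ r₂≡))
           (third-level-count ls {α} {β} {ρ} {σ} {l₃} {r₃} ρ∈ σ∈ l₃≡ r₃≡′ r₃≡)) ⟩
    + 1 +ᶻ ((+ 1 +ᶻ (r₁ -ᶻ l₁)) +ᶻ (+ 1 +ᶻ (b -ᶻ a)) +ᶻ ((β -ᶻ α) *ᶻ + 2 +ᶻ τ))
      ≡⟨ regroup r₁ l₁ a b α β τ ⟩
    + 3 +ᶻ τ +ᶻ ((r₁ -ᶻ α) +ᶻ (β -ᶻ l₁) +ᶻ (b -ᶻ α) +ᶻ (β -ᶻ a))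
      ≤⟨ ℤ.+-monoʳ-≤ (+ 3 +ᶻ τ) (ℤ.+-mono-≤ (ℤ.+-mono-≤ (ℤ.+-mono-≤ bound₁ bound₂) bound₃) bound₄) ⟩
    + 3 +ᶻ τ +ᶻ ((+ q *ᶻ + 2 +ᶻ f₁) +ᶻ (+ q *ᶻ + 2 +ᶻ f₂) +ᶻ (+ q *ᶻ + 1 +ᶻ f₃) +ᶻ (+ q *ᶻ + 1 +ᶻ f₄))
      ≡⟨ regroup′ (+ q) (+ 3 +ᶻ τ) f₁ f₂ f₃ f₄ ⟩
    + q *ᶻ + 6 +ᶻ heightThreeBound ρ σ s ∎) (heightThreeBound≤ ρ∈ σ∈ (m%n<n k 6))
  where
  open ℤ.≤-Reasoning
  open LevelBounds ls
  q s : ℕ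
  q = k / 6
  s = k % 6
  τ f₁ f₂ f₃ f₄ : ℤ
  τ = + 1 +ᶻ + σ -ᶻ + ρ
  f₁ = (+ s +ᶻ + ρ) /ℕ 3
  f₂ = (+ s +ᶻ - + σ) /ℕ 3
  f₃ = (+ s +ᶻ (+ ρ *ᶻ + 2 -ᶻ + 3)) /ℕ 6
  f₄ = (+ s +ᶻ (+ 3 -ᶻ + σ *ᶻ + 2)) /ℕ 6
  regroup : ∀ r l a b α β τ → + 1 +ᶻ ((+ 1 +ᶻ (r -ᶻ l)) +ᶻ (+ 1 +ᶻ (b -ᶻ a)) +ᶻ ((β -ᶻ α) *ᶻ + 2 +ᶻ τ))
            ≡ + 3 +ᶻ τ +ᶻ ((r -ᶻ α) +ᶻ (β -ᶻ l) +ᶻ (b -ᶻ α) +ᶻ (β -ᶻ a))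
  regroup = ℤ-Solver.solve-∀
  regroup′ : ∀ q c x y z v → c +ᶻ ((q *ᶻ + 2 +ᶻ x) +ᶻ (q *ᶻ + 2 +ᶻ y) +ᶻ (q *ᶻ + 1 +ᶻ z) +ᶻ (q *ᶻ + 1 +ᶻ v))
             ≡ q *ᶻ + 6 +ᶻ (c +ᶻ x +ᶻ y +ᶻ z +ᶻ v)
  regroup′ = ℤ-Solver.solve-∀
  bound₁ : r₁ -ᶻ α ≤ᶻ + q *ᶻ + 2 +ᶻ f₁
  bound₁ = slack-bound {k} 3 2 refl (r₁ -ᶻ α) (+ ρ) (det≤ ls {1} {3} {r₁} {l₃} r₁∈ l₃∈)
    (trans (cong (λ x → r₁ *ᶻ + 3 -ᶻ x *ᶻ + 1) l₃≡) (e₁ r₁ α (+ ρ)))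
    where
    e₁ : ∀ r a p → r *ᶻ + 3 -ᶻ (a *ᶻ + 3 +ᶻ p) *ᶻ + 1 ≡ (r -ᶻ a) *ᶻ + 3 -ᶻ p
    e₁ = ℤ-Solver.solve-∀
  bound₂ : β -ᶻ l₁ ≤ᶻ + q *ᶻ + 2 +ᶻ f₂
  bound₂ = slack-bound {k} 3 2 refl (β -ᶻ l₁) (- + σ) (det≤ ls {3} {1} {r₃} {l₁} r₃∈ l₁∈)
    (trans (cong (λ x → x *ᶻ + 1 -ᶻ l₁ *ᶻ + 3) r₃≡′) (e₁ l₁ β (+ σ)))
    where
    e₁ : ∀ l b p → (b *ᶻ + 3 +ᶻ p) *ᶻ + 1 -ᶻ l *ᶻ + 3 ≡ (b -ᶻ l) *ᶻ + 3 -ᶻ (- p)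
    e₁ = ℤ-Solver.solve-∀
  bound₃ : b -ᶻ α ≤ᶻ + q *ᶻ + 1 +ᶻ f₃
  bound₃ = slack-bound {k} 6 1 refl (b -ᶻ α) (+ ρ *ᶻ + 2 -ᶻ + 3) (det≤ ls {2} {3} {r₂} {l₃} r₂∈ l₃∈)
    (trans (cong₂ (λ x y → x *ᶻ + 3 -ᶻ y *ᶻ + 2) r₂≡′ l₃≡) (e₁ b α (+ ρ)))
    where
    e₁ : ∀ b a p → (b *ᶻ + 2 +ᶻ + 1) *ᶻ + 3 -ᶻ (a *ᶻ + 3 +ᶻ p) *ᶻ + 2 ≡ (b -ᶻ a) *ᶻ + 6 -ᶻ (p *ᶻ + 2 -ᶻ + 3)
    e₁ = ℤ-Solver.solve-∀
  bound₄ : β -ᶻ a ≤ᶻ + q *ᶻ + 1 +ᶻ f₄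
  bound₄ = slack-bound {k} 6 1 refl (β -ᶻ a) (+ 3 -ᶻ + σ *ᶻ + 2) (det≤ ls {3} {2} {r₃} {l₂} r₃∈ l₂∈)
    (trans (cong₂ (λ x y → x *ᶻ + 2 -ᶻ y *ᶻ + 3) r₃≡′ l₂≡) (e₁ β a (+ σ)))
    where
    e₁ : ∀ b a p → (b *ᶻ + 3 +ᶻ p) *ᶻ + 2 -ᶻ (a *ᶻ + 2 +ᶻ + 1) *ᶻ + 3 ≡ (b -ᶻ a) *ᶻ + 6 -ᶻ (+ 3 -ᶻ p *ᶻ + 2)
    e₁ = ℤ-Solver.solve-∀

-- Reduction of the height

record NiceList (k : ℕ) (xs : List ℤ²) : Set where
  field
    unique      : Unique xs
    coprime     : ∀ {x y} → (x , y) ∈ xs → Coprime ∣ x ∣ ∣ y ∣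
    noAntipodes : ∀ {x y} → (x , y) ∈ xs → (- x , - y) ∈ xs → ⊥
    detBound    : ∀ {x y x′ y′} → (x , y) ∈ xs → (x′ , y′) ∈ xs → ∣ x *ᶻ y′ -ᶻ x′ *ᶻ y ∣ ≤ k

unique-map : ∀ {a b} {A : Set a} {B : Set b} (f : A → B) {xs} →
             (∀ {p q} → p ∈ xs → q ∈ xs → f p ≡ f q → p ≡ q) → Unique xs → Unique (map f xs)
unique-map f inj []         = []
unique-map f inj (p∉ ∷ u) =
  All.map⁺ (All.tabulate λ q∈ eq → All.lookup p∉ q∈ (inj (here refl) (there q∈) eq))
  ∷ unique-map f (λ p∈ q∈ → inj (there p∈) (there q∈)) u

unsign : ∀ a → ∃[ σ ] ∣ σ ∣ ≡ 1 × a *ᶻ σ ≡ + ∣ a ∣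
unsign (+ n)      = + 1 , refl , ℤ.*-identityʳ (+ n)
unsign -[1+ n ]   = -[1+ 0 ] , refl , trans (ℤ.*-comm -[1+ n ] -[1+ 0 ]) (ℤ.-1*i≡-i -[1+ n ])

-- Bézout coefficients of the absolute values, with the signs put back, complete a primitive vector
-- to a basis of determinant 1.
unimodular : ∀ a b → Coprime ∣ a ∣ ∣ b ∣ → ∃₂ λ c d → a *ᶻ d -ᶻ b *ᶻ c ≡ + 1
unimodular a b cop with α , _ , aα ← unsign a | β , _ , bβ ← unsign b with coprime-Bézout cop
... | Bézout.+- x y eq = β *ᶻ + y , α *ᶻ + x , (begin
  a *ᶻ (α *ᶻ + x) -ᶻ b *ᶻ (β *ᶻ + y)        ≡⟨ regroup a α (+ x) b β (+ y) ⟩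
  a *ᶻ α *ᶻ + x -ᶻ b *ᶻ β *ᶻ + y            ≡⟨ cong₂ (λ m n → m *ᶻ + x -ᶻ n *ᶻ + y) aα bβ ⟩
  + ∣ a ∣ *ᶻ + x -ᶻ + ∣ b ∣ *ᶻ + y          ≡⟨ cong₂ _-ᶻ_ (trans (ℤ.*-comm (+ ∣ a ∣) (+ x)) (trans (sym (ℤ.pos-* x ∣ a ∣)) (cong +_ (sym eq))))
                                                 (trans (ℤ.*-comm (+ ∣ b ∣) (+ y)) (sym (ℤ.pos-* y ∣ b ∣))) ⟩
  + 1 +ᶻ + (y * ∣ b ∣) -ᶻ + (y * ∣ b ∣)     ≡⟨ cancel (+ (y * ∣ b ∣)) ⟩
  + 1                                       ∎)
  where
  open ≡-Reasoning
  regroup : ∀ a α x b β y → a *ᶻ (α *ᶻ x) -ᶻ b *ᶻ (β *ᶻ y) ≡ a *ᶻ α *ᶻ x -ᶻ b *ᶻ β *ᶻ y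
  regroup = ℤ-Solver.solve-∀
  cancel : ∀ z → + 1 +ᶻ z -ᶻ z ≡ + 1
  cancel = ℤ-Solver.solve-∀
... | Bézout.-+ x y eq = - (β *ᶻ + y) , - (α *ᶻ + x) , (begin
  a *ᶻ - (α *ᶻ + x) -ᶻ b *ᶻ - (β *ᶻ + y)    ≡⟨ regroup a α (+ x) b β (+ y) ⟩
  b *ᶻ β *ᶻ + y -ᶻ a *ᶻ α *ᶻ + x            ≡⟨ cong₂ (λ m n → n *ᶻ + y -ᶻ m *ᶻ + x) aα bβ ⟩
  + ∣ b ∣ *ᶻ + y -ᶻ + ∣ a ∣ *ᶻ + x          ≡⟨ cong₂ _-ᶻ_ (trans (ℤ.*-comm (+ ∣ b ∣) (+ y)) (trans (sym (ℤ.pos-* y ∣ b ∣)) (cong +_ (sym eq))))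
                                                 (trans (ℤ.*-comm (+ ∣ a ∣) (+ x)) (sym (ℤ.pos-* x ∣ a ∣))) ⟩
  + 1 +ᶻ + (x * ∣ a ∣) -ᶻ + (x * ∣ a ∣)     ≡⟨ cancel (+ (x * ∣ a ∣)) ⟩
  + 1                                       ∎)
  where
  open ≡-Reasoning
  regroup : ∀ a α x b β y → a *ᶻ - (α *ᶻ x) -ᶻ b *ᶻ - (β *ᶻ y) ≡ b *ᶻ β *ᶻ y -ᶻ a *ᶻ α *ᶻ x
  regroup = ℤ-Solver.solve-∀
  cancel : ∀ z → + 1 +ᶻ z -ᶻ z ≡ + 1
  cancel = ℤ-Solver.solve-∀

∣-combination : ∀ e u h a c → e ∣ ∣ u ∣ → e ∣ ∣ h ∣ → e ∣ ∣ u *ᶻ a +ᶻ h *ᶻ c ∣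
∣-combination e u h a c e∣u e∣h = Signed.∣⇒∣ᵤ (Signed.∣m∣n⇒∣m+n
  (Signed.∣m⇒∣m*n a (Signed.∣ᵤ⇒∣ {+ e} {u} e∣u)) (Signed.∣m⇒∣m*n c (Signed.∣ᵤ⇒∣ {+ e} {h} e∣h)))

module _ (a b c d : ℤ) (ad-bc≡1 : a *ᶻ d -ᶻ b *ᶻ c ≡ + 1) where

  -- coordinates with respect to the basis (a , b), (c , d)
  coordinates : ℤ² → ℤ²
  coordinates (x , y) = d *ᶻ x -ᶻ c *ᶻ y , a *ᶻ y -ᶻ b *ᶻ x

  private
    unit : ∀ {z} → (a *ᶻ d -ᶻ b *ᶻ c) *ᶻ z ≡ z
    unit {z} = trans (cong (_*ᶻ z) ad-bc≡1) (ℤ.*-identityˡ z)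

  recover : ∀ {x y u h} → (u , h) ≡ coordinates (x , y) → x ≡ u *ᶻ a +ᶻ h *ᶻ c × y ≡ u *ᶻ b +ᶻ h *ᶻ d
  recover {x} {y} refl = sym (trans (e₁ a b c d x y) unit) , sym (trans (e₂ a b c d x y) unit)
    where
    e₁ : ∀ a b c d x y → (d *ᶻ x -ᶻ c *ᶻ y) *ᶻ a +ᶻ (a *ᶻ y -ᶻ b *ᶻ x) *ᶻ c ≡ (a *ᶻ d -ᶻ b *ᶻ c) *ᶻ x
    e₁ = ℤ-Solver.solve-∀
    e₂ : ∀ a b c d x y → (d *ᶻ x -ᶻ c *ᶻ y) *ᶻ b +ᶻ (a *ᶻ y -ᶻ b *ᶻ x) *ᶻ d ≡ (a *ᶻ d -ᶻ b *ᶻ c) *ᶻ y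
    e₂ = ℤ-Solver.solve-∀

  coordinates-injective : ∀ p q → coordinates p ≡ coordinates q → p ≡ q
  coordinates-injective (x , y) (x′ , y′) eq =
    let x≡ , y≡ = recover {x} {y} refl; x′≡ , y′≡ = recover {x′} {y′} eq
    in cong₂ _,_ (trans x≡ (sym x′≡)) (trans y≡ (sym y′≡))

  coordinates-nice : ∀ {k xs} → NiceList k xs → NiceList k (map coordinates xs)
  coordinates-nice {k} {xs} nice = record
    { unique      = unique-map coordinates (λ {p} {q} _ _ → coordinates-injective p q) unique
    ; coprime     = coprime′
    ; noAntipodes = noAntipodes′
    ; detBound    = detBound′
    }
    where
    open NiceList nice
    coprime′ : ∀ {u h} → (u , h) ∈ map coordinates xs → Coprime ∣ u ∣ ∣ h ∣
    coprime′ {u} {h} p∈ {e} (e∣u , e∣h) with (x , y) , q∈ , eq ← ∈-map⁻ coordinates p∈ =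
      let x≡ , y≡ = recover {x} {y} eq in
      coprime q∈ (subst (λ z → e ∣ ∣ z ∣) (sym x≡) (∣-combination e u h a c e∣u e∣h) ,
                  subst (λ z → e ∣ ∣ z ∣) (sym y≡) (∣-combination e u h b d e∣u e∣h))
    noAntipodes′ : ∀ {u h} → (u , h) ∈ map coordinates xs → (- u , - h) ∈ map coordinates xs → ⊥
    noAntipodes′ {u} {h} p∈ p′∈
      with (x , y) , q∈ , eq ← ∈-map⁻ coordinates p∈ | (x′ , y′) , q′∈ , eq′ ← ∈-map⁻ coordinates p′∈ =
      let x≡ , y≡ = recover {x} {y} eq; x′≡ , y′≡ = recover {x′} {y′} eq′ in
      noAntipodes q∈ (subst (_∈ xs) (cong₂ _,_ (trans x′≡ (trans (negate u h a c) (cong -_ (sym x≡))))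
                                               (trans y′≡ (trans (negate u h b d) (cong -_ (sym y≡))))) q′∈)
      where
      negate : ∀ u h a c → - u *ᶻ a +ᶻ - h *ᶻ c ≡ - (u *ᶻ a +ᶻ h *ᶻ c)
      negate = ℤ-Solver.solve-∀
    detBound′ : ∀ {u h u′ h′} → (u , h) ∈ map coordinates xs → (u′ , h′) ∈ map coordinates xs → ∣ u *ᶻ h′ -ᶻ u′ *ᶻ h ∣ ≤ k
    detBound′ p∈ p′∈
      with (x , y) , q∈ , refl ← ∈-map⁻ coordinates p∈ | (x′ , y′) , q′∈ , refl ← ∈-map⁻ coordinates p′∈ =
      subst (λ z → ∣ z ∣ ≤ k) (sym (trans (e₁ a b c d x y x′ y′) unit)) (detBound q∈ q′∈)
      where
      e₁ : ∀ a b c d x y x′ y′ → (d *ᶻ x -ᶻ c *ᶻ y) *ᶻ (a *ᶻ y′ -ᶻ b *ᶻ x′) -ᶻ (d *ᶻ x′ -ᶻ c *ᶻ y′) *ᶻ (a *ᶻ y -ᶻ b *ᶻ x)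
           ≡ (a *ᶻ d -ᶻ b *ᶻ c) *ᶻ (x *ᶻ y′ -ᶻ x′ *ᶻ y)
      e₁ = ℤ-Solver.solve-∀

-- If a primitive vector (a , b) is taken as first basis vector, the new height of a point is its
-- determinant with that vector. Flattening a set thus means finding a primitive direction with
-- which all determinants are small.
rebase : ∀ {k xs} a b → Coprime ∣ a ∣ ∣ b ∣ → NiceList k xs → (P : ℕ → Set) →
         (∀ {x y} → (x , y) ∈ xs → P ∣ a *ᶻ y -ᶻ b *ᶻ x ∣) →
         ∃[ ys ] NiceList k ys × length ys ≡ length xs × (∀ {x y} → (x , y) ∈ ys → P ∣ y ∣)
rebase {k} {xs} a b cop nice P heights with c , d , eq ← unimodular a b cop =
  map f xs , coordinates-nice a b c d eq nice , length-map f xs , heights′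
  where
  f : ℤ² → ℤ²
  f = coordinates a b c d eq
  heights′ : ∀ {x y} → (x , y) ∈ map f xs → P ∣ y ∣
  heights′ p∈ with _ , q∈ , refl ← ∈-map⁻ f p∈ = heights q∈

-- Dirichlet approximation and flattening

module _ (x : ℤ) (Y B : ℕ) .{{_ : NonZero Y}} .{{_ : NonZero B}} where

  private
    rem : ℕ → ℕ
    rem i = (+ i *ᶻ x) %ℕ Y
    bucket< : ∀ i → rem i * B / Y < B
    bucket< i = m<n*o⇒m/o<n (≤-trans (*-monoˡ-< B (n%ℕd<d (+ i *ᶻ x) Y)) (≤-reflexive (*-comm Y B)))
    bucket : Fin (suc B) → Fin B
    bucket i = fromℕ< (bucket< (toℕ i))

  -- The residues modulo Y of the B + 1 multiples 0, x, ..., B x fall into B buckets. For two in the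
  -- same bucket, B times their difference is a difference of two remainders modulo Y, hence at most
  -- Y in absolute value.
  dirichlet : ∃₂ λ a b → 0 < b × b ≤ B × B * ∣ + b *ᶻ x -ᶻ a *ᶻ + Y ∣ ≤ Y
  dirichlet with i , j , i<j , fi≡fj ← pigeonhole (n<1+n B) bucket = a , b , m<n⇒0<n∸m i<j , b≤B , close
    where
    same : rem (toℕ i) * B / Y ≡ rem (toℕ j) * B / Y
    same = trans (sym (toℕ-fromℕ< (bucket< (toℕ i)))) (trans (cong toℕ fi≡fj) (toℕ-fromℕ< (bucket< (toℕ j))))
    a : ℤ
    a = (+ toℕ j *ᶻ x) /ℕ Y -ᶻ (+ toℕ i *ᶻ x) /ℕ Y
    b : ℕ
    b = toℕ j ∸ toℕ i
    b≤B : b ≤ B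
    b≤B = ≤-trans (m∸n≤m (toℕ j) (toℕ i)) (s≤s⁻¹ (toℕ<n j))
    +b≡ : + b ≡ + toℕ j -ᶻ + toℕ i
    +b≡ = trans (sym (ℤ.⊖-≥ (<⇒≤ i<j))) (sym (ℤ.m-n≡m⊖n (toℕ j) (toℕ i)))
    rem≡ : ∀ i → + rem i ≡ + i *ᶻ x -ᶻ (+ i *ᶻ x) /ℕ Y *ᶻ + Y
    rem≡ i = trans (cancel (+ rem i) ((+ i *ᶻ x) /ℕ Y *ᶻ + Y)) (cong (_-ᶻ (+ i *ᶻ x) /ℕ Y *ᶻ + Y) (sym (a≡a%ℕn+[a/ℕn]*n (+ i *ᶻ x) Y)))
      where
      cancel : ∀ r z → r ≡ r +ᶻ z -ᶻ z
      cancel = ℤ-Solver.solve-∀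
    difference : (+ b *ᶻ x -ᶻ a *ᶻ + Y) *ᶻ + B ≡ (rem (toℕ j) * B) % Y ⊖ (rem (toℕ i) * B) % Y
    difference = begin
      (+ b *ᶻ x -ᶻ a *ᶻ + Y) *ᶻ + B
        ≡⟨ cong (λ z → (z *ᶻ x -ᶻ a *ᶻ + Y) *ᶻ + B) +b≡ ⟩
      ((+ toℕ j -ᶻ + toℕ i) *ᶻ x -ᶻ a *ᶻ + Y) *ᶻ + B
        ≡⟨ regroup (+ toℕ j) (+ toℕ i) x ((+ toℕ j *ᶻ x) /ℕ Y) ((+ toℕ i *ᶻ x) /ℕ Y) (+ Y) (+ B) ⟩
      (+ toℕ j *ᶻ x -ᶻ (+ toℕ j *ᶻ x) /ℕ Y *ᶻ + Y) *ᶻ + B -ᶻ (+ toℕ i *ᶻ x -ᶻ (+ toℕ i *ᶻ x) /ℕ Y *ᶻ + Y) *ᶻ + B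
        ≡⟨ cong₂ (λ u v → u *ᶻ + B -ᶻ v *ᶻ + B) (sym (rem≡ (toℕ j))) (sym (rem≡ (toℕ i))) ⟩
      + rem (toℕ j) *ᶻ + B -ᶻ + rem (toℕ i) *ᶻ + B
        ≡⟨ cong₂ _-ᶻ_ (split (rem (toℕ j))) (split (rem (toℕ i))) ⟩
      (+ ((rem (toℕ j) * B) % Y) +ᶻ + (rem (toℕ j) * B / Y * Y)) -ᶻ (+ ((rem (toℕ i) * B) % Y) +ᶻ + (rem (toℕ i) * B / Y * Y))
        ≡⟨ cong (λ t → (+ ((rem (toℕ j) * B) % Y) +ᶻ + (t * Y)) -ᶻ (+ ((rem (toℕ i) * B) % Y) +ᶻ + (rem (toℕ i) * B / Y * Y))) (sym same) ⟩
      (+ ((rem (toℕ j) * B) % Y) +ᶻ + (rem (toℕ i) * B / Y * Y)) -ᶻ (+ ((rem (toℕ i) * B) % Y) +ᶻ + (rem (toℕ i) * B / Y * Y))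
        ≡⟨ cancel (+ ((rem (toℕ j) * B) % Y)) (+ ((rem (toℕ i) * B) % Y)) (+ (rem (toℕ i) * B / Y * Y)) ⟩
      + ((rem (toℕ j) * B) % Y) -ᶻ + ((rem (toℕ i) * B) % Y)
        ≡⟨ ℤ.m-n≡m⊖n ((rem (toℕ j) * B) % Y) ((rem (toℕ i) * B) % Y) ⟩
      (rem (toℕ j) * B) % Y ⊖ (rem (toℕ i) * B) % Y ∎
      where
      open ≡-Reasoning
      regroup : ∀ j i x p q Y B → ((j -ᶻ i) *ᶻ x -ᶻ (p -ᶻ q) *ᶻ Y) *ᶻ B ≡ (j *ᶻ x -ᶻ p *ᶻ Y) *ᶻ B -ᶻ (i *ᶻ x -ᶻ q *ᶻ Y) *ᶻ B
      regroup = ℤ-Solver.solve-∀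
      cancel : ∀ u v z → (u +ᶻ z) -ᶻ (v +ᶻ z) ≡ u -ᶻ v
      cancel = ℤ-Solver.solve-∀
      split : ∀ r → + r *ᶻ + B ≡ + ((r * B) % Y) +ᶻ + (r * B / Y * Y)
      split r = trans (sym (ℤ.pos-* r B)) (cong +_ (m≡m%n+[m/n]*n (r * B) Y))
    close : B * ∣ + b *ᶻ x -ᶻ a *ᶻ + Y ∣ ≤ Y
    close = begin
      B * ∣ + b *ᶻ x -ᶻ a *ᶻ + Y ∣                           ≡⟨ *-comm B ∣ + b *ᶻ x -ᶻ a *ᶻ + Y ∣ ⟩
      ∣ + b *ᶻ x -ᶻ a *ᶻ + Y ∣ * B                           ≡⟨ sym (ℤ.abs-* (+ b *ᶻ x -ᶻ a *ᶻ + Y) (+ B)) ⟩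
      ∣ (+ b *ᶻ x -ᶻ a *ᶻ + Y) *ᶻ + B ∣                      ≡⟨ cong ∣_∣ difference ⟩
      ∣ (rem (toℕ j) * B) % Y ⊖ (rem (toℕ i) * B) % Y ∣      ≤⟨ ℤ.∣m⊝n∣≤m⊔n ((rem (toℕ j) * B) % Y) ((rem (toℕ i) * B) % Y) ⟩
      (rem (toℕ j) * B) % Y ⊔ (rem (toℕ i) * B) % Y          ≤⟨ ⊔-lub (<⇒≤ (m%n<n (rem (toℕ j) * B) Y)) (<⇒≤ (m%n<n (rem (toℕ i) * B) Y)) ⟩
      Y                                                      ∎
      where open ≤-Reasoning

lowest-terms : ∀ a b → 0 < b → ∃₂ λ q g → ∃[ b′ ] NonZero g × a ≡ q *ᶻ + g × b ≡ b′ * g × Coprime ∣ q ∣ b′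
lowest-terms a b 0<b with Signed.∣ᵤ⇒∣ {+ gcd ∣ a ∣ b} {a} (gcd[m,n]∣m ∣ a ∣ b)
... | Signed.divides q a≡ = q , g , b / g , g≢0 , a≡ , sym (m/n*n≡m (gcd[m,n]∣n ∣ a ∣ b)) ,
  subst (λ m → Coprime m (b / g)) ∣a∣/g≡∣q∣ (coprime-/gcd ∣ a ∣ b)
  where
  g : ℕ
  g = gcd ∣ a ∣ b
  instance
    g≢0 : NonZero g
    g≢0 = ≢-nonZero (gcd[m,n]≢0 ∣ a ∣ b (inj₂ (≢-sym (<⇒≢ 0<b))))
  ∣a∣/g≡∣q∣ : ∣ a ∣ / g ≡ ∣ q ∣
  ∣a∣/g≡∣q∣ = trans (cong (_/ g) (trans (cong ∣_∣ a≡) (ℤ.abs-* q (+ g)))) (m*n/n≡m ∣ q ∣ g)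

-- A basis vector has to be primitive, so the approximation is reduced to lowest terms. Dividing by
-- the common factor increases neither the denominator nor the error.
primitive-dirichlet : ∀ x Y B .{{_ : NonZero Y}} .{{_ : NonZero B}} →
                      ∃₂ λ a b → Coprime ∣ a ∣ b × b ≤ B × B * ∣ + b *ᶻ x -ᶻ a *ᶻ + Y ∣ ≤ Y
primitive-dirichlet x Y B =
  let a , b , 0<b , b≤B , close = dirichlet x Y B
      q , g , b′ , g≢0 , a≡ , b≡ , cop = lowest-terms a b 0<b
  in q , b′ , cop , ≤-trans (m≤m*n b′ g {{g≢0}}) (subst (_≤ B) b≡ b≤B)
     , ≤-trans (*-monoʳ-≤ B (smaller a b q g b′ {{g≢0}} a≡ b≡)) close
  where
  smaller : ∀ a b q g b′ .{{_ : NonZero g}} → a ≡ q *ᶻ + g → b ≡ b′ * g →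
            ∣ + b′ *ᶻ x -ᶻ q *ᶻ + Y ∣ ≤ ∣ + b *ᶻ x -ᶻ a *ᶻ + Y ∣
  smaller _ _ q g b′ refl refl = ≤-trans (m≤n*m ∣ + b′ *ᶻ x -ᶻ q *ᶻ + Y ∣ g) (≤-reflexive (sym (trans (cong ∣_∣ factor)
    (ℤ.abs-* (+ g) (+ b′ *ᶻ x -ᶻ q *ᶻ + Y)))))
    where
    regroup : ∀ b g x q Y → b *ᶻ g *ᶻ x -ᶻ q *ᶻ g *ᶻ Y ≡ g *ᶻ (b *ᶻ x -ᶻ q *ᶻ Y)
    regroup = ℤ-Solver.solve-∀
    factor : + (b′ * g) *ᶻ x -ᶻ q *ᶻ + g *ᶻ + Y ≡ + g *ᶻ (+ b′ *ᶻ x -ᶻ q *ᶻ + Y)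
    factor = trans (cong (λ u → u *ᶻ x -ᶻ q *ᶻ + g *ᶻ + Y) (ℤ.pos-* b′ g)) (regroup (+ b′) (+ g) x q (+ Y))

module _ (E : ℕ) .{{_ : NonZero E}} {k : ℕ} (k-large : 4 * (E * (E * E)) ≤ k) where

  private
    B : ℕ
    B = 2 * E
    instance
      B≢0 : NonZero B
      B≢0 = m*n≢0 2 E

  -- A point of large height confines all others to a narrow strip around its line,
  -- and that line has a rational approximation with bounded denominator.
  module _ {xs : List ℤ²} (x₀ y₀ : ℤ) (nice : NiceList k xs) (low : ∀ {x y} → (x , y) ∈ xs → ∣ y ∣ ≤ k)
           (q₀∈ : (x₀ , y₀) ∈ xs) (tall : ¬ E * ∣ y₀ ∣ ≤ k) where

    private
      Y : ℕ
      Y = ∣ y₀ ∣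
      instance
        Y≢0 : NonZero Y
        Y≢0 = ≢-nonZero λ eq → tall (subst (λ z → E * z ≤ k) (sym eq) (≤-trans (≤-reflexive (*-zeroʳ E)) z≤n))

    -- Up to sign, Y h = b · det(q₀, q) - y (b x₀ - a Y), where h is the new height of q. With b ≤
    -- 2E, k ≤ E Y, |y| ≤ k and error at most Y / (2E), this gives E |h| ≤ 2E³ + k/2. Hence the
    -- choice B = 2E and the requirement 4E³ ≤ k.
    flatten-along : ∀ σ a b → ∣ σ ∣ ≡ 1 → y₀ *ᶻ σ ≡ + Y → Coprime ∣ a ∣ b → b ≤ B →
                    B * ∣ + b *ᶻ x₀ -ᶻ a *ᶻ + Y ∣ ≤ Y →
                    ∃[ ys ] NiceList k ys × length ys ≡ length xs × (∀ {x y} → (x , y) ∈ ys → E * ∣ y ∣ ≤ k)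
    flatten-along σ a b ∣σ∣≡1 y₀σ≡ cop b≤B close =
      rebase (a *ᶻ σ) (+ b) (subst (λ m → Coprime m b) (sym (∣*σ∣ a)) cop) nice (λ h → E * h ≤ k) bound
      where
      D : ℕ
      D = ∣ + b *ᶻ x₀ -ᶻ a *ᶻ + Y ∣
      ∣*σ∣ : ∀ z → ∣ z *ᶻ σ ∣ ≡ ∣ z ∣
      ∣*σ∣ z = trans (ℤ.abs-* z σ) (trans (cong (∣ z ∣ *_) ∣σ∣≡1) (*-identityʳ ∣ z ∣))
      module _ {x y : ℤ} (q∈ : (x , y) ∈ xs) where
        h : ℤ
        h = a *ᶻ σ *ᶻ y -ᶻ + b *ᶻ x
        identity : + Y *ᶻ h ≡ + b *ᶻ (x₀ *ᶻ y -ᶻ x *ᶻ y₀) *ᶻ σ -ᶻ y *ᶻ (+ b *ᶻ x₀ -ᶻ a *ᶻ + Y) *ᶻ σ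
        identity = trans (cong (λ z → z *ᶻ h) (sym y₀σ≡)) (trans (expand a (+ b) σ x y x₀ y₀)
          (cong (λ z → + b *ᶻ (x₀ *ᶻ y -ᶻ x *ᶻ y₀) *ᶻ σ -ᶻ y *ᶻ (+ b *ᶻ x₀ -ᶻ a *ᶻ z) *ᶻ σ) y₀σ≡))
          where
          expand : ∀ a b σ x y x₀ y₀ → y₀ *ᶻ σ *ᶻ (a *ᶻ σ *ᶻ y -ᶻ b *ᶻ x)
            ≡ b *ᶻ (x₀ *ᶻ y -ᶻ x *ᶻ y₀) *ᶻ σ -ᶻ y *ᶻ (b *ᶻ x₀ -ᶻ a *ᶻ (y₀ *ᶻ σ)) *ᶻ σ
          expand = ℤ-Solver.solve-∀
        Yh≤ : Y * ∣ h ∣ ≤ b * k + ∣ y ∣ * D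
        Yh≤ = begin
          Y * ∣ h ∣
            ≡⟨ sym (ℤ.abs-* (+ Y) h) ⟩
          ∣ + Y *ᶻ h ∣
            ≡⟨ cong ∣_∣ identity ⟩
          ∣ + b *ᶻ (x₀ *ᶻ y -ᶻ x *ᶻ y₀) *ᶻ σ -ᶻ y *ᶻ (+ b *ᶻ x₀ -ᶻ a *ᶻ + Y) *ᶻ σ ∣
            ≤⟨ ℤ.∣i-j∣≤∣i∣+∣j∣ (+ b *ᶻ (x₀ *ᶻ y -ᶻ x *ᶻ y₀) *ᶻ σ) (y *ᶻ (+ b *ᶻ x₀ -ᶻ a *ᶻ + Y) *ᶻ σ) ⟩
          ∣ + b *ᶻ (x₀ *ᶻ y -ᶻ x *ᶻ y₀) *ᶻ σ ∣ + ∣ y *ᶻ (+ b *ᶻ x₀ -ᶻ a *ᶻ + Y) *ᶻ σ ∣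
            ≡⟨ cong₂ _+_ (trans (∣*σ∣ (+ b *ᶻ (x₀ *ᶻ y -ᶻ x *ᶻ y₀))) (ℤ.abs-* (+ b) (x₀ *ᶻ y -ᶻ x *ᶻ y₀)))
                         (trans (∣*σ∣ (y *ᶻ (+ b *ᶻ x₀ -ᶻ a *ᶻ + Y))) (ℤ.abs-* y (+ b *ᶻ x₀ -ᶻ a *ᶻ + Y))) ⟩
          b * ∣ x₀ *ᶻ y -ᶻ x *ᶻ y₀ ∣ + ∣ y ∣ * D
            ≤⟨ +-monoˡ-≤ (∣ y ∣ * D) (*-monoʳ-≤ b (NiceList.detBound nice q₀∈ q∈)) ⟩
          b * k + ∣ y ∣ * D ∎
          where open ≤-Reasoning
        bound : E * ∣ h ∣ ≤ k
        bound = *-cancelˡ-≤ 2 (*-cancelˡ-≤ Y (*-cancelˡ-≤ E (begin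
          E * (Y * (2 * (E * ∣ h ∣)))               ≡⟨ e₁ E Y ∣ h ∣ ⟩
          E * (B * (Y * ∣ h ∣))                     ≤⟨ *-monoʳ-≤ E (*-monoʳ-≤ B Yh≤) ⟩
          E * (B * (b * k + ∣ y ∣ * D))             ≡⟨ e₂ E B b k ∣ y ∣ D ⟩
          E * B * (b * k) + E * (∣ y ∣ * (B * D))   ≤⟨ +-mono-≤ (*-monoʳ-≤ (E * B) (*-mono-≤ b≤B (<⇒≤ (≰⇒> tall))))
                                                         (*-monoʳ-≤ E (*-mono-≤ (low q∈) close)) ⟩
          E * B * (B * (E * Y)) + E * (k * Y)       ≡⟨ e₃ E Y k ⟩
          E * (Y * (4 * (E * (E * E)) + k))         ≤⟨ *-monoʳ-≤ E (*-monoʳ-≤ Y (+-monoˡ-≤ k k-large)) ⟩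
          E * (Y * (k + k))                         ≡⟨ cong (λ z → E * (Y * (k + z))) (sym (+-identityʳ k)) ⟩
          E * (Y * (2 * k))                         ∎)))
          where
          open ≤-Reasoning
          e₁ : ∀ E Y h → E * (Y * (2 * (E * h))) ≡ E * (2 * E * (Y * h))
          e₁ = solve-∀
          e₂ : ∀ E B b k y D → E * (B * (b * k + y * D)) ≡ E * B * (b * k) + E * (y * (B * D))
          e₂ = solve-∀
          e₃ : ∀ E Y k → E * (2 * E) * (2 * E * (E * Y)) + E * (k * Y) ≡ E * (Y * (4 * (E * (E * E)) + k))
          e₃ = solve-∀

    flatten : ∃[ ys ] NiceList k ys × length ys ≡ length xs × (∀ {x y} → (x , y) ∈ ys → E * ∣ y ∣ ≤ k)
    flatten =
      let σ , ∣σ∣≡1 , y₀σ≡ = unsign y₀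
          a , b , cop , b≤B , close = primitive-dirichlet x₀ Y B
      in flatten-along σ a b ∣σ∣≡1 y₀σ≡ cop b≤B close

  -- Taking any member as first basis vector turns all heights into determinants of the set, so they
  -- are at most k. If some E |y| still exceeds k, such a point is tall enough for `flatten`.
  reduce-heights : ∀ {xs} → NiceList k xs →
                   ∃[ ys ] NiceList k ys × length ys ≡ length xs × (∀ {x y} → (x , y) ∈ ys → E * ∣ y ∣ ≤ k)
  reduce-heights {[]} nice = [] , nice , refl , λ ()
  reduce-heights {xs@((a , b) ∷ _)} nice =
    let ys , nice′ , len , low = rebase a b (NiceList.coprime nice (here refl)) nice (_≤ k)
           (λ {x} {y} q∈ → subst (λ z → ∣ a *ᶻ y -ᶻ z ∣ ≤ k) (ℤ.*-comm x b) (NiceList.detBound nice (here refl) q∈))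
        zs , nice″ , len′ , flat = second ys nice′ low
    in zs , nice″ , trans len′ len , flat
    where
    second : ∀ ys → NiceList k ys → (∀ {x y} → (x , y) ∈ ys → ∣ y ∣ ≤ k) →
             ∃[ zs ] NiceList k zs × length zs ≡ length ys × (∀ {x y} → (x , y) ∈ zs → E * ∣ y ∣ ≤ k)
    second ys nice low with All.all? (λ p → E * ∣ proj₂ p ∣ ≤? k) ys
    ... | yes all = ys , nice , refl , All.lookup all
    ... | no ¬all =
      let (x₀ , y₀) , q₀∈ , tall = find (All.¬All⇒Any¬ (λ p → E * ∣ proj₂ p ∣ ≤? k) ys ¬all)
      in flatten x₀ y₀ nice low q₀∈ tall

-- The upper bound

pick : ℕ → List (ℤ × ℕ) → List ℤ
pick j []             = []
pick j ((x , y) ∷ ps) with y ≟ j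
... | yes _ = x ∷ pick j ps
... | no  _ = pick j ps

∈-pick⁻ : ∀ {j x} ps → x ∈ pick j ps → (x , j) ∈ ps
∈-pick⁻ {j} ((x , y) ∷ ps) x∈ with y ≟ j
∈-pick⁻ ((x , y) ∷ ps) (here refl) | yes refl = here refl
∈-pick⁻ ((x , y) ∷ ps) (there x∈)  | yes refl = there (∈-pick⁻ ps x∈)
∈-pick⁻ ((x , y) ∷ ps) x∈          | no _     = there (∈-pick⁻ ps x∈)

∈-pick⁺ : ∀ {j x} ps → (x , j) ∈ ps → x ∈ pick j ps
∈-pick⁺ {j} ((x , y) ∷ ps) x∈ with y ≟ j
∈-pick⁺ ((x , y) ∷ ps) (here refl) | yes _  = here refl
∈-pick⁺ ((x , y) ∷ ps) (there x∈)  | yes _  = there (∈-pick⁺ ps x∈)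
∈-pick⁺ ((x , y) ∷ ps) (here refl) | no y≢j = contradiction refl y≢j
∈-pick⁺ ((x , y) ∷ ps) (there x∈)  | no _   = ∈-pick⁺ ps x∈

pick-unique : ∀ j {ps} → Unique ps → Unique (pick j ps)
pick-unique j []                     = []
pick-unique j {(x , y) ∷ ps} (p∉ ∷ u) with y ≟ j
... | yes refl = All.tabulate (λ x′∈ x≡x′ → All.lookup p∉ (∈-pick⁻ ps x′∈) (cong (_, j) x≡x′)) ∷ pick-unique j u
... | no _     = pick-unique j u

length-pick : ∀ j x y ps → length (pick j ((x , y) ∷ ps)) ≡ δ y j + length (pick j ps)
length-pick j x y ps with y ≟ j
... | yes _ = refl
... | no  _ = refl

length≤∑pick : ∀ n ps → (∀ {x y} → (x , y) ∈ ps → y ≤ n) → length ps ≤ ∑ (suc n) (λ j → length (pick j ps))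
length≤∑pick n []             h = z≤n
length≤∑pick n ((x , y) ∷ ps) h = begin
  1 + length ps
    ≤⟨ +-mono-≤ (≤-trans (≤-reflexive (sym (indicator-yes (y ≟ y) refl))) (∑-term (suc n) (δ y) y (s≤s (h (here refl)))))
                (length≤∑pick n ps (h ∘ there)) ⟩
  ∑ (suc n) (δ y) + ∑ (suc n) (λ j → length (pick j ps))
    ≡⟨ sym (∑-+ (suc n) (δ y) _) ⟩
  ∑ (suc n) (λ j → δ y j + length (pick j ps))
    ≡⟨ ∑-cong (suc n) (λ j _ → sym (length-pick j x y ps)) ⟩
  ∑ (suc n) (λ j → length (pick j ((x , y) ∷ ps))) ∎
  where open ≤-Reasoning

maxHeight : ∀ (ps : List (ℤ × ℕ)) → ∃[ n ] (∀ {x y} → (x , y) ∈ ps → y ≤ n) × (n ≡ 0 ⊎ ∃[ x ] (x , n) ∈ ps)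
maxHeight [] = 0 , (λ ()) , inj₁ refl
maxHeight ((x , y) ∷ ps) with maxHeight ps
... | n , ≤n , top with ≤-total y n
...   | inj₁ y≤n = n , (λ { (here refl) → y≤n ; (there p∈) → ≤n p∈ }) , Sum.map₂ (λ (x′ , p∈) → x′ , there p∈) top
...   | inj₂ n≤y = y , (λ { (here refl) → ≤-refl ; (there p∈) → ≤-trans (≤n p∈) n≤y }) , inj₂ (x , here refl)

-- Folding a nice set into the half plane

up : ℤ² → ℤ × ℕ
up (x , + y)      = x , y
up (x , -[1+ y ]) = - x , suc y

up-sign : ∀ x y → ∃[ σ ] ∣ σ ∣ ≡ 1 × proj₁ (up (x , y)) ≡ σ *ᶻ x × + proj₂ (up (x , y)) ≡ σ *ᶻ y
up-sign x (+ y)      = + 1 , refl , sym (ℤ.*-identityˡ x) , sym (ℤ.*-identityˡ (+ y))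
up-sign x -[1+ y ]   = -[1+ 0 ] , refl , sym (ℤ.-1*i≡-i x) , sym (ℤ.-1*i≡-i -[1+ y ])

-- Folding identifies only equal or antipodal points, so on a nice list it is injective and no point
-- is lost.
up-kernel : ∀ x y x′ y′ → up (x , y) ≡ up (x′ , y′) → (x , y) ≡ (x′ , y′) ⊎ (x′ , y′) ≡ (- x , - y)
up-kernel x (+ y)      x′ (+ y′)      eq = inj₁ (cong₂ _,_ (cong proj₁ eq) (cong (+_ ∘ proj₂) eq))
up-kernel x (+ y)      x′ -[1+ y′ ]   eq with refl ← cong proj₂ eq =
  inj₂ (cong (_, -[1+ y′ ]) (trans (sym (ℤ.neg-involutive x′)) (cong -_ (sym (cong proj₁ eq)))))
up-kernel x -[1+ y ]   x′ (+ y′)      eq with refl ← cong proj₂ eq = inj₂ (cong (_, + suc y) (sym (cong proj₁ eq)))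
up-kernel x -[1+ y ]   x′ -[1+ y′ ]   eq with refl ← cong proj₂ eq = inj₁ (cong (_, -[1+ y ]) (ℤ.neg-injective (cong proj₁ eq)))

∣proj₂-up∣ : ∀ x y → proj₂ (up (x , y)) ≡ ∣ y ∣
∣proj₂-up∣ x (+ y)    = refl
∣proj₂-up∣ x -[1+ y ] = refl

∣proj₁-up∣ : ∀ x y → ∣ proj₁ (up (x , y)) ∣ ≡ ∣ x ∣
∣proj₁-up∣ x (+ y)    = refl
∣proj₁-up∣ x -[1+ y ] = ℤ.∣-i∣≡∣i∣ x

module _ {k : ℕ} {xs : List ℤ²} (nice : NiceList k xs) where
  open NiceList nice

  private
    ps : List (ℤ × ℕ)
    ps = map up xs

  up-unique : Unique ps
  up-unique = unique-map up inj unique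
    where
    inj : ∀ {p q} → p ∈ xs → q ∈ xs → up p ≡ up q → p ≡ q
    inj {x , y} {x′ , y′} p∈ q∈ eq with up-kernel x y x′ y′ eq
    ... | inj₁ p≡q  = p≡q
    ... | inj₂ refl = contradiction (noAntipodes p∈ q∈) λ ()

  up-coprime : ∀ {x j} → (x , j) ∈ ps → Coprime ∣ x ∣ j
  up-coprime p∈ with (x , y) , q∈ , refl ← ∈-map⁻ up p∈ =
    subst₂ Coprime (sym (∣proj₁-up∣ x y)) (sym (∣proj₂-up∣ x y)) (coprime q∈)

  up-detBound : ∀ {x j x′ j′} → (x , j) ∈ ps → (x′ , j′) ∈ ps → ∣ x *ᶻ + j′ -ᶻ x′ *ᶻ + j ∣ ≤ k
  up-detBound p∈ p′∈ with (x , y) , q∈ , refl ← ∈-map⁻ up p∈ | (x′ , y′) , q′∈ , refl ← ∈-map⁻ up p′∈ =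
    let σ , ∣σ∣≡1 , σx , σy = up-sign x y; σ′ , ∣σ′∣≡1 , σx′ , σy′ = up-sign x′ y′ in begin
    ∣ proj₁ (up (x , y)) *ᶻ + proj₂ (up (x′ , y′)) -ᶻ proj₁ (up (x′ , y′)) *ᶻ + proj₂ (up (x , y)) ∣
      ≡⟨ cong ∣_∣ (trans (cong₂ _-ᶻ_ (cong₂ _*ᶻ_ σx σy′) (cong₂ _*ᶻ_ σx′ σy)) (regroup σ σ′ x y x′ y′)) ⟩
    ∣ σ *ᶻ (σ′ *ᶻ (x *ᶻ y′ -ᶻ x′ *ᶻ y)) ∣
      ≡⟨ trans (∣unit∣ σ _ ∣σ∣≡1) (∣unit∣ σ′ _ ∣σ′∣≡1) ⟩
    ∣ x *ᶻ y′ -ᶻ x′ *ᶻ y ∣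
      ≤⟨ detBound q∈ q′∈ ⟩
    k ∎
    where
    open ≤-Reasoning
    regroup : ∀ σ σ′ x y x′ y′ → σ *ᶻ x *ᶻ (σ′ *ᶻ y′) -ᶻ σ′ *ᶻ x′ *ᶻ (σ *ᶻ y) ≡ σ *ᶻ (σ′ *ᶻ (x *ᶻ y′ -ᶻ x′ *ᶻ y))
    regroup = ℤ-Solver.solve-∀
    ∣unit∣ : ∀ σ z → ∣ σ ∣ ≡ 1 → ∣ σ *ᶻ z ∣ ≡ ∣ z ∣
    ∣unit∣ σ z eq = trans (ℤ.abs-* σ z) (trans (cong (_* ∣ z ∣) eq) (*-identityˡ ∣ z ∣))

  up-zero : ∀ {x} → x ∈ pick 0 ps → (x , + 0) ∈ xs
  up-zero x∈ with ∈-map⁻ up (∈-pick⁻ ps x∈)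
  ... | (_ , + 0) , q∈ , refl = q∈

  -- At height 0 coprimality forces x = 1 or x = -1, and the two are antipodal. Folding leaves
  -- height 0 untouched, so this has to be argued in the original list.
  bottom≤1 : length (pick 0 ps) ≤ 1
  bottom≤1 with pick 0 ps in eq | pick-unique 0 up-unique
  ... | []        | _ = z≤n
  ... | _ ∷ []    | _ = s≤s z≤n
  ... | x ∷ y ∷ _ | (x≢y ∷ _) ∷ _ = contradiction (antipodes x y (unit-or x (here refl)) (unit-or y (there (here refl))) x≢y) λ ()
    where
    member : ∀ {z} → z ∈ x ∷ y ∷ _ → (z , + 0) ∈ xs
    member z∈ = up-zero (subst (_ ∈_) (sym eq) z∈)
    unit-or : ∀ z → z ∈ x ∷ y ∷ _ → (z ≡ + 1 ⊎ z ≡ -[1+ 0 ]) × (z , + 0) ∈ xs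
    unit-or z z∈ = helper z (coprime (member z∈) (∣-refl , _ ∣0)) , member z∈
      where
      helper : ∀ z → ∣ z ∣ ≡ 1 → z ≡ + 1 ⊎ z ≡ -[1+ 0 ]
      helper (+ .1)      refl = inj₁ refl
      helper -[1+ zero ] refl = inj₂ refl
    antipodes : ∀ x y → (x ≡ + 1 ⊎ x ≡ -[1+ 0 ]) × (x , + 0) ∈ xs → (y ≡ + 1 ⊎ y ≡ -[1+ 0 ]) × (y , + 0) ∈ xs → x ≢ y → ⊥
    antipodes _ _ (inj₁ refl , _)  (inj₁ refl , _)  x≢y = x≢y refl
    antipodes _ _ (inj₂ refl , _)  (inj₂ refl , _)  x≢y = x≢y refl
    antipodes _ _ (inj₁ refl , p∈) (inj₂ refl , q∈) x≢y = noAntipodes p∈ q∈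
    antipodes _ _ (inj₂ refl , p∈) (inj₁ refl , q∈) x≢y = noAntipodes p∈ q∈

  levels : ∀ n → (∀ {x y} → (x , y) ∈ ps → y ≤ suc n) → (∃[ x ] (x , suc n) ∈ ps) → Levels k (suc n)
  levels n ≤n (x₀ , top∈) = record
    { level    = level
    ; unique   = unique′
    ; coprime  = λ {j} x∈ → up-coprime (∈-level⁻ j x∈)
    ; detBound = λ {i} {j} x∈ y∈ → up-detBound (∈-level⁻ i x∈) (∈-level⁻ j y∈)
    ; bottom   = refl
    ; top      = λ eq → contradiction (subst (x₀ ∈_) eq (∈-pick⁺ ps top∈)) λ ()
    ; above    = above
    }
    where
    level : ℕ → List ℤ
    -- Height 0 is left empty on purpose: its single possible point is added separately in
    -- `flat-bound`.
    level zero    = []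
    level (suc j) = pick (suc j) ps
    ∈-level⁻ : ∀ j {x} → x ∈ level j → (x , j) ∈ ps
    ∈-level⁻ (suc j) x∈ = ∈-pick⁻ ps x∈
    unique′ : ∀ j → Unique (level j)
    unique′ zero    = []
    unique′ (suc j) = pick-unique (suc j) up-unique
    above : ∀ {j} → suc n < j → level j ≡ []
    above {suc j} n<j with pick (suc j) ps in eq
    ... | []    = refl
    ... | x ∷ _ = contradiction (≤n (∈-pick⁻ ps (subst (x ∈_) (sym eq) (here refl)))) (<⇒≱ n<j)

  flat-bound : ∀ N → heightThreshold ≤ N → N ! * N ! * (N * N) ≤ k → 9 ≤ k →
               (∀ {x y} → (x , y) ∈ xs → aspectRatio * ∣ y ∣ ≤ k) → length xs ≤ closedForm k
  flat-bound N N-large k-large 9≤k low with maxHeight ps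
  ... | zero , ≤0 , _ = begin
    length xs                              ≡⟨ sym (length-map up xs) ⟩
    length ps                              ≤⟨ length≤∑pick 0 ps ≤0 ⟩
    length (pick 0 ps)                     ≤⟨ bottom≤1 ⟩
    1                                      ≤⟨ ≤-trans (s≤s z≤n) (m≤n+m 2 k) ⟩
    k + 2                                  ≤⟨ k+2≤closedForm k ⟩
    closedForm k                           ∎
    where open ≤-Reasoning
  ... | suc n , ≤n , inj₂ top∈ = begin
    length xs                                                     ≡⟨ sym (length-map up xs) ⟩
    length ps                                                     ≤⟨ length≤∑pick (suc n) ps ≤n ⟩
    ∑ (2 + n) (λ j → length (pick j ps))                          ≡⟨ ∑-head (suc n) (λ j → length (pick j ps)) ⟩
    length (pick 0 ps) + ∑ (suc n) (λ a → length (pick (suc a) ps)) ≤⟨ +-monoˡ-≤ _ bottom≤1 ⟩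
    1 + ∑ (suc n) (λ a → length (pick (suc a) ps))                ≤⟨ by-height n ls (top-low top∈) ⟩
    closedForm k                                                  ∎
    where
    open ≤-Reasoning
    ls : Levels k (suc n)
    ls = levels n ≤n top∈
    top-low : (∃[ x ] (x , suc n) ∈ ps) → aspectRatio * suc n ≤ k
    top-low (_ , p∈) with (x , y) , q∈ , eq ← ∈-map⁻ up p∈ =
      subst (λ j → aspectRatio * j ≤ k) (sym (trans (cong proj₂ eq) (∣proj₂-up∣ x y))) (low q∈)
    k-suffices : ∀ {C} → C ≤ k → 1 + C ≤ closedForm k
    k-suffices {C} C≤k = ≤-trans (s≤s C≤k) (≤-trans (≤-trans (n≤1+n (suc k)) (≤-reflexive (+-comm 2 k))) (k+2≤closedForm k))
    by-height : ∀ n (ls : Levels k (suc n)) → aspectRatio * suc n ≤ k →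
                1 + ∑ (suc n) (λ a → LevelBounds.c ls (suc a)) ≤ closedForm k
    by-height 0 ls _ = height-one ls
    by-height 1 ls _ = height-two ls
    by-height 2 ls _ = height-three ls 9≤k
    by-height (suc (suc (suc q))) ls En≤k with 4 + q ≤? N
    ... | yes n≤N = k-suffices (few-points-bounded-height N ls n≤N k-large)
    ... | no  n≰N = k-suffices (few-points-great-height ls (≤-trans N-large (<⇒≤ (≰⇒> n≰N))) En≤k)

upper-bound : ∀ N → heightThreshold ≤ N → ∀ {k} →
              N ! * N ! * (N * N) ≤ k → 9 ≤ k → 4 * (aspectRatio * (aspectRatio * aspectRatio)) ≤ k →
              ∀ {xs} → NiceList k xs → length xs ≤ closedForm k
upper-bound N N-large k-large 9≤k E³≤k nice =
  let ys , nice′ , len , low = reduce-heights aspectRatio {{aspectRatio≢0}} E³≤k nice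
  in ≤-trans (≤-reflexive (sym len)) (flat-bound nice′ N N-large k-large 9≤k low)

-- Constructions

∣∣≤ : ∀ {i k} → i ≤ᶻ + k → - i ≤ᶻ + k → ∣ i ∣ ≤ k
∣∣≤ {+ n}      i≤k _    = drop‿+≤+ i≤k
∣∣≤ { -[1+ n ]} _  -i≤k = drop‿+≤+ -i≤k

-- The determinant x j - x′ i grows with x and falls with x′, so it suffices to compare right ends
-- with left ends. Exchanging the two points covers the opposite sign. Height 0 admits only (1 , 0),
-- which excludes antipodes.
module Staircase {k : ℕ} (n : ℕ) (lo hi : ℕ → ℤ) (lo₀ : lo 0 ≡ + 1) (hi₀ : hi 0 ≡ + 1)
                 (fits : ∀ i j → i ≤ n → j ≤ n → hi i *ᶻ + j -ᶻ lo j *ᶻ + i ≤ᶻ + k) where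

  Shape : ℤ² → Set
  Shape (x , y) = ∃[ j ] j ≤ n × y ≡ + j × lo j ≤ᶻ x × x ≤ᶻ hi j × Coprime ∣ x ∣ j

  shape-det : ∀ {x i x′ j} → i ≤ n → j ≤ n → x ≤ᶻ hi i → lo j ≤ᶻ x′ → x *ᶻ + j -ᶻ x′ *ᶻ + i ≤ᶻ + k
  shape-det {x} {i} {x′} {j} i≤n j≤n x≤ ≤x′ = ℤ.≤-trans
    (ℤ.+-mono-≤ (ℤ.*-monoʳ-≤-nonNeg (+ j) x≤) (ℤ.neg-mono-≤ (ℤ.*-monoʳ-≤-nonNeg (+ i) ≤x′))) (fits i j i≤n j≤n)

  shape-nice : ∀ {xs} → All Shape xs → IsNice k (_∈ xs)
  shape-nice {xs} shapes = record
    { nonZero     = nonZero′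
    ; coprime     = coprime
    ; noAntipodes = noAntipodes
    ; detBound    = detBound
    }
    where
    nonZero′ : ∀ {x y} → (x , y) ∈ xs → (x , y) ≢ (0ℤ , 0ℤ)
    nonZero′ p∈ refl with _ , _ , refl , _ , _ , cop ← All.lookup shapes p∈ =
      contradiction (cop {2} ((2 ∣0) , (2 ∣0))) λ ()
    coprime : ∀ {x y} → (x , y) ∈ xs → gcdᶻ x y ≡ 1ℤ
    coprime p∈ with _ , _ , refl , _ , _ , cop ← All.lookup shapes p∈ = cong +_ (coprime⇒gcd≡1 cop)
    noAntipodes : ∀ x y → ¬ ((x , y) ∈ xs × (- x , - y) ∈ xs)
    noAntipodes x y (p∈ , q∈) with All.lookup shapes p∈ | All.lookup shapes q∈
    ... | zero , _ , refl , l , u , _ | zero , _ , _ , l′ , u′ , _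
      with refl ← ℤ.≤-antisym (subst (x ≤ᶻ_) hi₀ u) (subst (_≤ᶻ x) lo₀ l)
      with () ← subst (_≤ᶻ -[1+ 0 ]) lo₀ l′
    ... | suc _ , _ , refl , _ | _ , _ , () , _
    detBound : ∀ {x y x′ y′} → (x , y) ∈ xs → (x′ , y′) ∈ xs → ∣ x *ᶻ y′ -ᶻ x′ *ᶻ y ∣ ≤ k
    detBound {x} {_} {x′} p∈ q∈ with All.lookup shapes p∈ | All.lookup shapes q∈
    ... | i , i≤n , refl , l , u , _ | j , j≤n , refl , l′ , u′ , _ =
      ∣∣≤ (shape-det i≤n j≤n u l′) (subst (_≤ᶻ + k) (flip (x *ᶻ + j) (x′ *ᶻ + i)) (shape-det j≤n i≤n u′ l))
      where
      flip : ∀ a b → b -ᶻ a ≡ - (a -ᶻ b)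
      flip = ℤ-Solver.solve-∀

  attained-by : ∀ {s} xs → Unique xs → All Shape xs → length xs ≡ s → ∃[ Q ] IsNice k Q × HasSize Q s
  attained-by xs unique shapes len = (_∈ xs) , shape-nice shapes , xs , unique , (λ p → mk⇔ id id) , len

progression : ℤ → ℤ → ℕ → ℕ → List ℤ²
progression a d j s = applyUpTo (λ i → a +ᶻ + i *ᶻ d , + j) s

∈-progression⁻ : ∀ {a d j s p} → p ∈ progression a d j s → ∃[ i ] i < s × p ≡ (a +ᶻ + i *ᶻ d , + j)
∈-progression⁻ = ∈-applyUpTo⁻ _

progression-unique : ∀ a d j s → .{{_ : NonZero ∣ d ∣}} → Unique (progression a d j s)
progression-unique a d j s = applyUpTo⁺₁ _ s λ {i} {i′} i<i′ _ eq →
  <⇒≢ i<i′ (ℤ.+-injective (ℤ.*-cancelʳ-≡ (+ i) (+ i′) d (∙-cancel (cong proj₁ eq))))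
  where
  ∙-cancel : ∀ {u v} → a +ᶻ u ≡ a +ᶻ v → u ≡ v
  ∙-cancel {u} {v} eq = trans (sym (strip a u)) (trans (cong (λ z → - a +ᶻ z) eq) (strip a v))
    where
    strip : ∀ a u → - a +ᶻ (a +ᶻ u) ≡ u
    strip = ℤ-Solver.solve-∀

progression-length : ∀ a d j s → length (progression a d j s) ≡ s
progression-length a d j s = length-applyUpTo _ s

All-progression : ∀ {P : ℤ² → Set} a d j s → (∀ i → i < s → P (a +ᶻ + i *ᶻ d , + j)) → All P (progression a d j s)
All-progression a d j s h = All.applyUpTo⁺₁ _ s λ {i} i<s → h i i<s

heights-disjoint : ∀ {xs ys : List ℤ²} h → All (λ p → proj₂ p ≡ h) xs → All (λ p → proj₂ p ≢ h) ys → Disjoint xs ys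
heights-disjoint h all all′ (p∈ , p∈′) = All.lookup all′ p∈′ (All.lookup all p∈)

coprime-shift : ∀ a i j → Coprime ∣ a ∣ j → Coprime ∣ a +ᶻ + i *ᶻ + j ∣ j
coprime-shift a i j cop {d} (d∣x , d∣j) =
  cop (∣-unshift d (i * j) a (∣n⇒∣m*n i d∣j) (subst (λ z → d ∣ ∣ a +ᶻ z ∣) (sym (ℤ.pos-* i j)) d∣x) , d∣j)

coprime-1 : ∀ m → Coprime m 1
coprime-1 m (_ , d∣1) = ∣1⇒≡1 d∣1

coprime-+* : ∀ a q j → Coprime a j → Coprime (a + q * j) j
coprime-+* a q j cop = subst (λ z → Coprime ∣ + a +ᶻ z ∣ j) (sym (ℤ.pos-* q j)) (coprime-shift (+ a) q j cop)

-- The points (1 , 0) and (0 , 1) to (k , 1) already number k + 2. The vector (k , 2) has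
-- determinants 2x - k with (x , 1), all between -k and k, so for odd k it can be added as one more
-- primitive point.
module Flat (k : ℕ) (2≤k : 2 ≤ k) where

  private
    lo hi : ℕ → ℤ
    lo 0 = + 1
    lo 1 = + 0
    lo _ = + k
    hi 0 = + 1
    hi _ = + k
    fits : ∀ i j → i ≤ 2 → j ≤ 2 → hi i *ᶻ + j -ᶻ lo j *ᶻ + i ≤ᶻ + k
    fits 0 0 _ _ = +≤+ z≤n
    fits 0 1 _ _ = +≤+ (≤-trans (s≤s z≤n) 2≤k)
    fits 0 2 _ _ = subst (_≤ᶻ + k) (sym (e (+ k))) (+≤+ 2≤k)
      where
      e : ∀ k → + 2 -ᶻ k *ᶻ + 0 ≡ + 2
      e = ℤ-Solver.solve-∀
    fits 1 0 _ _ = subst (_≤ᶻ + k) (sym (e (+ k))) -≤+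
      where
      e : ∀ k → k *ᶻ + 0 -ᶻ + 1 ≡ -[1+ 0 ]
      e = ℤ-Solver.solve-∀
    fits 1 1 _ _ = ℤ.≤-reflexive (e (+ k))
      where
      e : ∀ k → k *ᶻ + 1 -ᶻ + 0 ≡ k
      e = ℤ-Solver.solve-∀
    fits 1 2 _ _ = ℤ.≤-reflexive (e (+ k))
      where
      e : ∀ k → k *ᶻ + 2 -ᶻ k *ᶻ + 1 ≡ k
      e = ℤ-Solver.solve-∀
    fits 2 0 _ _ = subst (_≤ᶻ + k) (sym (e (+ k))) -≤+
      where
      e : ∀ k → k *ᶻ + 0 -ᶻ + 2 ≡ -[1+ 1 ]
      e = ℤ-Solver.solve-∀
    fits 2 1 _ _ = ℤ.≤-reflexive (e (+ k))
      where
      e : ∀ k → k *ᶻ + 1 -ᶻ + 0 ≡ k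
      e = ℤ-Solver.solve-∀
    fits 2 2 _ _ = subst (_≤ᶻ + k) (sym (e (+ k))) (+≤+ z≤n)
      where
      e : ∀ k → k *ᶻ + 2 -ᶻ k *ᶻ + 2 ≡ + 0
      e = ℤ-Solver.solve-∀
    fits (suc (suc (suc _))) _ (s≤s (s≤s ())) _
    fits _ (suc (suc (suc _))) _ (s≤s (s≤s ()))

    open Staircase {k} 2 lo hi refl refl fits

    row₁ : List ℤ²
    row₁ = progression (+ 0) (+ 1) 1 (suc k)
    shapes₁ : All Shape row₁
    shapes₁ = All-progression (+ 0) (+ 1) 1 (suc k) λ i i≤k →
      1 , s≤s z≤n , refl , subst (+ 0 ≤ᶻ_) (sym (e (+ i))) (+≤+ z≤n) , subst (_≤ᶻ + k) (sym (e (+ i))) (+≤+ (s≤s⁻¹ i≤k)) , coprime-1 _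
      where
      e : ∀ i → + 0 +ᶻ i *ᶻ + 1 ≡ i
      e = ℤ-Solver.solve-∀
    base : List ℤ²
    base = (+ 1 , + 0) ∷ row₁
    shapes : All Shape base
    shapes = (0 , z≤n , refl , ℤ.≤-refl , ℤ.≤-refl , 1-coprimeTo 0) ∷ shapes₁
    height₁ : ∀ {p} → p ∈ row₁ → proj₂ p ≡ + 1
    height₁ p∈ with _ , _ , refl ← ∈-progression⁻ {+ 0} {+ 1} {1} {suc k} p∈ = refl
    base-unique : Unique base
    base-unique = All.tabulate (λ p∈ eq → contradiction (trans (cong proj₂ eq) (height₁ p∈)) λ ()) ∷ progression-unique (+ 0) (+ 1) 1 (suc k)
    base-length : length base ≡ 2 + k
    base-length = cong suc (progression-length (+ 0) (+ 1) 1 (suc k))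

  attained-even : ∃[ Q ] IsNice k Q × HasSize Q (k + 2)
  attained-even = attained-by base base-unique shapes (trans base-length (+-comm 2 k))

  attained-odd : Coprime k 2 → ∃[ Q ] IsNice k Q × HasSize Q (k + 3)
  attained-odd cop = attained-by ((+ k , + 2) ∷ base)
    (((λ ()) ∷ All.tabulate (λ p∈ eq → contradiction (trans (cong proj₂ eq) (height₁ p∈)) λ ())) ∷ base-unique)
    ((2 , ≤-refl , refl , ℤ.≤-refl , ℤ.≤-refl , cop) ∷ shapes)
    (trans (cong suc base-length) (+-comm 3 k))

-- Level j is the symmetric interval from -β j to β j. Given c = β 3, the other two are as large as
-- possible in 3 b₁ + c = k and 3 b₂ + 2 c = k - 1. Since k and c are 2 modulo 3 both divisions are
-- exact, and the ends of level 3 have residues 1 and 2, the best case of the count. The constraint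
-- 4 b₂ ≤ k is equivalent to r ≤ t + 1.
module Tall (t r : ℕ) (r≤1+t : r ≤ suc t) where

  private
    k c b₁ b₂ : ℕ
    k  = 18 * t + 6 * r + 14
    c  = 3 * t + 2
    b₁ = 5 * t + 4 + 2 * r
    b₂ = 4 * t + 3 + 2 * r
    β : ℕ → ℕ
    β 1 = b₁
    β 2 = b₂
    β _ = c
    lo hi : ℕ → ℤ
    lo 0       = + 1
    lo (suc j) = - + β (suc j)
    hi 0       = + 1
    hi (suc j) = + β (suc j)

    slack : ∀ {m} x → m + x ≡ k → m ≤ k
    slack {m} x eq = ≤-trans (m≤m+n m x) (≤-reflexive eq)

    fits-β : ∀ i j → i ≤ 2 → j ≤ 2 → β (suc i) * suc j + β (suc j) * suc i ≤ k
    fits-β 0 0 _ _ = slack (8 * t + 2 * r + 6) (e t r)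
      where
      e : ∀ t r → (5 * t + 4 + 2 * r) * 1 + (5 * t + 4 + 2 * r) * 1 + (8 * t + 2 * r + 6) ≡ 18 * t + 6 * r + 14
      e = solve-∀
    fits-β 0 1 _ _ = slack (4 * t + 3) (e t r)
      where
      e : ∀ t r → (5 * t + 4 + 2 * r) * 2 + (4 * t + 3 + 2 * r) * 1 + (4 * t + 3) ≡ 18 * t + 6 * r + 14
      e = solve-∀
    fits-β 0 2 _ _ = slack 0 (e t r)
      where
      e : ∀ t r → (5 * t + 4 + 2 * r) * 3 + (3 * t + 2) * 1 + 0 ≡ 18 * t + 6 * r + 14
      e = solve-∀
    fits-β 1 0 _ _ = slack (4 * t + 3) (e t r)
      where
      e : ∀ t r → (4 * t + 3 + 2 * r) * 1 + (5 * t + 4 + 2 * r) * 2 + (4 * t + 3) ≡ 18 * t + 6 * r + 14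
      e = solve-∀
    fits-β 1 1 _ _ = begin
      b₂ * 2 + b₂ * 2                           ≡⟨ e₁ t r ⟩
      16 * t + 6 * r + 12 + 2 * r               ≤⟨ +-monoʳ-≤ (16 * t + 6 * r + 12) (*-monoʳ-≤ 2 r≤1+t) ⟩
      16 * t + 6 * r + 12 + 2 * suc t           ≡⟨ e₂ t r ⟩
      k                                         ∎
      where
      open ≤-Reasoning
      e₁ : ∀ t r → (4 * t + 3 + 2 * r) * 2 + (4 * t + 3 + 2 * r) * 2 ≡ 16 * t + 6 * r + 12 + 2 * r
      e₁ = solve-∀
      e₂ : ∀ t r → 16 * t + 6 * r + 12 + 2 * suc t ≡ 18 * t + 6 * r + 14
      e₂ = solve-∀
    fits-β 1 2 _ _ = slack 1 (e t r)
      where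
      e : ∀ t r → (4 * t + 3 + 2 * r) * 3 + (3 * t + 2) * 2 + 1 ≡ 18 * t + 6 * r + 14
      e = solve-∀
    fits-β 2 0 _ _ = slack 0 (e t r)
      where
      e : ∀ t r → (3 * t + 2) * 1 + (5 * t + 4 + 2 * r) * 3 + 0 ≡ 18 * t + 6 * r + 14
      e = solve-∀
    fits-β 2 1 _ _ = slack 1 (e t r)
      where
      e : ∀ t r → (3 * t + 2) * 2 + (4 * t + 3 + 2 * r) * 3 + 1 ≡ 18 * t + 6 * r + 14
      e = solve-∀
    fits-β 2 2 _ _ = slack (6 * r + 2) (e t r)
      where
      e : ∀ t r → (3 * t + 2) * 3 + (3 * t + 2) * 3 + (6 * r + 2) ≡ 18 * t + 6 * r + 14
      e = solve-∀
    fits-β (suc (suc (suc _))) _ (s≤s (s≤s ())) _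
    fits-β _ (suc (suc (suc _))) _ (s≤s (s≤s ()))

    3≤k : 3 ≤ k
    3≤k = ≤-trans (m≤m+n 3 11) (m≤n+m 14 (18 * t + 6 * r))

    fits : ∀ i j → i ≤ 3 → j ≤ 3 → hi i *ᶻ + j -ᶻ lo j *ᶻ + i ≤ᶻ + k
    fits 0 0 _ _ = +≤+ z≤n
    fits 0 (suc j) _ j≤3 = subst (_≤ᶻ + k) (sym (e (+ suc j) (- + β (suc j)))) (+≤+ (≤-trans j≤3 3≤k))
      where
      e : ∀ j l → + 1 *ᶻ j -ᶻ l *ᶻ + 0 ≡ j
      e = ℤ-Solver.solve-∀
    fits (suc i) 0 _ _ = subst (_≤ᶻ + k) (sym (e (+ suc i) (+ β (suc i)))) -≤+
      where
      e : ∀ i h → h *ᶻ + 0 -ᶻ + 1 *ᶻ i ≡ - i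
      e = ℤ-Solver.solve-∀
    fits (suc i) (suc j) (s≤s i≤2) (s≤s j≤2) = subst (_≤ᶻ + k) (sym combine-β) (+≤+ (fits-β i j i≤2 j≤2))
      where
      e : ∀ b b′ i j → b *ᶻ j -ᶻ - b′ *ᶻ i ≡ b *ᶻ j +ᶻ b′ *ᶻ i
      e = ℤ-Solver.solve-∀
      combine-β : + β (suc i) *ᶻ + suc j -ᶻ - + β (suc j) *ᶻ + suc i ≡ + (β (suc i) * suc j + β (suc j) * suc i)
      combine-β = trans (e (+ β (suc i)) (+ β (suc j)) (+ suc i) (+ suc j))
        (sym (cong₂ _+ᶻ_ (ℤ.pos-* (β (suc i)) (suc j)) (ℤ.pos-* (β (suc j)) (suc i))))

    open Staircase {k} 3 lo hi refl refl fits

    row-shape : ∀ j a s → j ≤ 2 → a ≤ β (suc j) → ∀ d →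
                (∀ i → i < s → i * d ≤ a + β (suc j)) → (∀ i → Coprime ∣ - + a +ᶻ + i *ᶻ + d ∣ (suc j)) →
                All Shape (progression (- + a) (+ d) (suc j) s)
    row-shape j a s j≤2 a≤β d upper cop = All-progression (- + a) (+ d) (suc j) s λ i i<s →
      suc j , s≤s j≤2 , refl
      , ℤ.≤-trans (ℤ.neg-mono-≤ (+≤+ a≤β)) (subst (λ z → - + a ≤ᶻ - + a +ᶻ z) (ℤ.pos-* i d) (ℤ.i≤i+j (- + a) (+ (i * d))))
      , subst (- + a +ᶻ + i *ᶻ + d ≤ᶻ_) (e (+ a) (+ β (suc j)))
          (ℤ.+-monoʳ-≤ (- + a) (subst (_≤ᶻ + a +ᶻ + β (suc j)) (ℤ.pos-* i d) (+≤+ (upper i i<s))))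
      , cop i
      where
      e : ∀ a b → - a +ᶻ (a +ᶻ b) ≡ b
      e = ℤ-Solver.solve-∀

    step-coprime : ∀ a j → Coprime a j → ∀ i → Coprime ∣ - + a +ᶻ + i *ᶻ + j ∣ j
    step-coprime a j cop i = coprime-shift (- + a) i j (subst (λ m → Coprime m j) (sym (ℤ.∣-i∣≡∣i∣ (+ a))) cop)

    b₂-odd : Coprime b₂ 2
    b₂-odd = subst (λ m → Coprime m 2) (e t r) (coprime-+* 1 (2 * t + r + 1) 2 (1-coprimeTo 2))
      where
      e : ∀ t r → 1 + (2 * t + r + 1) * 2 ≡ 4 * t + 3 + 2 * r
      e = solve-∀

    c-coprime : Coprime c 3
    c-coprime = subst (λ m → Coprime m 3) (e t) (coprime-+* 2 t 3 (from-yes (coprime? 2 3)))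
      where
      e : ∀ t → 2 + t * 3 ≡ 3 * t + 2
      e = solve-∀

    c-1-coprime : Coprime (3 * t + 1) 3
    c-1-coprime = subst (λ m → Coprime m 3) (e t) (coprime-+* 1 t 3 (1-coprimeTo 3))
      where
      e : ∀ t → 1 + t * 3 ≡ 3 * t + 1
      e = solve-∀

    row₁ row₂ row₃ row₃′ : List ℤ²
    row₁  = progression (- + b₁) (+ 1) 1 (suc (b₁ + b₁))
    row₂  = progression (- + b₂) (+ 2) 2 (suc b₂)
    -- Level 3 as two residue classes modulo 3: `row₃` runs from -c to c - 1, `row₃′` from -(c - 1)
    -- to c.
    row₃  = progression (- + c) (+ 3) 3 (2 + 2 * t)
    row₃′ = progression (- + (3 * t + 1)) (+ 3) 3 (2 + 2 * t)

    shapes₁ : All Shape row₁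
    shapes₁ = row-shape 0 b₁ (suc (b₁ + b₁)) z≤n ≤-refl 1
      (λ i i< → ≤-trans (≤-reflexive (*-identityʳ i)) (s≤s⁻¹ i<)) (λ i → coprime-1 _)

    shapes₂ : All Shape row₂
    shapes₂ = row-shape 1 b₂ (suc b₂) (s≤s z≤n) ≤-refl 2
      (λ i i< → ≤-trans (*-monoˡ-≤ 2 (s≤s⁻¹ i<)) (≤-reflexive (e b₂))) (step-coprime b₂ 2 b₂-odd)
      where
      e : ∀ b → b * 2 ≡ b + b
      e = solve-∀

    shapes₃ : All Shape row₃
    shapes₃ = row-shape 2 c (2 + 2 * t) ≤-refl ≤-refl 3
      (λ i i< → ≤-trans (*-monoˡ-≤ 3 (s≤s⁻¹ i<)) (≤-trans (m≤m+n _ 1) (≤-reflexive (e t)))) (step-coprime c 3 c-coprime)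
      where
      e : ∀ t → suc (2 * t) * 3 + 1 ≡ 3 * t + 2 + (3 * t + 2)
      e = solve-∀

    shapes₃′ : All Shape row₃′
    shapes₃′ = row-shape 2 (3 * t + 1) (2 + 2 * t) ≤-refl (+-monoʳ-≤ (3 * t) (s≤s z≤n)) 3
      (λ i i< → ≤-trans (*-monoˡ-≤ 3 (s≤s⁻¹ i<)) (≤-reflexive (e t))) (step-coprime (3 * t + 1) 3 c-1-coprime)
      where
      e : ∀ t → suc (2 * t) * 3 ≡ 3 * t + 1 + (3 * t + 2)
      e = solve-∀

    row₃-disjoint : Disjoint row₃ row₃′
    row₃-disjoint (p∈ , p∈′)
      with i , _ , refl ← ∈-progression⁻ {a = - + c} {d = + 3} {j = 3} {s = 2 + 2 * t} p∈
         | i′ , _ , eq ← ∈-progression⁻ {a = - + (3 * t + 1)} {d = + 3} {j = 3} {s = 2 + 2 * t} p∈′ =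
      contradiction (trans (sym (m*n%n≡0 i 3)) (trans (cong (_% 3) i*3≡) ([m+kn]%n≡m%n 1 i′ 3))) λ ()
      where
      strip : ∀ c x → c +ᶻ (- c +ᶻ x) ≡ x
      strip = ℤ-Solver.solve-∀
      strip′ : ∀ d x → d +ᶻ + 2 +ᶻ (- (d +ᶻ + 1) +ᶻ x) ≡ + 1 +ᶻ x
      strip′ = ℤ-Solver.solve-∀
      i*3≡ : i * 3 ≡ 1 + i′ * 3
      i*3≡ = ℤ.+-injective (begin
        + (i * 3)                                              ≡⟨ ℤ.pos-* i 3 ⟩
        + i *ᶻ + 3                                             ≡⟨ sym (strip (+ c) (+ i *ᶻ + 3)) ⟩
        + c +ᶻ (- + c +ᶻ + i *ᶻ + 3)                           ≡⟨ cong (λ z → + c +ᶻ z) (cong proj₁ eq) ⟩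
        + c +ᶻ (- + (3 * t + 1) +ᶻ + i′ *ᶻ + 3)                ≡⟨ strip′ (+ (3 * t)) (+ i′ *ᶻ + 3) ⟩
        + 1 +ᶻ + i′ *ᶻ + 3                                     ≡⟨ cong (λ z → + 1 +ᶻ z) (sym (ℤ.pos-* i′ 3)) ⟩
        + (1 + i′ * 3)                                         ∎)
        where open ≡-Reasoning

    points : List ℤ²
    points = (+ 1 , + 0) ∷ row₁ ++ row₂ ++ row₃ ++ row₃′

    heights₁ : All (λ p → proj₂ p ≡ + 1) row₁
    heights₁ = All-progression (- + b₁) (+ 1) 1 (suc (b₁ + b₁)) λ _ _ → refl
    heights₂ : All (λ p → proj₂ p ≡ + 2) row₂
    heights₂ = All-progression (- + b₂) (+ 2) 2 (suc b₂) λ _ _ → refl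
    heights₃ : All (λ p → proj₂ p ≡ + 3) (row₃ ++ row₃′)
    heights₃ = All.++⁺ (All-progression (- + c) (+ 3) 3 (2 + 2 * t) λ _ _ → refl)
                       (All-progression (- + (3 * t + 1)) (+ 3) 3 (2 + 2 * t) λ _ _ → refl)

    other : ∀ {u v} → u ≢ v → ∀ {xs : List ℤ²} → All (λ p → proj₂ p ≡ u) xs → All (λ p → proj₂ p ≢ v) xs
    other u≢v = All.map λ { refl → u≢v }

    unique : Unique points
    unique =
      All.map (λ { h≢0 refl → h≢0 refl })
        (All.++⁺ (other {v = + 0} (λ ()) heights₁) (All.++⁺ (other (λ ()) heights₂) (other (λ ()) heights₃)))
      ∷ ++⁺ (progression-unique (- + b₁) (+ 1) 1 (suc (b₁ + b₁)))
          (++⁺ (progression-unique (- + b₂) (+ 2) 2 (suc b₂))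
            (++⁺ (progression-unique (- + c) (+ 3) 3 (2 + 2 * t)) (progression-unique (- + (3 * t + 1)) (+ 3) 3 (2 + 2 * t))
              row₃-disjoint)
            (heights-disjoint (+ 2) heights₂ (other (λ ()) heights₃)))
          (heights-disjoint (+ 1) heights₁ (All.++⁺ (other (λ ()) heights₂) (other (λ ()) heights₃)))

    size : length points ≡ k + 4
    size = begin
      1 + length (row₁ ++ row₂ ++ row₃ ++ row₃′)
        ≡⟨ cong suc (trans (length-++ row₁) (cong₂ _+_ (progression-length (- + b₁) (+ 1) 1 (suc (b₁ + b₁)))
             (trans (length-++ row₂) (cong₂ _+_ (progression-length (- + b₂) (+ 2) 2 (suc b₂))
               (trans (length-++ row₃) (cong₂ _+_ (progression-length (- + c) (+ 3) 3 (2 + 2 * t))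
                 (progression-length (- + (3 * t + 1)) (+ 3) 3 (2 + 2 * t)))))))) ⟩
      1 + (suc (b₁ + b₁) + (suc b₂ + (2 + 2 * t + (2 + 2 * t))))
        ≡⟨ e t r ⟩
      k + 4 ∎
      where
      open ≡-Reasoning
      e : ∀ t r → 1 + (suc ((5 * t + 4 + 2 * r) + (5 * t + 4 + 2 * r)) + (suc (4 * t + 3 + 2 * r) + (2 + 2 * t + (2 + 2 * t))))
          ≡ 18 * t + 6 * r + 14 + 4
      e = solve-∀

  attained-tall : ∃[ Q ] IsNice k Q × HasSize Q (k + 4)
  attained-tall = attained-by points unique
    ((0 , z≤n , refl , ℤ.≤-refl , ℤ.≤-refl , 1-coprimeTo 0)
     ∷ All.++⁺ shapes₁ (All.++⁺ shapes₂ (All.++⁺ shapes₃ shapes₃′))) size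

-- Attaining the closed form and assembling the bounds

NiceSize : ℕ → ℕ → Set₁
NiceSize k s = ∃[ Q ] IsNice k Q × HasSize Q s

-- For k = 6m + 2, division of m - 2 by 3 yields t and r. As r ≤ 2, the condition r ≤ t + 1 follows
-- from t ≥ 1, that is m ≥ 5, which is k ≥ 32.
k≡18t+6r+14 : ∀ k → 32 ≤ k → k % 6 ≡ 2 → ∃₂ λ t r → r ≤ suc t × 18 * t + 6 * r + 14 ≡ k
k≡18t+6r+14 k 32≤k k%6≡2 = t , r , ≤-trans (s≤s⁻¹ (m%n<n (m ∸ 2) 3)) (s≤s t≥1) , (begin
  18 * t + 6 * r + 14      ≡⟨ e t r ⟩
  2 + (2 + (r + t * 3)) * 6 ≡⟨ cong (λ z → 2 + (2 + z) * 6) (sym (m≡m%n+[m/n]*n (m ∸ 2) 3)) ⟩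
  2 + (2 + (m ∸ 2)) * 6    ≡⟨ cong₂ (λ x y → x + y * 6) (sym k%6≡2) (m+[n∸m]≡n (≤-trans (s≤s (s≤s z≤n)) m≥5)) ⟩
  k % 6 + k / 6 * 6        ≡⟨ sym (m≡m%n+[m/n]*n k 6) ⟩
  k                        ∎)
  where
  open ≡-Reasoning
  m t r : ℕ
  m = k / 6
  t = (m ∸ 2) / 3
  r = (m ∸ 2) % 3
  m≥5 : 5 ≤ m
  m≥5 = /-monoˡ-≤ 6 32≤k
  t≥1 : 1 ≤ t
  t≥1 = /-monoˡ-≤ 3 (∸-monoˡ-≤ 2 m≥5)
  e : ∀ t r → 18 * t + 6 * r + 14 ≡ 2 + (2 + (r + t * 3)) * 6
  e = solve-∀

attained : ∀ k → 32 ≤ k → NiceSize k (closedForm k)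
attained k 32≤k = subst (NiceSize k) (sym (closedForm-bonus k)) (by-residue (k % 6) refl)
  where
  open Flat k (≤-trans (s≤s (s≤s z≤n)) 32≤k)
  coprime-2 : ∀ r → k % 6 ≡ r → Coprime r 2 → Coprime k 2
  coprime-2 r eq cop = subst (λ m → Coprime m 2)
    (trans (trans (cong (λ z → r + z) (*-assoc (k / 6) 3 2)) (cong (_+ k / 6 * 6) (sym eq))) (sym (m≡m%n+[m/n]*n k 6)))
    (coprime-+* r (k / 6 * 3) 2 cop)
  by-residue : ∀ r → k % 6 ≡ r → NiceSize k (k + bonus r)
  by-residue 0 _  = attained-even
  by-residue 1 eq = attained-odd (coprime-2 1 eq (from-yes (coprime? 1 2)))
  by-residue 2 eq = let t , r , r≤1+t , k≡ = k≡18t+6r+14 k 32≤k eq in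
    subst (λ k → NiceSize k (k + 4)) k≡ (Tall.attained-tall t r r≤1+t)
  by-residue 3 eq = attained-odd (coprime-2 3 eq (from-yes (coprime? 3 2)))
  by-residue 4 _  = attained-even
  by-residue 5 eq = attained-odd (coprime-2 5 eq (from-yes (coprime? 5 2)))
  by-residue (suc (suc (suc (suc (suc (suc _)))))) _ = attained-even

niceList : ∀ {k Q xs} → IsNice k Q → Unique xs → All Q xs → NiceList k xs
niceList nice unique all = record
  { unique      = unique
  ; coprime     = λ p∈ → gcd≡1⇒coprime (ℤ.+-injective (coprime (All.lookup all p∈)))
  ; noAntipodes = λ {x} {y} p∈ q∈ → noAntipodes x y (All.lookup all p∈ , All.lookup all q∈)
  ; detBound    = λ p∈ q∈ → detBound (All.lookup all p∈) (All.lookup all q∈)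
  }
  where open IsNice nice

theorem20 : ∃[ k₀ ] (∀ (k : ℕ) .{{_ : NonZero k}} → k₀ ≤ k → IsMaxNiceSize k (closedForm k))
theorem20 = A + (B + 32) , λ k k₀≤k → record
  { attained   = attained k (≤-trans (≤-trans (m≤n+m 32 B) (m≤n+m (B + 32) A)) k₀≤k)
  ; upperBound = λ Q nice xs unique all → upper-bound N ≤-refl
      (≤-trans (m≤m+n A (B + 32)) k₀≤k)
      (≤-trans (m≤m+n 9 23) (≤-trans (≤-trans (m≤n+m 32 B) (m≤n+m (B + 32) A)) k₀≤k))
      (≤-trans (≤-trans (m≤m+n B 32) (m≤n+m (B + 32) A)) k₀≤k)
      (niceList nice unique all)
  }
  where
  N A B : ℕ
  -- The two ranges of heights from 4 on meet here: up to N the Farey bound applies, at the price of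
  -- k ≥ A, and beyond N the dense bound. B is what flattening requires, and 32 serves both the
  -- construction and `9 ≤ k`.
  N = heightThreshold
  A = N ! * N ! * (N * N)
  B = 4 * (aspectRatio * (aspectRatio * aspectRatio))
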